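{- For each of the seven concrete Catalan families listed in the context, let $\varphi$ be the canonical bijection from rooted plane trees to that family. Then for every plane tree $t$ of size $n$, the canonical statistics transport to native statistics as follows, where the identities for $\mathrm{sub}$ and $\mathrm{rpath}$ hold for all $n\ge 0$ and those for $\mathrm{leaves}$ and $\mathrm{internal}$ hold for all $n\ge 1$. The quadruple $(\mathrm{sub}(t),\mathrm{rpath}(t),\mathrm{leaves}(t),\mathrm{internal}(t))$ equals, evaluated at $\varphi(t)$, (1) $(\mathrm{comp},\mathrm{rcomp},\mathrm{peak},\mathrm{nonpeak})$ on Dyck paths; (2) $(\mathrm{comp},\mathrm{rcomp},\mathrm{tr},\mathrm{nontr})$ on triangulations; (3) $(\mathrm{comp},\mathrm{rmax},\mathrm{rmin},\mathrm{nonrmin})$ on $231$-avoiding permutations; (4) $(\mathrm{comp},\mathrm{rcomp},\mathrm{rmin},\mathrm{nonrmin})$ on $321$-avoiding permutations; (5) $(\mathrm{comp},\mathrm{rcomp},\mathrm{redge},\mathrm{ledge})$ on binary trees; (6) $(\mathrm{comp},\mathrm{rcomp},\mathrm{noncons},\mathrm{cons})$ on $2\times n$ standard Young tableaux; (7) $(\mathrm{comp},\mathrm{rcomp},\mathrm{blocks},\mathrm{nonmin})$ on non-crossing partitions.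
   Context: A Catalan structure is a quadruple $(C,e,\lambda,\oplus)$ where $C=\bigsqcup_{n\ge 0}C_n$ with $C_0=\{e\}$ ($|t|=n$ for $t\in C_n$), $\lambda\colon C_n\to C_{n+1}$, $\oplus\colon C_m\times C_n\to C_{m+n}$, $\oplus$ is associative with two-sided identity $e$, and every $t\in C$ can be written uniquely in exactly one of three forms: $t=e$; $t=\lambda(s)$ (indecomposable); $t=u\oplus v$ with $u$ indecomposable and $v\neq e$ (decomposable). The canonical bijection $\varphi\colon A\to B$ between two Catalan structures is the map determined by $\varphi(e_A)=e_B$, $\varphi(\lambda_A(t))=\lambda_B(\varphi(t))$, $\varphi(u\oplus_A v)=\varphi(u)\oplus_B\varphi(v)$. Rooted plane trees, written as lists of children, form a Catalan structure with $e=[\,]$ (single node), $\lambda(T)=[T]$, $\oplus$ = concatenation of child lists, size = number of edges. The canonical statistics on plane trees are given by (in each clause for $u\oplus v$ both $u,v\ne e$): $\mathrm{leaves}(e)=1$, $\mathrm{leaves}(\lambda(t))=\mathrm{leaves}(t)$, $\mathrm{leaves}(u\oplus v)=\mathrm{leaves}(u)+\mathrm{leaves}(v)$; $\mathrm{internal}(e)=0$, $\mathrm{internal}(\lambda(t))=1+\mathrm{internal}(t)$, $\mathrm{internal}(u\oplus v)=\mathrm{internal}(u)+\mathrm{internal}(v)-1$; $\mathrm{sub}(e)=0$, $\mathrm{sub}(\lambda(t))=1$, $\mathrm{sub}(u\oplus v)=\mathrm{sub}(u)+\mathrm{sub}(v)$; $\mathrm{rpath}(e)=0$, $\mathrm{rpath}(\lambda(t))=1+\mathrm{rpath}(t)$,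 $\mathrm{rpath}(u\oplus v)=\mathrm{rpath}(v)$. Each family below is a Catalan structure with the stated $e,\lambda,\oplus$. (1) Dyck paths of semilength $n$ as words in $u,d$: $e=\epsilon$, $\lambda(w)=uwd$, $w_1\oplus w_2=w_1w_2$. comp = number of returns to the $x$-axis; rcomp = length of the final run of $d$'s; peak = number of factors $ud$; nonpeak = $1$ + number of factors $uu$. (2) Triangulations of the convex $(n+2)$-gon with vertices labeled $1,\dots,n+2$ clockwise (size $n$; size $0$ is the single edge $(1,2)$, which is $e$). $\lambda(T)$: relabel $i\mapsto i+1$ in $T$ (size $n$) and add a new vertex $1$ adjacent to $2$ and $n+3$. $T_1\oplus T_2$ (with $|T_1|=n_1$): identify the edge $(1,n_1+2)$ of $T_1$ with the edge $(1,2)$ of $T_2$, so vertex $1$ of $T_2$ stays $1$ and vertex $j\ge 2$ of $T_2$ becomes $n_1+j$. Edges include boundary edges. comp = (number of edges incident to $1$) $-1$; rcomp = (number of edges incident to $n+2$) $-1$; tr = number of $i\in\{2,\dots,n+1\}$ such that some $j<i$ is adjacent to both $i$ and $i+1$; nontr $=n+1-\mathrm{tr}$. (3) $231$-avoiding permutations of $[n]$: $e=\epsilon$, $\lambda(\pi)=(n+1)\pi$ (prepend a new maximum), $\oplus$ = direct sum ($\pi_1\oplus\pi_2=\pi_1\pi_2'$ with $\pi_2'(i)=\pi_2(i)+|\pi_1|$). comp = number of direct-sum components; rmax = number of right-to-left maxima; rmin = number of right-to-left minima; nonrmin = $1$ + number of entries that are not right-to-left minima. (4) $321$-avoiding permutations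 of $[n]$: $e=\epsilon$, $\oplus$ = direct sum, $\lambda(\epsilon)=1$, and for $n\ge 1$, $\lambda(\pi)$ is obtained as follows: let $i$ be the position of $1$ in $\pi$; box the positions to the right of $i$ that are left-to-right maxima but not right-to-left minima of $\pi$; insert $n+1$ at position $i$ (shifting later entries, and boxes, one place right) and box this position too; then cyclically shift the values at the boxed positions one step to the left (each boxed value moves to the previous boxed position, the first wraps to the last). comp = number of direct-sum components; rcomp $=n-\pi(n)+1$ for $n\ge 1$ and $\mathrm{rcomp}(\epsilon)=0$; rmin, nonrmin as in (3). (5) Binary trees with $n$ nodes: either $\varnothing$ or $(L,R)$ with $L,R$ binary trees. $e=\varnothing$, $\lambda(T)=(T,\varnothing)$, $\varnothing\oplus B=B$, $(T,B_1)\oplus B_2=(T,B_1\oplus B_2)$. The right spine is the maximal sequence of nodes reached from the root along right edges. comp = number of nodes on the right spine; rcomp = number of iterations needed to reach $\varnothing$ when repeatedly replacing the tree by the left subtree of the last node of its right spine; redge = $1$ + number of edges from a node to a nonempty right child; ledge $=n+1-\mathrm{redge}$. (6) $2\times n$ standard Young tableaux: $e$ = empty tableau; $\lambda(T)$ ($T$ of size $n$): increase all entries by $1$, prepend $1$ to the top row and append $2n+2$ to the bottom row; $T_1\oplus T_2$: add $2|T_1|$ to all entries of $T_2$ and adjoin its columns to the right of $T_1$. comp = number of $k\in\{1,\dots,n\}$ such that the first $k$ columns contain exactly $\{1,\dots,2k\}$; rcomp = largest $k$ such that the last $k$ bottom-row entries, read right to left, are $2n,2n-1,\dots,2n-k+1$;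 cons = $1$ + number of top-row entries $i$ with $i+1$ in the top row; noncons = number of top-row entries $i$ with $i+1$ in the bottom row. (7) Non-crossing partitions of $[n]$: $e$ = empty partition; $\lambda(P)$: add $n+1$ to the block containing $1$ (and $\lambda(e)=\{\{1\}\}$); $P_1\oplus P_2=P_1\cup(P_2+|P_1|)$. comp = number of indecomposable summands (equivalently, number of $k\in\{1,\dots,n\}$ such that $[k]$ is a union of blocks); rcomp = number of right-to-left maxima of the flattened form, i.e. the word listing each block in decreasing order, with blocks sorted by minimal element; blocks = number of blocks; nonmin $=n+1-\mathrm{blocks}$. -}

module Defs where

open import Data.Bool.Base using (Bool; true; false; if_then_else_)
open import Data.Empty using (⊥; ⊥-elim)
open import Data.List.Base using (List; []; _∷_; [_]; _++_; length; map; filter; applyUpTo; upTo; take; last; reverse; takeWhile; concat)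
open import Data.List.Properties using (length-map; length-++; length-applyUpTo; applyUpTo-∷ʳ; map-applyUpTo; map-++; ≡-dec; concat-++; concat-map)
open import Data.List.Membership.Propositional using (_∈_; _∉_)
open import Data.List.Membership.Propositional.Properties using (∈-map⁺; ∈-map⁻; ∈-++⁺ˡ; ∈-++⁺ʳ; ∈-++⁻)
import Data.List.Membership.DecPropositional as DecMembership
open import Data.List.Relation.Binary.Permutation.Propositional using (_↭_; prep; swap; ↭-refl; ↭-sym; ↭-trans; ↭-reflexive)
open import Data.List.Relation.Binary.Permutation.Propositional.Properties using (All-resp-↭; ↭-length; ++⁺; ++⁺ˡ; ++⁺ʳ; ++-assoc; shift; shifts) renaming (map⁺ to ↭-map⁺)
import Data.List.Relation.Binary.Permutation.Propositional.Properties as ↭P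
open import Data.List.Relation.Binary.Pointwise.Base using (Pointwise; []; _∷_)
import Data.List.Relation.Binary.Pointwise as PW
open import Data.List.Relation.Binary.Sublist.Propositional using (_⊆_; []; _∷_; _∷ʳ_; to∈; ⊆-refl)
import Data.List.Relation.Binary.Sublist.Propositional as Sub
import Data.List.Relation.Binary.Sublist.Propositional.Properties as SubP
open import Data.List.Relation.Unary.All using (All; []; _∷_; all?)
import Data.List.Relation.Unary.All as All
import Data.List.Relation.Unary.All.Properties as AllP
open import Data.List.Relation.Unary.AllPairs using (AllPairs; []; _∷_)
import Data.List.Relation.Unary.AllPairs as AllPairs
import Data.List.Relation.Unary.AllPairs.Properties as AllPairsP
open import Data.List.Relation.Unary.Any using (here; there)
open import Data.Maybe.Base using (maybe′)
open import Data.Nat.Base using (ℕ; zero; suc; _+_; _*_; _∸_; _≤_; _<_; _>_; z≤n; s≤s; s≤s⁻¹)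
open import Data.Nat.Properties
open import Data.Product.Base using (∃; ∃₂; _×_; _,_; proj₁; proj₂)
import Data.Product.Properties as ×P
open import Data.Sum.Base using (_⊎_; inj₁; inj₂)
open import Relation.Binary.Definitions using (DecidableEquality)
open import Relation.Binary.PropositionalEquality using (_≡_; _≢_; refl; sym; trans; cong; cong₂; subst)
open import Relation.Nullary.Decidable using (Dec; yes; no; does; ¬?; _×-dec_; _⊎-dec_; dec-false)
open import Relation.Nullary.Negation using (¬_)
open import Relation.Unary using (Decidable)

open DecMembership _≟_ using (_∈?_)

record CatalanOperations : Set₁ where
  infixr 6 _⊕_
  field
    Carrier : Set
    ∣_∣     : Carrier → ℕ
    e       : Carrier
    ƛ       : Carrier → Carrier
    _⊕_     : Carrier → Carrier → Carrier

data PlaneTree : Set where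
  node : List PlaneTree → PlaneTree

module PlaneTrees where

  size : PlaneTree → ℕ
  size (node [])       = 0
  size (node (t ∷ ts)) = suc (size t) + size (node ts)

  _⊕_ : PlaneTree → PlaneTree → PlaneTree
  node ts ⊕ node us = node (ts ++ us)

  operations : CatalanOperations
  operations = record
    { Carrier = PlaneTree ; ∣_∣ = size ; e = node [] ; ƛ = λ t → node (t ∷ []) ; _⊕_ = _⊕_ }

  -- A tree with children t ∷ u ∷ us is ƛ t ⊕ node (u ∷ us), so the clauses
  -- below are those for e, for ƛ t, and for a decomposable tree with first
  -- summand ƛ t.
  leaves : PlaneTree → ℕ
  leaves (node [])           = 1
  leaves (node (t ∷ []))     = leaves t
  leaves (node (t ∷ u ∷ us)) = leaves t + leaves (node (u ∷ us))

  -- Truncated subtraction is exact here: the minuend is a successor.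
  internal : PlaneTree → ℕ
  internal (node [])           = 0
  internal (node (t ∷ []))     = 1 + internal t
  internal (node (t ∷ u ∷ us)) = (1 + internal t) + internal (node (u ∷ us)) ∸ 1

  sub : PlaneTree → ℕ
  sub (node [])           = 0
  sub (node (t ∷ []))     = 1
  sub (node (t ∷ u ∷ us)) = 1 + sub (node (u ∷ us))

  rpath : PlaneTree → ℕ
  rpath (node [])           = 0
  rpath (node (t ∷ []))     = 1 + rpath t
  rpath (node (t ∷ u ∷ us)) = rpath (node (u ∷ us))

module _ (B : CatalanOperations) where
  private module B = CatalanOperations B

  φ : PlaneTree → B.Carrier
  φ (node [])           = B.e
  φ (node (t ∷ []))     = B.ƛ (φ t)
  φ (node (t ∷ u ∷ us)) = B.ƛ (φ t) B.⊕ φ (node (u ∷ us))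

-- One equation for each of the three forms e, ƛ s, u ⊕ v (u = ƛ s, v ≢ e) of
-- an element of A; together they determine f.
record IsCanonical (A B : CatalanOperations)
                   (f : CatalanOperations.Carrier A → CatalanOperations.Carrier B) : Set where
  private
    module A = CatalanOperations A
    module B = CatalanOperations B
  field
    e-homo : f A.e ≡ B.e
    ƛ-homo : ∀ t → f (A.ƛ t) ≡ B.ƛ (f t)
    ⊕-homo : ∀ s v → v ≢ A.e → f (A.ƛ s A.⊕ v) ≡ f (A.ƛ s) B.⊕ f v

φ-isCanonical : ∀ B → IsCanonical PlaneTrees.operations B (φ B)
φ-isCanonical B = record { e-homo = refl ; ƛ-homo = λ _ → refl ; ⊕-homo = ⊕-homo }
  where
  open CatalanOperations B
  ⊕-homo : ∀ s v → v ≢ node [] →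
           φ B (node (s ∷ []) PlaneTrees.⊕ v) ≡ φ B (node (s ∷ [])) ⊕ φ B v
  ⊕-homo s (node [])       v≢e = ⊥-elim (v≢e refl)
  ⊕-homo s (node (u ∷ us)) v≢e = refl

range : ℕ → List ℕ
range n = applyUpTo suc n

count : {A : Set} {P : A → Set} → Decidable P → List A → ℕ
count P? xs = length (filter P? xs)

largest : {P : ℕ → Set} → Decidable P → ℕ → ℕ
largest P? zero    = zero
largest P? (suc n) = if does (P? (suc n)) then suc n else largest P? n

SameElements : List ℕ → List ℕ → Set
SameElements xs ys = All (_∈ ys) xs × All (_∈ xs) ys

sameElements? : ∀ xs ys → Dec (SameElements xs ys)
sameElements? xs ys = all? (_∈? ys) xs ×-dec all? (_∈? xs) ys

countEntries : {P : ℕ → List ℕ → Set} → (∀ x xs → Dec (P x xs)) → List ℕ → ℕ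
countEntries P? []       = 0
countEntries P? (x ∷ xs) =
  (if does (P? x xs) then 1 else 0) + countEntries P? xs

RLMax RLMin : ℕ → List ℕ → Set
RLMax x later = All (_< x) later
RLMin x later = All (x <_) later

rlMax? : ∀ x later → Dec (RLMax x later)
rlMax? x later = all? (_<? x) later

rlMin? : ∀ x later → Dec (RLMin x later)
rlMin? x later = all? (x <?_) later

range-+ : ∀ m n → range (m + n) ≡ range m ++ map (m +_) (range n)
range-+ m n = trans (go suc m n) (cong (range m ++_) (lem m n))
  where
  go : ∀ (f : ℕ → ℕ) m n → applyUpTo f (m + n) ≡ applyUpTo f m ++ applyUpTo (λ i → f (m + i)) n
  go f zero    n = refl
  go f (suc m) n = cong (f 0 ∷_) (go (λ i → f (suc i)) m n)
  cong-applyUpTo : ∀ {f g : ℕ → ℕ} n → (∀ i → f i ≡ g i) → applyUpTo f n ≡ applyUpTo g n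
  cong-applyUpTo zero    f≗g = refl
  cong-applyUpTo (suc n) f≗g = cong₂ _∷_ (f≗g 0) (cong-applyUpTo n (λ i → f≗g (suc i)))
  lem : ∀ m n → applyUpTo (λ i → suc (m + i)) n ≡ map (m +_) (range n)
  lem m n = trans (cong-applyUpTo n (λ i → sym (+-suc m i))) (sym (map-applyUpTo suc (m +_) n))

range-suc : ∀ n → suc n ∷ range n ↭ range (suc n)
range-suc n = ↭-trans (↭P.∷↭∷ʳ (suc n) (range n)) (↭-reflexive (applyUpTo-∷ʳ suc n))

length-range : ∀ n → length (range n) ≡ n
length-range = length-applyUpTo suc

All-range : ∀ n → All (λ x → 1 ≤ x × x ≤ n) (range n)
All-range n = AllP.applyUpTo⁺₁ suc n (λ i<n → s≤s z≤n , i<n)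

All-perm : ∀ {w} n → w ↭ range n → All (λ x → 1 ≤ x × x ≤ n) w
All-perm n p = All-resp-↭ (↭-sym p) (All-range n)

range-unique : ∀ n → AllPairs _≢_ (range n)
range-unique n = AllPairsP.applyUpTo⁺₁ suc n (λ i<j _ eq → <⇒≢ i<j (suc-injective eq))

unique-↭ : ∀ {xs ys : List ℕ} → xs ↭ ys → AllPairs _≢_ xs → AllPairs _≢_ ys
unique-↭ _↭_.refl u = u
unique-↭ (prep x p) (x∉ ∷ u) = All-resp-↭ p x∉ ∷ unique-↭ p u
unique-↭ (swap x y p) ((x≢y ∷ x∉) ∷ y∉ ∷ u) =
  ((λ eq → x≢y (sym eq)) ∷ All-resp-↭ p y∉) ∷ All-resp-↭ p x∉ ∷ unique-↭ p u
unique-↭ (_↭_.trans p q) u = unique-↭ q (unique-↭ p u)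

⊆-++⁻ : {A : Set} (xs : List A) {ys zs : List A} → zs ⊆ xs ++ ys →
        ∃₂ λ us vs → zs ≡ us ++ vs × us ⊆ xs × vs ⊆ ys
⊆-++⁻ []       {zs = zs} τ = [] , zs , refl , [] , τ
⊆-++⁻ (x ∷ xs) (.x ∷ʳ τ) with us , vs , eq , σ , ρ ← ⊆-++⁻ xs τ =
  us , vs , eq , x ∷ʳ σ , ρ
⊆-++⁻ (x ∷ xs) (refl ∷ τ) with us , vs , eq , σ , ρ ← ⊆-++⁻ xs τ =
  x ∷ us , vs , cong (x ∷_) eq , refl ∷ σ , ρ

AllPairs-resp-⊆ : {A : Set} {R : A → A → Set} {xs ys : List A} →
                  xs ⊆ ys → AllPairs R ys → AllPairs R xs
AllPairs-resp-⊆ []         []       = []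
AllPairs-resp-⊆ (y ∷ʳ τ)   (_ ∷ ps) = AllPairs-resp-⊆ τ ps
AllPairs-resp-⊆ (refl ∷ τ) (p ∷ ps) = SubP.All-resp-⊆ τ p ∷ AllPairs-resp-⊆ τ ps

⊆-map⁻ : {A B : Set} (f : A → B) (ys : List A) {zs : List B} → zs ⊆ map f ys →
         ∃ λ zs′ → zs ≡ map f zs′ × zs′ ⊆ ys
⊆-map⁻ f []       []          = [] , refl , []
⊆-map⁻ f (y ∷ ys) (._ ∷ʳ τ) with zs′ , eq , σ ← ⊆-map⁻ f ys τ = zs′ , eq , y ∷ʳ σ
⊆-map⁻ f (y ∷ ys) (refl ∷ τ) with zs′ , eq , σ ← ⊆-map⁻ f ys τ =
  y ∷ zs′ , cong (f y ∷_) eq , refl ∷ σ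

module DyckPaths where

  data Step : Set where
    u d : Step

  _≟ˢ_ : DecidableEquality Step
  u ≟ˢ u = yes refl
  u ≟ˢ d = no λ ()
  d ≟ˢ u = no λ ()
  d ≟ˢ d = yes refl

  -- DyckFrom h w: started at height h, the path w stays weakly above the
  -- x-axis and ends on it.
  data DyckFrom : ℕ → List Step → Set where
    stop : DyckFrom 0 []
    up   : ∀ {h w} → DyckFrom (suc h) w → DyckFrom h (u ∷ w)
    down : ∀ {h w} → DyckFrom h w → DyckFrom (suc h) (d ∷ w)

  record DyckPath : Set where
    field
      word   : List Step
      isDyck : DyckFrom 0 word

  open DyckPath

  append : ∀ {h w} k {v} → DyckFrom h w → DyckFrom k v → DyckFrom (h + k) (w ++ v)
  append k stop     q = q
  append k (up p)   q = up (append k p q)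
  append k (down p) q = down (append k p q)

  semilength : DyckPath → ℕ
  semilength p = count (u ≟ˢ_) (word p)

  operations : CatalanOperations
  operations = record
    { Carrier = DyckPath
    ; ∣_∣     = semilength
    ; e       = record { word = [] ; isDyck = stop }
    ; ƛ       = λ p → record
      { word   = u ∷ word p ++ [ d ]
      ; isDyck = up (append 1 (isDyck p) (down stop))
      }
    ; _⊕_     = λ p q → record
      { word   = word p ++ word q
      ; isDyck = append 0 (isDyck p) (isDyck q)
      }
    }

  -- The first argument is the current height; a down step at height 0 does
  -- not occur in a Dyck path.
  returns : ℕ → List Step → ℕ
  returns h             []      = 0
  returns h             (u ∷ w) = returns (suc h) w
  returns 0             (d ∷ w) = returns 0 w
  returns 1             (d ∷ w) = suc (returns 0 w)
  returns (suc (suc h)) (d ∷ w) = returns (suc h) w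

  factors : Step → Step → List Step → ℕ
  factors x y []          = 0
  factors x y (a ∷ [])    = 0
  factors x y (a ∷ b ∷ w) =
    (if does ((a ≟ˢ x) ×-dec (b ≟ˢ y)) then 1 else 0) + factors x y (b ∷ w)

  comp rcomp peak nonpeak : DyckPath → ℕ
  comp p    = returns 0 (word p)
  rcomp p   = length (takeWhile (d ≟ˢ_) (reverse (word p)))
  peak p    = factors u d (word p)
  nonpeak p = 1 + factors u u (word p)

Crosses : ℕ × ℕ → ℕ × ℕ → Set
Crosses (a , b) (a′ , b′) = (a < a′ × a′ < b × b < b′) ⊎ (a′ < a × a < b′ × b′ < b)

-- A triangulation of a convex polygon is a maximal set of pairwise
-- non-crossing edges (i , j), i < j, between its vertices 1, …, size + 2;
-- sides of the polygon cross nothing, hence belong to it.  The list of edges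
-- is read as a set: order and multiplicity are irrelevant.
record Triangulation : Set where
  field
    size        : ℕ
    edges       : List (ℕ × ℕ)
    inPolygon   : ∀ {i j} → (i , j) ∈ edges → 1 ≤ i × i < j × j ≤ 2 + size
    nonCrossing : ∀ {a b} → a ∈ edges → b ∈ edges → ¬ Crosses a b
    maximal     : ∀ {i j} → 1 ≤ i → i < j → j ≤ 2 + size →
                  (∀ {a} → a ∈ edges → ¬ Crosses (i , j) a) → (i , j) ∈ edges

module Triangulations where
  open Triangulation

  _∈ᴱ?_ = DecMembership._∈?_ (×P.≡-dec _≟_ _≟_)

  Adjacent : Triangulation → ℕ → ℕ → Set
  Adjacent T i j = (i , j) ∈ edges T ⊎ (j , i) ∈ edges T

  adjacent? : ∀ T i j → Dec (Adjacent T i j)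
  adjacent? T i j = ((i , j) ∈ᴱ? edges T) ⊎-dec ((j , i) ∈ᴱ? edges T)

  empty : Triangulation
  empty = record
    { size = 0
    ; edges = (1 , 2) ∷ []
    ; inPolygon = λ { (here refl) → s≤s z≤n , s≤s (s≤s z≤n) , s≤s (s≤s z≤n) }
    ; nonCrossing = λ { (here refl) (here refl) (inj₁ (p , _)) → <-irrefl refl p
                      ; (here refl) (here refl) (inj₂ (p , _)) → <-irrefl refl p }
    ; maximal = λ { {suc zero} {suc (suc zero)} _ _ _ _ → here refl
                  ; {suc zero} {suc zero} _ (s≤s ()) _ _
                  ; {_} {suc (suc (suc _))} _ _ (s≤s (s≤s ())) _
                  ; {suc (suc _)} {suc zero} _ (s≤s ()) _ _
                  ; {suc (suc _)} {suc (suc zero)} _ (s≤s (s≤s ())) _ _ }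
    }

  longSide : ∀ T → (1 , 2 + size T) ∈ edges T
  longSide T = maximal T ≤-refl (s≤s (s≤s z≤n)) ≤-refl λ { {a , b} a∈ →
    let 1≤a , a<b , b≤ = inPolygon T a∈ in λ where
      (inj₁ (_ , _ , n<b)) → <-irrefl refl (<-≤-trans n<b b≤)
      (inj₂ (a<1 , _))     → <-irrefl refl (<-≤-trans a<1 1≤a) }

  shiftEdge : ℕ × ℕ → ℕ × ℕ
  shiftEdge (i , j) = suc i , suc j

  cone : List (ℕ × ℕ) → ℕ → List (ℕ × ℕ)
  cone E n = (1 , 2) ∷ (1 , 3 + n) ∷ map shiftEdge E

  addVertex : Triangulation → Triangulation
  addVertex T = record
    { size = suc n ; edges = cone E n
    ; inPolygon = inPoly ; nonCrossing = nonCr ; maximal = maxi }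
    where
    n = size T
    E = edges T
    inPoly : ∀ {i j} → (i , j) ∈ cone E n → 1 ≤ i × i < j × j ≤ 3 + n
    inPoly (here refl)         = s≤s z≤n , s≤s (s≤s z≤n) , s≤s (s≤s z≤n)
    inPoly (there (here refl)) = s≤s z≤n , s≤s (s≤s z≤n) , ≤-refl
    inPoly (there (there p)) with (i , j) , q , refl ← ∈-map⁻ shiftEdge p
      = let _ , i<j , j≤ = inPolygon T q in s≤s z≤n , s≤s i<j , s≤s j≤

    noLeft : ∀ {j a b x y} → (a , b) ∈ cone E n → (x , y) ∈ cone E n → (x , y) ≡ (1 , j) →
             a < x → ⊥
    noLeft p q refl a<x = <-irrefl refl (<-≤-trans a<x (proj₁ (inPoly p)))

    oneSide : ∀ {a b x y} → (a , b) ∈ cone E n → (x , y) ∈ cone E n →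
              ¬ (a < x × x < b × b < y)
    oneSide (here refl) q (a<x , s≤s x<b , _) = <-irrefl refl (≤-trans a<x x<b)
    oneSide (there (here refl)) q (_ , _ , b<y) =
      <-irrefl refl (<-≤-trans b<y (proj₂ (proj₂ (inPoly q))))
    oneSide p@(there (there _)) q@(here refl) (a<x , _) = noLeft p q refl a<x
    oneSide p@(there (there _)) q@(there (here refl)) (a<x , _) = noLeft p q refl a<x
    oneSide (there (there p)) (there (there q)) (x , y , z)
      with _ , p′ , refl ← ∈-map⁻ shiftEdge p
         | _ , q′ , refl ← ∈-map⁻ shiftEdge q
      = nonCrossing T p′ q′ (inj₁ (s≤s⁻¹ x , s≤s⁻¹ y , s≤s⁻¹ z))

    nonCr : ∀ {a b} → a ∈ cone E n → b ∈ cone E n → ¬ Crosses a b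
    nonCr p q (inj₁ c) = oneSide p q c
    nonCr p q (inj₂ c) = oneSide q p c

    maxi : ∀ {i j} → 1 ≤ i → i < j → j ≤ 3 + n →
           (∀ {a} → a ∈ cone E n → ¬ Crosses (i , j) a) → (i , j) ∈ cone E n
    maxi {suc zero} {j} 1≤i i<j j≤ nc with j ≟ 2 | j ≟ 3 + n
    ... | yes refl | _        = here refl
    ... | no _     | yes refl = there (here refl)
    ... | no j≢2   | no j≢n   = ⊥-elim (nc (there (there (∈-map⁺ shiftEdge (longSide T))))
          (inj₁ (≤-refl , ≤∧≢⇒< i<j (λ eq → j≢2 (sym eq)) , ≤∧≢⇒< j≤ j≢n)))
    maxi {suc (suc i)} {suc j} 1≤i i<j j≤ nc =
      there (there (∈-map⁺ shiftEdge (maximal T (s≤s z≤n) (s≤s⁻¹ i<j) (s≤s⁻¹ j≤) λ where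
        a∈ (inj₁ (x , y , z)) → nc (there (there (∈-map⁺ shiftEdge a∈))) (inj₁ (s≤s x , s≤s y , s≤s z))
        a∈ (inj₂ (x , y , z)) → nc (there (there (∈-map⁺ shiftEdge a∈))) (inj₂ (s≤s x , s≤s y , s≤s z)))))

  relabel : ℕ → ℕ → ℕ
  relabel m 1 = 1
  relabel m j = m + j

  relabelEdge : ℕ → ℕ × ℕ → ℕ × ℕ
  relabelEdge m (i , j) = relabel m i , relabel m j

  relabel-mono : ∀ m {i j} → 1 ≤ i → i < j → relabel m i < relabel m j
  relabel-mono m {suc zero} {suc (suc j)} _ _ = ≤-trans (s≤s (s≤s z≤n)) (m≤n+m (2 + j) m)
  relabel-mono m {suc zero} {suc zero} _ (s≤s ())
  relabel-mono m {suc (suc i)} {suc (suc j)} _ i<j = +-monoʳ-< m i<j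
  relabel-mono m {suc (suc i)} {suc zero} _ (s≤s ())

  relabel-cancel : ∀ m {i j} → 1 ≤ i → 1 ≤ j → relabel m i < relabel m j → i < j
  relabel-cancel m {i} {j} 1≤i 1≤j lt with <-≤-connex i j
  ... | inj₁ i<j = i<j
  ... | inj₂ j≤i with m≤n⇒m<n∨m≡n j≤i
  ...   | inj₁ j<i  = ⊥-elim (<-asym lt (relabel-mono m 1≤j j<i))
  ...   | inj₂ refl = ⊥-elim (<-irrefl refl lt)

  relabel-big : ∀ m {j} → 2 ≤ j → relabel m j ≡ m + j
  relabel-big m {suc (suc j)} _ = refl
  relabel-big m {suc zero} (s≤s ())

  relabel-≥ : ∀ m {j} → 2 ≤ j → m + 2 ≤ relabel m j
  relabel-≥ m {j} 2≤j = subst (m + 2 ≤_) (sym (relabel-big m 2≤j)) (+-monoʳ-≤ m 2≤j)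

  unrelabel : ∀ m {j} → m + 2 ≤ j → ∃ λ j′ → 2 ≤ j′ × relabel m j′ ≡ j
  unrelabel m {j} le = j ∸ m , 2≤ , trans (relabel-big m 2≤) (m+[n∸m]≡n (m+n≤o⇒m≤o m le))
    where
    2≤ : 2 ≤ j ∸ m
    2≤ = subst (_≤ j ∸ m) (m+n∸m≡n m 2) (∸-monoˡ-≤ m le)

  join : Triangulation → Triangulation → Triangulation
  join T₁ T₂ = record
    { size = m + n ; edges = E
    ; inPolygon = inPoly
    ; nonCrossing = λ { p q (inj₁ c) → oneSide p q c ; p q (inj₂ c) → oneSide q p c }
    ; maximal = maxi }
    where
    m = size T₁
    n = size T₂
    E = edges T₁ ++ map (relabelEdge m) (edges T₂)

    m+2 : m + 2 ≡ 2 + m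
    m+2 = +-comm m 2

    swap2 : m + (2 + n) ≡ 2 + (m + n)
    swap2 = trans (sym (+-assoc m 2 n)) (cong (_+ n) m+2)

    right : ∀ {a} → a ∈ edges T₂ → relabelEdge m a ∈ E
    right a∈ = ∈-++⁺ʳ (edges T₁) (∈-map⁺ (relabelEdge m) a∈)

    inPoly : ∀ {i j} → (i , j) ∈ E → 1 ≤ i × i < j × j ≤ 2 + (m + n)
    inPoly p with ∈-++⁻ (edges T₁) p
    ... | inj₁ q = let 1≤i , i<j , j≤ = inPolygon T₁ q in
                   1≤i , i<j , ≤-trans j≤ (s≤s (s≤s (m≤m+n m n)))
    ... | inj₂ q with (i , j) , r , refl ← ∈-map⁻ (relabelEdge m) q
      = let 1≤i , i<j , j≤ = inPolygon T₂ r
            2≤j = ≤-trans (s≤s 1≤i) i<j in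
        pos 1≤i , relabel-mono m 1≤i i<j ,
        subst (relabel m j ≤_) swap2
          (subst (_≤ m + (2 + n)) (sym (relabel-big m 2≤j)) (+-monoʳ-≤ m j≤))
      where
      pos : ∀ {i} → 1 ≤ i → 1 ≤ relabel m i
      pos {suc zero}    _ = ≤-refl
      pos {suc (suc i)} _ = ≤-trans (s≤s z≤n) (m≤n+m (2 + i) m)

    oneSide : ∀ {a b x y} → (a , b) ∈ E → (x , y) ∈ E → ¬ (a < x × x < b × b < y)
    oneSide p q (a<x , x<b , b<y) with ∈-++⁻ (edges T₁) p | ∈-++⁻ (edges T₁) q
    ... | inj₁ p′ | inj₁ q′ = nonCrossing T₁ p′ q′ (inj₁ (a<x , x<b , b<y))
    ... | inj₁ p′ | inj₂ q′ with ∈-map⁻ (relabelEdge m) q′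
    ...   | (zero , y) , r , refl with () ← proj₁ (inPolygon T₂ r)
    ...   | (suc zero , y) , r , refl =
            <-irrefl refl (<-≤-trans a<x (proj₁ (inPolygon T₁ p′)))
    ...   | (suc (suc x′) , y) , r , refl = <-irrefl refl (<-≤-trans x<b
            (≤-trans (proj₂ (proj₂ (inPolygon T₁ p′)))
              (subst (_≤ m + (2 + x′)) m+2 (+-monoʳ-≤ m (s≤s (s≤s z≤n))))))
    oneSide p q (a<x , x<b , b<y) | inj₂ p′ | inj₁ q′
      with (a , b) , r , refl ← ∈-map⁻ (relabelEdge m) p′
      = let 1≤a , a<b , _ = inPolygon T₂ r in
        <-irrefl refl (<-≤-trans b<y (≤-trans (proj₂ (proj₂ (inPolygon T₁ q′)))
          (subst (_≤ relabel m b) m+2 (relabel-≥ m (≤-trans (s≤s 1≤a) a<b)))))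
    oneSide p q (a<x , x<b , b<y) | inj₂ p′ | inj₂ q′
      with (a , b) , r , refl ← ∈-map⁻ (relabelEdge m) p′
         | (x , y) , s , refl ← ∈-map⁻ (relabelEdge m) q′
      = let 1≤a , a<b , _ = inPolygon T₂ r
            1≤x , x<y , _ = inPolygon T₂ s
            1≤b = ≤-trans 1≤a (<⇒≤ a<b)
            1≤y = ≤-trans 1≤x (<⇒≤ x<y) in
        nonCrossing T₂ r s (inj₁ ( relabel-cancel m 1≤a 1≤x a<x
                                 , relabel-cancel m 1≤x 1≤b x<b
                                 , relabel-cancel m 1≤b 1≤y b<y))

    fromT₂ : ∀ {i j} → 1 ≤ i → 2 ≤ j → relabel m i < relabel m j → relabel m j ≤ 2 + (m + n) →
             (∀ {a} → a ∈ E → ¬ Crosses (relabel m i , relabel m j) a) →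
             (relabel m i , relabel m j) ∈ E
    fromT₂ {i} {j} 1≤i 2≤j lt le nc =
      right (maximal T₂ 1≤i (relabel-cancel m 1≤i 1≤j lt) j≤ λ { {a , b} a∈ →
        let 1≤a , a<b , _ = inPolygon T₂ a∈
            1≤b = ≤-trans 1≤a (<⇒≤ a<b) in λ where
          (inj₁ (x , y , z)) → nc (right a∈)
            (inj₁ (relabel-mono m 1≤i x , relabel-mono m 1≤a y , relabel-mono m 1≤j z))
          (inj₂ (x , y , z)) → nc (right a∈)
            (inj₂ (relabel-mono m 1≤a x , relabel-mono m 1≤i y , relabel-mono m 1≤b z)) })
      where
      1≤j = ≤-trans (s≤s z≤n) 2≤j
      j≤ : j ≤ 2 + n
      j≤ = +-cancelˡ-≤ m j (2 + n)
             (subst (_≤ m + (2 + n)) (relabel-big m 2≤j) (subst (relabel m j ≤_) (sym swap2) le))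

    maxi : ∀ {i j} → 1 ≤ i → i < j → j ≤ 2 + (m + n) →
           (∀ {a} → a ∈ E → ¬ Crosses (i , j) a) → (i , j) ∈ E
    maxi {i} {j} 1≤i i<j j≤ nc with ≤-<-connex j (2 + m)
    ... | inj₁ j≤m = ∈-++⁺ˡ (maximal T₁ 1≤i i<j j≤m (λ a∈ → nc (∈-++⁺ˡ a∈)))
    ... | inj₂ m<j
        with unrelabel m (subst (_≤ j) (sym m+2) (<⇒≤ m<j)) | ≤-<-connex (2 + m) i
    ...   | j′ , 2≤j′ , refl | inj₁ m≤i
            with i′ , 2≤i′ , refl ← unrelabel m (subst (_≤ i) (sym m+2) m≤i)
            = fromT₂ (≤-trans (s≤s z≤n) 2≤i′) 2≤j′ i<j j≤ nc
    ...   | j′ , 2≤j′ , refl | inj₂ i<m with i ≟ 1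
    ...     | yes refl = fromT₂ ≤-refl 2≤j′ i<j j≤ nc
    ...     | no i≢1 = ⊥-elim (nc (∈-++⁺ˡ (longSide T₁))
                (inj₂ (≤∧≢⇒< 1≤i (λ eq → i≢1 (sym eq)) , i<m , m<j)))

  operations : CatalanOperations
  operations = record
    { Carrier = Triangulation ; ∣_∣ = size ; e = empty ; ƛ = addVertex ; _⊕_ = join }

  -- An edge at v is counted through its other end.
  degree : Triangulation → ℕ → ℕ
  degree T v = count (adjacent? T v) (range (2 + size T))

  -- The subtractions are exact: every vertex lies on a side, and tr counts
  -- among size T candidates.
  comp rcomp tr nontr : Triangulation → ℕ
  comp T  = degree T 1 ∸ 1
  rcomp T = degree T (2 + size T) ∸ 1
  tr T    = count (λ i → anyUpTo? (λ j → adjacent? T j i ×-dec adjacent? T j (suc i)) i)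
                  (map suc (range (size T)))
  nontr T = size T + 1 ∸ tr T

IsPermutation : List ℕ → Set
IsPermutation w = w ↭ range (length w)

-- P describes the relative order of a pattern; its occurrences are the
-- subwords, not necessarily contiguous, in that order.
Avoids : (ℕ → ℕ → ℕ → Set) → List ℕ → Set
Avoids P w = ∀ {a b c} → (a ∷ b ∷ c ∷ []) ⊆ w → ¬ P a b c

Pattern231 Pattern321 : ℕ → ℕ → ℕ → Set
Pattern231 a b c = c < a × a < b
Pattern321 a b c = c < b × b < a

record AvoidingPermutation (P : ℕ → ℕ → ℕ → Set) : Set where
  field
    word          : List ℕ
    isPermutation : IsPermutation word
    avoids        : Avoids P word

module Permutations where

  directSum : List ℕ → List ℕ → List ℕ
  directSum v w = v ++ map (length v +_) w

  -- The direct-sum components are the segments between consecutive k with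
  -- π({1,…,k}) = {1,…,k}; each such k ≥ 1 ends exactly one component.
  components : List ℕ → ℕ
  components w = count (λ k → sameElements? (take k w) (range k)) (range (length w))

  rmaxʷ rminʷ nonrminʷ : List ℕ → ℕ
  rmaxʷ    w = countEntries rlMax? w
  rminʷ    w = countEntries rlMin? w
  nonrminʷ w = 1 + countEntries (λ x xs → ¬? (rlMin? x xs)) w

  isPerm : ∀ {w} n → w ↭ range n → IsPermutation w
  isPerm {w} n p = subst (λ k → w ↭ range k) (sym (trans (↭-length p) (length-range n))) p

  directSum-perm : ∀ {v w} → IsPermutation v → IsPermutation w → IsPermutation (directSum v w)
  directSum-perm {v} {w} p q = isPerm (length v + length w)
    (↭-trans (++⁺ p (↭-map⁺ (length v +_) q)) (↭-reflexive (sym (range-+ (length v) (length w)))))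

  directSum-avoids : ∀ {P v w} → (∀ {a b c} → P a b c → c < a) →
                     (∀ {m a b c} → P (m + a) (m + b) (m + c) → P a b c) →
                     IsPermutation v → IsPermutation w →
                     Avoids P v → Avoids P w → Avoids P (directSum v w)
  directSum-avoids {P} {v} {w} P⇒< unshift pv pw av aw τ abc with ⊆-++⁻ v τ
  ... | [] , _ , refl , _ , ρ with _ ∷ _ ∷ _ ∷ [] , refl , ρ′ ← ⊆-map⁻ (length v +_) w ρ
    = aw ρ′ (unshift {length v} abc)
  ... | a ∷ [] , b ∷ c ∷ [] , refl , σ , ρ
    with b′ ∷ c′ ∷ [] , refl , ρ′ ← ⊆-map⁻ (length v +_) w ρ
    = <-irrefl refl (<-≤-trans (P⇒< abc) (≤-trans
        (proj₂ (All.lookup (All-perm _ pv) (to∈ σ))) (m≤m+n (length v) c′)))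
  ... | a ∷ b ∷ [] , c ∷ [] , refl , σ , ρ
    with c′ ∷ [] , refl , ρ′ ← ⊆-map⁻ (length v +_) w ρ
    = <-irrefl refl (<-≤-trans (P⇒< abc) (≤-trans
        (proj₂ (All.lookup (All-perm _ pv) (Sub.lookup σ (here refl)))) (m≤m+n (length v) c′)))
  ... | a ∷ b ∷ c ∷ [] , [] , refl , σ , ρ = av σ abc
  ... | _ ∷ _ ∷ _ ∷ [] , _ ∷ _ , () , _ , _
  ... | _ ∷ _ ∷ _ ∷ _ ∷ _ , _ , () , _ , _

Permutation231 : Set
Permutation231 = AvoidingPermutation Pattern231

module Permutations231 where
  open AvoidingPermutation
  open Permutations

  empty : Permutation231
  empty = record { word = [] ; isPermutation = ↭-refl ; avoids = λ () }

  prependMax : Permutation231 → Permutation231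
  prependMax π = record
    { word = suc n ∷ word π
    ; isPermutation = ↭-trans (prep (suc n) (isPermutation π)) (range-suc n)
    ; avoids = av }
    where
    n = length (word π)
    av : Avoids Pattern231 (suc n ∷ word π)
    av (_ ∷ʳ τ)   abc         = avoids π τ abc
    av (refl ∷ τ) (_ , n+1<b) = <-irrefl refl (<-≤-trans n+1<b
      (≤-trans (proj₂ (All.lookup (All-perm _ (isPermutation π)) (to∈ τ))) (n≤1+n n)))

  _⊕_ : Permutation231 → Permutation231 → Permutation231
  π ⊕ ρ = record
    { word = directSum (word π) (word ρ)
    ; isPermutation = directSum-perm (isPermutation π) (isPermutation ρ)
    ; avoids = directSum-avoids {Pattern231} proj₁
        (λ {m} → λ { (x , y) → +-cancelˡ-< m _ _ x , +-cancelˡ-< m _ _ y })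
        (isPermutation π) (isPermutation ρ) (avoids π) (avoids ρ)
    }

  operations : CatalanOperations
  operations = record
    { Carrier = Permutation231 ; ∣_∣ = λ π → length (word π)
    ; e = empty ; ƛ = prependMax ; _⊕_ = _⊕_ }

  comp rmax rmin nonrmin : Permutation231 → ℕ
  comp    π = components (word π)
  rmax    π = rmaxʷ (word π)
  rmin    π = rminʷ (word π)
  nonrmin π = nonrminʷ (word π)

Permutation321 : Set
Permutation321 = AvoidingPermutation Pattern321

module Permutations321 where
  open AvoidingPermutation
  open Permutations

  Boxed : List ℕ → ℕ → List ℕ → Set
  Boxed earlier x later = 1 ∈ earlier × All (_< x) earlier × ¬ RLMin x later

  boxed? : ∀ earlier x later → Dec (Boxed earlier x later)
  boxed? earlier x later = (1 ∈? earlier) ×-dec all? (_<? x) earlier ×-dec ¬? (rlMin? x later)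

  -- mark earlier w boxes the entries of w, given the entries preceding w.
  mark : List ℕ → List ℕ → List (ℕ × Bool)
  mark earlier []       = []
  mark earlier (x ∷ xs) = (x , does (boxed? earlier x xs)) ∷ mark (x ∷ earlier) xs

  -- Insertion at the position of 1; the first clause serves only ƛ ε = 1.
  insertAt1 : ℕ → List (ℕ × Bool) → List (ℕ × Bool)
  insertAt1 m []            = (m , true) ∷ []
  insertAt1 m ((x , b) ∷ w) with x ≟ 1
  ... | yes _ = (m , true) ∷ (x , b) ∷ w
  ... | no  _ = (x , b) ∷ insertAt1 m w

  boxedValues : List (ℕ × Bool) → List ℕ
  boxedValues []                = []
  boxedValues ((x , true)  ∷ w) = x ∷ boxedValues w
  boxedValues ((x , false) ∷ w) = boxedValues w

  rotateLeft : List ℕ → List ℕ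
  rotateLeft []       = []
  rotateLeft (x ∷ xs) = xs ++ [ x ]

  -- Overwrites the boxed entries, in order, by the given values.
  refill : List (ℕ × Bool) → List ℕ → List ℕ
  refill []                vs       = []
  refill ((x , false) ∷ w) vs       = x ∷ refill w vs
  refill ((x , true)  ∷ w) []       = x ∷ refill w []
  refill ((x , true)  ∷ w) (v ∷ vs) = v ∷ refill w vs

  cycleBoxed : List (ℕ × Bool) → List ℕ
  cycleBoxed w = refill w (rotateLeft (boxedValues w))

  ƛʷ : List ℕ → List ℕ
  ƛʷ w = cycleBoxed (insertAt1 (suc (length w)) (mark [] w))

  -- A recursive, box-preserving description of ƛʷ: every box receives the
  -- value of the next box, the last one receives m.
  next : ℕ → List (ℕ × Bool) → ℕ
  next m []                = m
  next m ((x , true)  ∷ w) = x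
  next m ((x , false) ∷ w) = next m w

  pull : ℕ → List (ℕ × Bool) → List (ℕ × Bool)
  pull m []                = []
  pull m ((x , true)  ∷ w) = (next m w , true) ∷ pull m w
  pull m ((x , false) ∷ w) = (x , false) ∷ pull m w

  pullAt1 : ℕ → List (ℕ × Bool) → List (ℕ × Bool)
  pullAt1 m []            = (m , true) ∷ []
  pullAt1 m ((x , b) ∷ w) with x ≟ 1
  ... | yes _ = (next m w , true) ∷ (x , b) ∷ pull m w
  ... | no  _ = (x , b) ∷ pullAt1 m w

  1∉⇒unboxed : ∀ {ps x xs} → 1 ∉ ps → does (boxed? ps x xs) ≡ false
  1∉⇒unboxed {ps} {x} {xs} 1∉ = dec-false (boxed? ps x xs) (λ b → 1∉ (proj₁ b))

  ∉-∷ : ∀ {x} {ps : List ℕ} → x ≢ 1 → 1 ∉ ps → 1 ∉ x ∷ ps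
  ∉-∷ x≢1 1∉ (here 1≡x) = x≢1 (sym 1≡x)
  ∉-∷ x≢1 1∉ (there 1∈) = 1∉ 1∈

  next-first : ∀ m w → ∃ λ us → boxedValues w ++ [ m ] ≡ next m w ∷ us
  next-first m []                = [] , refl
  next-first m ((x , true)  ∷ w) = _ , refl
  next-first m ((x , false) ∷ w) = next-first m w

  refill-pull : ∀ m w vs → boxedValues w ++ [ m ] ≡ next m w ∷ vs →
                refill w vs ≡ map proj₁ (pull m w)
  refill-pull m []                vs eq   = refl
  refill-pull m ((x , false) ∷ w) vs eq   = cong (x ∷_) (refill-pull m w vs eq)
  refill-pull m ((x , true)  ∷ w) vs refl with us , eq ← next-first m w
    rewrite eq = cong (next m w ∷_) (refill-pull m w us eq)

  refill-all : ∀ m w → refill ((m , true) ∷ w) (boxedValues w ++ [ m ]) ≡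
               next m w ∷ map proj₁ (pull m w)
  refill-all m w with us , eq ← next-first m w
    rewrite eq = cong (next m w ∷_) (refill-pull m w us eq)

  cycle-pull : ∀ m ps w → 1 ∉ ps →
               cycleBoxed (insertAt1 m (mark ps w)) ≡ map proj₁ (pullAt1 m (mark ps w))
  cycle-pull m ps []       1∉ = refl
  cycle-pull m ps (x ∷ xs) 1∉ rewrite 1∉⇒unboxed {ps} {x} {xs} 1∉ with x ≟ 1
  ... | yes refl = refill-all m ((1 , false) ∷ mark (1 ∷ ps) xs)
  ... | no x≢1   = cong (x ∷_) (cycle-pull m (x ∷ ps) xs (∉-∷ x≢1 1∉))

  mark-values : ∀ ps w → map proj₁ (mark ps w) ≡ w
  mark-values ps []       = refl
  mark-values ps (x ∷ xs) = cong (x ∷_) (mark-values (x ∷ ps) xs)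

  ƛʷ-pull : ∀ w → ƛʷ w ≡ map proj₁ (pullAt1 (suc (length w)) (mark [] w))
  ƛʷ-pull w = cycle-pull _ [] w (λ ())

  pull-↭ : ∀ m w → next m w ∷ map proj₁ (pull m w) ↭ m ∷ map proj₁ w
  pull-↭ m []                = ↭-refl
  pull-↭ m ((x , true)  ∷ w) = ↭-trans (prep x (pull-↭ m w)) (swap x m ↭-refl)
  pull-↭ m ((x , false) ∷ w) =
    ↭-trans (swap _ x ↭-refl) (↭-trans (prep x (pull-↭ m w)) (swap x m ↭-refl))

  pullAt1-↭ : ∀ m w → map proj₁ (pullAt1 m w) ↭ m ∷ map proj₁ w
  pullAt1-↭ m []            = ↭-refl
  pullAt1-↭ m ((x , b) ∷ w) with x ≟ 1
  ... | yes refl = ↭-trans (swap _ x ↭-refl) (↭-trans (prep x (pull-↭ m w)) (swap x m ↭-refl))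
  ... | no  _    = ↭-trans (prep x (pullAt1-↭ m w)) (swap x m ↭-refl)

  -- Boxed entries exceed everything before them.
  Below : ℕ → ℕ × Bool → Set
  Below a (b , boxed) = boxed ≡ true → a < b

  _◁_ : ℕ × Bool → ℕ × Bool → Set
  (a , _) ◁ y = Below a y

  next-below : ∀ {m a} w → a < m → All (Below a) w → a < next m w
  next-below []                a<m []       = a<m
  next-below ((x , true)  ∷ w) a<m (p ∷ _)  = p refl
  next-below ((x , false) ∷ w) a<m (_ ∷ ps) = next-below w a<m ps

  pull-below : ∀ {m a} w → a < m → All (Below a) w → All (Below a) (pull m w)
  pull-below []                a<m []       = []
  pull-below ((x , true)  ∷ w) a<m (_ ∷ ps) = (λ _ → next-below w a<m ps) ∷ pull-below w a<m ps
  pull-below ((x , false) ∷ w) a<m (_ ∷ ps) = (λ ()) ∷ pull-below w a<m ps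

  pullAt1-below : ∀ {m a} w → a < m → All (Below a) w → All (Below a) (pullAt1 m w)
  pullAt1-below []            a<m []       = (λ _ → a<m) ∷ []
  pullAt1-below ((x , b) ∷ w) a<m (p ∷ ps) with x ≟ 1
  ... | yes refl = (λ _ → next-below w a<m ps) ∷ p ∷ pull-below w a<m ps
  ... | no  _    = p ∷ pullAt1-below w a<m ps

  SmallValues : ℕ → List (ℕ × Bool) → Set
  SmallValues m = All (λ y → proj₁ y < m)

  next-pull : ∀ {m} w → SmallValues m w → AllPairs _◁_ w → All (Below (next m w)) (pull m w)
  next-pull []                _         _        = []
  next-pull ((x , true)  ∷ w) (x<m ∷ _) (p ∷ _)  = (λ _ → next-below w x<m p) ∷ pull-below w x<m p
  next-pull ((x , false) ∷ w) (_ ∷ s)   (_ ∷ ps) = (λ ()) ∷ next-pull w s ps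

  pull-pairs : ∀ {m} w → SmallValues m w → AllPairs _◁_ w → AllPairs _◁_ (pull m w)
  pull-pairs []                _         _        = []
  pull-pairs ((x , true)  ∷ w) (_ ∷ s)   (_ ∷ ps) = next-pull w s ps ∷ pull-pairs w s ps
  pull-pairs ((x , false) ∷ w) (x<m ∷ s) (p ∷ ps) = pull-below w x<m p ∷ pull-pairs w s ps

  pullAt1-pairs : ∀ {m} ps w → 1 ∉ ps → (∀ {x} → x ∈ w → x < m) →
                  AllPairs _◁_ (mark ps w) → AllPairs _◁_ (pullAt1 m (mark ps w))
  pullAt1-pairs ps []       1∉ s _         = [] ∷ []
  pullAt1-pairs {m} ps (x ∷ xs) 1∉ s (q ∷ qs) rewrite 1∉⇒unboxed {ps} {x} {xs} 1∉ with x ≟ 1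
  ... | no x≢1   = pullAt1-below (mark (x ∷ ps) xs) (s (here refl)) q
                   ∷ pullAt1-pairs (x ∷ ps) xs (∉-∷ x≢1 1∉) (λ x∈ → s (there x∈)) qs
  ... | yes refl = ((λ ()) ∷ next-pull R small qs)
                   ∷ pull-below R (s (here refl)) q ∷ pull-pairs R small qs
    where
    R = mark (1 ∷ ps) xs
    small : SmallValues m R
    small = AllP.map⁻ (subst (All (_< m)) (sym (mark-values (1 ∷ ps) xs))
              (All.tabulate (λ x∈ → s (there x∈))))

  does-true : {P : Set} (p? : Dec P) → does p? ≡ true → P
  does-true (yes p) _ = p
  does-true (no _) ()

  does-false : {P : Set} (p? : Dec P) → does p? ≡ false → ¬ P
  does-false (no ¬p) _ = ¬p
  does-false (yes _) ()

  mark-below : ∀ {a} ps w → a ∈ ps → All (Below a) (mark ps w)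
  mark-below ps []       a∈ = []
  mark-below ps (x ∷ xs) a∈ =
    (λ eq → All.lookup (proj₁ (proj₂ (does-true (boxed? ps x xs) eq))) a∈)
    ∷ mark-below (x ∷ ps) xs (there a∈)

  mark-pairs : ∀ ps w → AllPairs _◁_ (mark ps w)
  mark-pairs ps []       = []
  mark-pairs ps (x ∷ xs) = mark-below (x ∷ ps) xs (here refl) ∷ mark-pairs (x ∷ ps) xs

  Unboxed : ℕ × Bool → Set
  Unboxed y = proj₂ y ≡ false

  pull-unboxed : ∀ {m zs} w → All Unboxed zs → zs ⊆ pull m w → zs ⊆ w
  pull-unboxed []                us       []         = []
  pull-unboxed ((x , true)  ∷ w) us       (_ ∷ʳ τ)   = _ ∷ʳ pull-unboxed w us τ
  pull-unboxed ((x , true)  ∷ w) (() ∷ _) (refl ∷ τ)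
  pull-unboxed ((x , false) ∷ w) us       (_ ∷ʳ τ)   = _ ∷ʳ pull-unboxed w us τ
  pull-unboxed ((x , false) ∷ w) (_ ∷ us) (refl ∷ τ) = refl ∷ pull-unboxed w us τ

  pullAt1-unboxed : ∀ {m zs} w → All Unboxed zs → zs ⊆ pullAt1 m w → zs ⊆ w
  pullAt1-unboxed []            us       (_ ∷ʳ τ)   = τ
  pullAt1-unboxed []            (() ∷ _) (refl ∷ τ)
  pullAt1-unboxed ((x , b) ∷ w) us       τ          with x ≟ 1
  pullAt1-unboxed ((x , b) ∷ w) us (_ ∷ʳ _ ∷ʳ τ)         | yes refl = _ ∷ʳ pull-unboxed w us τ
  pullAt1-unboxed ((x , b) ∷ w) (_ ∷ us) (_ ∷ʳ refl ∷ τ) | yes refl = refl ∷ pull-unboxed w us τ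
  pullAt1-unboxed ((x , b) ∷ w) (() ∷ _) (refl ∷ τ)      | yes refl
  pullAt1-unboxed ((x , b) ∷ w) us (_ ∷ʳ τ)              | no _ = _ ∷ʳ pullAt1-unboxed w us τ
  pullAt1-unboxed ((x , b) ∷ w) (_ ∷ us) (refl ∷ τ)      | no _ = refl ∷ pullAt1-unboxed w us τ

  NoOccurrence : List ℕ → List ℕ → Set
  NoOccurrence ps w = ∀ {a b c} → a ∈ ps → (b ∷ c ∷ []) ⊆ w → ¬ Pattern321 a b c

  Disjoint : List ℕ → List ℕ → Set
  Disjoint ps w = ∀ {a b} → a ∈ ps → b ∈ w → a ≢ b

  step-no : ∀ {ps x xs} → Avoids Pattern321 (x ∷ xs) → NoOccurrence ps (x ∷ xs) →
            NoOccurrence (x ∷ ps) xs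
  step-no av no′ (here refl) τ = av (refl ∷ τ)
  step-no av no′ (there a∈)  τ = no′ a∈ (_ ∷ʳ τ)

  step-disjoint : ∀ {ps x xs} → AllPairs _≢_ (x ∷ xs) → Disjoint ps (x ∷ xs) →
                  Disjoint (x ∷ ps) xs
  step-disjoint (x∉ ∷ _) dj (here refl) b∈ = All.lookup x∉ b∈
  step-disjoint _        dj (there a∈)  b∈ = dj a∈ (there b∈)

  values-⊆ : ∀ {zs} ps w → zs ⊆ mark ps w → map proj₁ zs ⊆ w
  values-⊆ ps w τ = subst (_ ⊆_) (mark-values ps w) (SubP.map⁺ proj₁ τ)

  noUnboxedInversion : ∀ {b c} ps w → 1 ∈ ps → AllPairs _≢_ w → Disjoint ps w →
                       Avoids Pattern321 w → NoOccurrence ps w →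
                       ((b , false) ∷ (c , false) ∷ []) ⊆ mark ps w → ¬ c < b
  noUnboxedInversion ps (x ∷ xs) 1∈ uq dj av no′ (_ ∷ʳ τ) =
    noUnboxedInversion (x ∷ ps) xs (there 1∈) (AllPairs.tail uq) (step-disjoint uq dj)
      (λ σ → av (_ ∷ʳ σ)) (step-no av no′) τ
  noUnboxedInversion {c = c} ps (x ∷ xs) 1∈ uq dj av no′ (eq ∷ τ) c<b
    with refl ← cong proj₁ eq =
    does-false (boxed? ps x xs) (sym (cong proj₂ eq)) (1∈ , allBelow , notRLMin)
    where
    allBelow : All (_< x) ps
    allBelow = All.tabulate λ {a} a∈ → ≰⇒> λ x≤a →
      no′ a∈ (refl ∷ values-⊆ (x ∷ ps) xs τ)
        (c<b , ≤∧≢⇒< x≤a (λ x≡a → dj a∈ (here refl) (sym x≡a)))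
    notRLMin : ¬ RLMin x xs
    notRLMin rl = <-asym c<b (All.lookup rl (to∈ (values-⊆ (x ∷ ps) xs τ)))

  noBoxedFirst : ∀ {m a b c} ps w → 1 ∉ ps → (∀ {x} → x ∈ w → 1 ≤ x) →
                 AllPairs _≢_ w → Disjoint ps w →
                 Avoids Pattern321 w → NoOccurrence ps w →
                 ((a , true) ∷ (b , false) ∷ (c , false) ∷ []) ⊆ pullAt1 m (mark ps w) → ¬ c < b
  noBoxedFirst ps []       1∉ 1≤ uq dj av no′ (_ ∷ʳ ())
  noBoxedFirst ps []       1∉ 1≤ uq dj av no′ (_ ∷ ())
  noBoxedFirst {m} ps (x ∷ xs) 1∉ 1≤ uq dj av no′ τ
    rewrite 1∉⇒unboxed {ps} {x} {xs} 1∉ with x ≟ 1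
  noBoxedFirst ps (x ∷ xs) 1∉ 1≤ uq dj av no′ (() ∷ _)  | no x≢1
  noBoxedFirst ps (x ∷ xs) 1∉ 1≤ uq dj av no′ (_ ∷ʳ τ)  | no x≢1 =
    noBoxedFirst (x ∷ ps) xs (∉-∷ x≢1 1∉) (λ x∈ → 1≤ (there x∈)) (AllPairs.tail uq)
      (step-disjoint uq dj) (λ σ → av (_ ∷ʳ σ)) (step-no av no′) τ
  noBoxedFirst {m} ps (x ∷ xs) 1∉ 1≤ uq dj av no′ τ     | yes refl = λ c<b →
    noUnboxedInversion (1 ∷ ps) xs (here refl) (AllPairs.tail uq) (step-disjoint uq dj)
      (λ σ → av (_ ∷ʳ σ)) (step-no av no′) (afterOne (tailOf τ) c<b) c<b
    where
    R = mark (1 ∷ ps) xs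
    tailOf : ∀ {y ys zs} → (y ∷ ys) ⊆ ((next m R , true) ∷ zs) → ys ⊆ zs
    tailOf (refl ∷ σ) = σ
    tailOf (_ ∷ʳ σ)   = Sub.⊆-trans (_ ∷ʳ ⊆-refl) σ
    afterOne : ∀ {b c} → ((b , false) ∷ (c , false) ∷ []) ⊆ ((1 , false) ∷ pull m R) → c < b →
               ((b , false) ∷ (c , false) ∷ []) ⊆ R
    afterOne (_ ∷ʳ σ)   _   = pull-unboxed R (refl ∷ refl ∷ []) σ
    afterOne (refl ∷ σ) c<1 = ⊥-elim (<-irrefl refl (<-≤-trans c<1
      (1≤ (there (to∈ (values-⊆ (1 ∷ ps) xs (pull-unboxed R (refl ∷ []) σ)))))))

  ƛʷ-perm : ∀ {w} → IsPermutation w → IsPermutation (ƛʷ w)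
  ƛʷ-perm {w} p = isPerm (suc n) (↭-trans
    (↭-trans (↭-reflexive (ƛʷ-pull w)) (↭-trans (pullAt1-↭ (suc n) (mark [] w))
      (prep (suc n) (↭-trans (↭-reflexive (mark-values [] w)) p))))
    (range-suc n))
    where n = length w

  ƛʷ-avoids : ∀ {w} → IsPermutation w → Avoids Pattern321 w → Avoids Pattern321 (ƛʷ w)
  ƛʷ-avoids {w} p av τ (c<b , b<a)
    with (a , ta) ∷ (b , tb) ∷ (c , tc) ∷ [] , refl , σ
           ← ⊆-map⁻ proj₁ (pullAt1 (suc (length w)) (mark [] w)) (subst (_ ⊆_) (ƛʷ-pull w) τ)
    with pairs ← pullAt1-pairs {suc (length w)} [] w (λ ())
                   (λ x∈ → s≤s (proj₂ (All.lookup (All-perm _ p) x∈))) (mark-pairs [] w)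
    with (a◁b ∷ _) ∷ (b◁c ∷ _) ∷ _ ← AllPairs-resp-⊆ σ pairs
    with ta | tb | tc
  ... | _     | true  | _     = <-asym b<a (a◁b refl)
  ... | _     | false | true  = <-asym c<b (b◁c refl)
  ... | false | false | false =
    av (values-⊆ [] w (pullAt1-unboxed (mark [] w) (refl ∷ refl ∷ refl ∷ []) σ)) (c<b , b<a)
  ... | true  | false | false =
    noBoxedFirst [] w (λ ()) (λ x∈ → proj₁ (All.lookup (All-perm _ p) x∈))
      (unique-↭ (↭-sym p) (range-unique _)) (λ ()) av (λ ()) σ c<b

  empty : Permutation321
  empty = record { word = [] ; isPermutation = ↭-refl ; avoids = λ () }

  λ₃₂₁ : Permutation321 → Permutation321
  λ₃₂₁ π = record
    { word = ƛʷ (word π)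
    ; isPermutation = ƛʷ-perm (isPermutation π)
    ; avoids = ƛʷ-avoids (isPermutation π) (avoids π) }

  _⊕_ : Permutation321 → Permutation321 → Permutation321
  π ⊕ ρ = record
    { word = directSum (word π) (word ρ)
    ; isPermutation = directSum-perm (isPermutation π) (isPermutation ρ)
    ; avoids = directSum-avoids {Pattern321} (λ { (c<b , b<a) → <-trans c<b b<a })
        (λ {m} → λ { (x , y) → +-cancelˡ-< m _ _ x , +-cancelˡ-< m _ _ y })
        (isPermutation π) (isPermutation ρ) (avoids π) (avoids ρ)
    }

  operations : CatalanOperations
  operations = record
    { Carrier = Permutation321 ; ∣_∣ = λ π → length (word π)
    ; e = empty ; ƛ = λ₃₂₁ ; _⊕_ = _⊕_ }

  comp rcomp rmin nonrmin : Permutation321 → ℕ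
  comp    π = components (word π)
  rcomp   π = maybe′ (λ πₙ → length (word π) ∸ πₙ + 1) 0 (last (word π))
  rmin    π = rminʷ (word π)
  nonrmin π = nonrminʷ (word π)

data BinaryTree : Set where
  ∅     : BinaryTree
  ⟨_,_⟩ : (L R : BinaryTree) → BinaryTree

module BinaryTrees where

  size : BinaryTree → ℕ
  size ∅         = 0
  size ⟨ L , R ⟩ = 1 + size L + size R

  _⊕_ : BinaryTree → BinaryTree → BinaryTree
  ∅          ⊕ B₂ = B₂
  ⟨ T , B₁ ⟩ ⊕ B₂ = ⟨ T , B₁ ⊕ B₂ ⟩

  operations : CatalanOperations
  operations = record
    { Carrier = BinaryTree ; ∣_∣ = size ; e = ∅ ; ƛ = λ T → ⟨ T , ∅ ⟩ ; _⊕_ = _⊕_ }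

  -- Left subtree of the last node of the right spine.
  lastLeft : BinaryTree → BinaryTree
  lastLeft ∅                 = ∅
  lastLeft ⟨ L , ∅ ⟩         = L
  lastLeft ⟨ _ , ⟨ L , R ⟩ ⟩ = lastLeft ⟨ L , R ⟩

  -- Number of applications of lastLeft needed to reach ∅, if that is at most
  -- the first argument.
  iterations : ℕ → BinaryTree → ℕ
  iterations _       ∅         = 0
  iterations zero    ⟨ L , R ⟩ = 0
  iterations (suc k) ⟨ L , R ⟩ = 1 + iterations k (lastLeft ⟨ L , R ⟩)

  rightEdges : BinaryTree → ℕ
  rightEdges ∅                 = 0
  rightEdges ⟨ L , ∅ ⟩         = rightEdges L
  rightEdges ⟨ L , ⟨ S , R ⟩ ⟩ = rightEdges L + 1 + rightEdges ⟨ S , R ⟩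

  comp rcomp redge ledge : BinaryTree → ℕ
  comp ∅         = 0
  comp ⟨ L , R ⟩ = 1 + comp R
  -- lastLeft removes at least one node, so size T iterations suffice.
  rcomp T = iterations (size T) T
  redge T = 1 + rightEdges T
  -- Exact for T = ∅ too: there redge T = 1.
  ledge T = size T + 1 ∸ redge T

record Tableau : Set where
  field
    top bottom       : List ℕ
    entries          : top ++ bottom ↭ range (2 * length top)
    topIncreasing    : AllPairs _<_ top
    bottomIncreasing : AllPairs _<_ bottom
    columns          : Pointwise _<_ top bottom

module Tableaux where
  open Tableau

  size : Tableau → ℕ
  size T = length (top T)

  empty : Tableau
  empty = record
    { top = [] ; bottom = [] ; entries = ↭-refl
    ; topIncreasing = [] ; bottomIncreasing = [] ; columns = [] }

  2*suc : ∀ n → 2 * suc n ≡ 2 + 2 * n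
  2*suc n = cong suc (+-suc n (n + 0))

  staircase : ∀ {x N t b} → Pointwise _<_ t b → AllPairs _<_ b →
              All (x <_) b → All (_< N) b → x < N → Pointwise _<_ (x ∷ t) (b ++ [ N ])
  staircase []       _        _         _         x<N = x<N ∷ []
  staircase (p ∷ ps) (q ∷ qs) (x<b ∷ _) (b<N ∷ bs) x<N =
    x<b ∷ staircase ps qs (All.map (<-trans p) q) bs (<-trans p b<N)

  wrap : Tableau → Tableau
  wrap T = record
    { top = 1 ∷ map suc (top T)
    ; bottom = map suc (bottom T) ++ [ N ]
    ; entries = subst (λ k → (1 ∷ map suc t) ++ map suc b ++ [ N ] ↭ range k)
        (trans (sym (2*suc n)) (cong (λ k → 2 * suc k) (sym (length-map suc t)))) ent
    ; topIncreasing = AllP.map⁺ (All.map (λ q → s≤s (proj₁ q)) boundsᵗ)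
        ∷ AllPairsP.map⁺ (AllPairs.map s≤s (topIncreasing T))
    ; bottomIncreasing = AllPairsP.++⁺ bInc ([] ∷ []) (All.map (λ q → q ∷ []) b<N)
    ; columns = staircase (PW.map⁺ suc suc (PW.map s≤s (columns T))) bInc
        (AllP.map⁺ (All.map (λ q → s≤s (proj₁ q)) boundsᵇ)) b<N (s≤s (s≤s z≤n)) }
    where
    n = size T
    t = top T
    b = bottom T
    N = 2 + 2 * n
    bounds : All (λ x → 1 ≤ x × x ≤ 2 * n) (t ++ b)
    bounds = All-perm (2 * n) (entries T)
    boundsᵗ = AllP.++⁻ˡ t bounds
    boundsᵇ = AllP.++⁻ʳ t bounds
    bInc : AllPairs _<_ (map suc b)
    bInc = AllPairsP.map⁺ (AllPairs.map s≤s (bottomIncreasing T))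
    b<N : All (_< N) (map suc b)
    b<N = AllP.map⁺ (All.map (λ q → s≤s (s≤s (proj₂ q))) boundsᵇ)
    ent : (1 ∷ map suc t) ++ map suc b ++ [ N ] ↭ range N
    ent = ↭-trans
      (prep 1 (↭-trans (↭-sym (++-assoc (map suc t) (map suc b) [ N ]))
        (++⁺ʳ [ N ] (↭-trans (↭-reflexive (sym (map-++ suc t b))) (↭-map⁺ suc (entries T))))))
      (↭-reflexive (trans (cong (λ l → 1 ∷ l ++ [ N ]) (map-applyUpTo suc suc (2 * n)))
                          (applyUpTo-∷ʳ suc (suc (2 * n)))))

  _⊕_ : Tableau → Tableau → Tableau
  T₁ ⊕ T₂ = record
    { top = t₁ ++ map (s +_) t₂
    ; bottom = b₁ ++ map (s +_) b₂
    ; entries = subst (λ k → (t₁ ++ map (s +_) t₂) ++ b₁ ++ map (s +_) b₂ ↭ range k) size-eq ent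
    ; topIncreasing = incr (topIncreasing T₁) (topIncreasing T₂)
        (AllP.++⁻ˡ t₁ bounds₁) (AllP.++⁻ˡ t₂ bounds₂)
    ; bottomIncreasing = incr (bottomIncreasing T₁) (bottomIncreasing T₂)
        (AllP.++⁻ʳ t₁ bounds₁) (AllP.++⁻ʳ t₂ bounds₂)
    ; columns = PW.++⁺ (columns T₁)
        (PW.map⁺ (s +_) (s +_) (PW.map (+-monoʳ-< s) (columns T₂))) }
    where
    s = 2 * size T₁
    t₁ = top T₁
    b₁ = bottom T₁
    t₂ = top T₂
    b₂ = bottom T₂
    bounds₁ = All-perm s (entries T₁)
    bounds₂ = All-perm (2 * size T₂) (entries T₂)
    incr : ∀ {v w} → AllPairs _<_ v → AllPairs _<_ w →
           All (λ x → 1 ≤ x × x ≤ s) v → All (λ x → 1 ≤ x × x ≤ 2 * size T₂) w →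
           AllPairs _<_ (v ++ map (s +_) w)
    incr iv iw bv bw = AllPairsP.++⁺ iv (AllPairsP.map⁺ (AllPairs.map (+-monoʳ-< s) iw))
      (All.map (λ { (_ , x≤s) → AllP.map⁺ (All.map
        (λ { (1≤y , _) → ≤-<-trans x≤s (m<m+n s 1≤y) }) bw) }) bv)
    size-eq : s + 2 * size T₂ ≡ 2 * length (t₁ ++ map (s +_) t₂)
    size-eq = trans (sym (*-distribˡ-+ 2 (size T₁) (size T₂)))
      (cong (2 *_) (sym (trans (length-++ t₁) (cong (size T₁ +_) (length-map (s +_) t₂)))))
    ent : (t₁ ++ map (s +_) t₂) ++ b₁ ++ map (s +_) b₂ ↭ range (s + 2 * size T₂)
    ent = ↭-trans (++-assoc t₁ (map (s +_) t₂) _)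
      (↭-trans (++⁺ˡ t₁ (shifts (map (s +_) t₂) b₁))
      (↭-trans (↭-sym (++-assoc t₁ b₁ _))
      (↭-trans (++⁺ (entries T₁) (↭-trans (↭-reflexive (sym (map-++ (s +_) t₂ b₂)))
                                          (↭-map⁺ (s +_) (entries T₂))))
               (↭-reflexive (sym (range-+ s (2 * size T₂)))))))

  operations : CatalanOperations
  operations = record
    { Carrier = Tableau ; ∣_∣ = size ; e = empty ; ƛ = wrap ; _⊕_ = _⊕_ }

  comp rcomp cons noncons : Tableau → ℕ
  comp T    = count (λ k → sameElements? (take k (top T) ++ take k (bottom T)) (range (2 * k)))
                    (range (size T))
  rcomp T   = largest (λ k → ≡-dec _≟_ (take k (reverse (bottom T)))
                                       (map (2 * size T ∸_) (upTo k)))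
                      (size T)
  cons T    = 1 + count (λ i → suc i ∈? top T) (top T)
  noncons T = count (λ i → suc i ∈? bottom T) (top T)

-- min B < min C, for non-empty C
_≺_ : List ℕ → List ℕ → Set
B ≺ C = ∃ λ x → x ∈ B × All (x <_) C

Interleaved : List ℕ → List ℕ → Set
Interleaved B C = ∃₂ λ a b → ∃₂ λ c d →
  a < b × b < c × c < d × a ∈ B × c ∈ B × b ∈ C × d ∈ C

-- A set partition is represented by its flattened form divided into blocks:
-- each block is listed in decreasing order, the blocks are sorted by minimum.
-- Every set partition has exactly one such representation.
record NonCrossingPartition : Set where
  field
    size        : ℕ
    blockList   : List (List ℕ)
    partition   : concat blockList ↭ range size
    nonEmpty    : All (_≢ []) blockList
    decreasing  : All (AllPairs _>_) blockList
    sorted      : AllPairs _≺_ blockList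
    nonCrossing : AllPairs (λ B C → ¬ Interleaved B C × ¬ Interleaved C B) blockList

module NonCrossingPartitions where
  open NonCrossingPartition

  -- Insertion into the block containing 1; the first clause serves only
  -- ƛ e = {{1}}.
  insertWith1 : ℕ → List (List ℕ) → List (List ℕ)
  insertWith1 m []       = [ m ] ∷ []
  insertWith1 m (B ∷ Bs) =
    if does (1 ∈? B) then (m ∷ B) ∷ Bs else B ∷ insertWith1 m Bs

  empty : NonCrossingPartition
  empty = record
    { size = 0 ; blockList = [] ; partition = ↭-refl ; nonEmpty = [] ; decreasing = []
    ; sorted = [] ; nonCrossing = [] }

  Separate : List ℕ → List ℕ → Set
  Separate B C = ¬ Interleaved B C × ¬ Interleaved C B

  Small : ℕ → List ℕ → Set
  Small n = All (λ x → 1 ≤ x × x ≤ n)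

  insert-↭ : ∀ m Bs → concat (insertWith1 m Bs) ↭ m ∷ concat Bs
  insert-↭ m []       = ↭-refl
  insert-↭ m (B ∷ Bs) with 1 ∈? B
  ... | yes _ = ↭-refl
  ... | no  _ = ↭-trans (++⁺ˡ B (insert-↭ m Bs)) (shift m B (concat Bs))

  insert-nonEmpty : ∀ m {Bs} → All (_≢ []) Bs → All (_≢ []) (insertWith1 m Bs)
  insert-nonEmpty m {[]}     _        = (λ ()) ∷ []
  insert-nonEmpty m {B ∷ Bs} (p ∷ ps) with 1 ∈? B
  ... | yes _ = (λ ()) ∷ ps
  ... | no  _ = p ∷ insert-nonEmpty m ps

  insert-decreasing : ∀ n {Bs} → All (Small n) Bs → All (AllPairs _>_) Bs →
                      All (AllPairs _>_) (insertWith1 (suc n) Bs)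
  insert-decreasing n {[]}     _        _        = ([] ∷ []) ∷ []
  insert-decreasing n {B ∷ Bs} (s ∷ ss) (p ∷ ps) with 1 ∈? B
  ... | yes _ = (All.map (λ q → s≤s (proj₂ q)) s ∷ p) ∷ ps
  ... | no  _ = p ∷ insert-decreasing n ss ps

  nonEmpty-∈ : ∀ {B : List ℕ} → B ≢ [] → ∃ λ x → x ∈ B
  nonEmpty-∈ {[]}    ne = ⊥-elim (ne refl)
  nonEmpty-∈ {x ∷ B} ne = x , here refl

  insert-≺ : ∀ {n A} Bs → A ≢ [] → Small n A → All (A ≺_) Bs →
             All (A ≺_) (insertWith1 (suc n) Bs)
  insert-≺ []       ne s []       = let x , x∈ = nonEmpty-∈ ne in
    (x , x∈ , s≤s (proj₂ (All.lookup s x∈)) ∷ []) ∷ []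
  insert-≺ (B ∷ Bs) ne s (p@(x , x∈ , x<) ∷ ps) with 1 ∈? B
  ... | yes _ = (x , x∈ , s≤s (proj₂ (All.lookup s x∈)) ∷ x<) ∷ ps
  ... | no  _ = p ∷ insert-≺ Bs ne s ps

  insert-sorted : ∀ {n} Bs → All (_≢ []) Bs → All (Small n) Bs → AllPairs _≺_ Bs →
                  AllPairs _≺_ (insertWith1 (suc n) Bs)
  insert-sorted []       _         _        _        = [] ∷ []
  insert-sorted (B ∷ Bs) (ne ∷ nes) (s ∷ ss) (p ∷ ps) with 1 ∈? B
  ... | yes _ = All.map (λ { (x , x∈ , x<) → x , there x∈ , x< }) p ∷ ps
  ... | no  _ = insert-≺ Bs ne s p ∷ insert-sorted Bs nes ss ps

  separate-new : ∀ {n B C} → 1 ∈ B → 1 ∉ C → Small n B → Small n C → Separate B C →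
                 Separate (suc n ∷ B) C
  separate-new {n} {B} {C} 1∈B 1∉C sB sC (no₁ , no₂) = left , right
    where
    left : ¬ Interleaved (suc n ∷ B) C
    left (a , b , c , e , a<b , b<c , c<e , there a∈ , there c∈ , b∈ , e∈) =
      no₁ (a , b , c , e , a<b , b<c , c<e , a∈ , c∈ , b∈ , e∈)
    left (a , b , c , e , a<b , b<c , c<e , here refl , c∈ , b∈ , e∈) =
      <-asym a<b (s≤s (proj₂ (All.lookup sC b∈)))
    left (a , b , c , e , a<b , b<c , c<e , there a∈ , here refl , b∈ , e∈) =
      <-asym c<e (s≤s (proj₂ (All.lookup sC e∈)))
    right : ¬ Interleaved C (suc n ∷ B)
    right (a , b , c , e , a<b , b<c , c<e , a∈ , c∈ , here refl , e∈) =
      <-asym b<c (s≤s (proj₂ (All.lookup sC c∈)))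
    right (a , b , c , e , a<b , b<c , c<e , a∈ , c∈ , there b∈ , there e∈) =
      no₂ (a , b , c , e , a<b , b<c , c<e , a∈ , c∈ , b∈ , e∈)
    right (a , b , c , e , a<b , b<c , c<e , a∈ , c∈ , there b∈ , here refl) =
      no₁ (1 , a , b , c , 1<a , a<b , b<c , 1∈B , b∈ , a∈ , c∈)
      where
      1<a : 1 < a
      1<a = ≤∧≢⇒< (proj₁ (All.lookup sC a∈)) (λ 1≡a → 1∉C (subst (_∈ C) (sym 1≡a) a∈))

  separate-max : ∀ {n A} → Small n A → Separate A [ suc n ]
  separate-max sA =
    (λ { (_ , _ , _ , _ , _ , b<c , _ , _ , c∈ , here refl , _) →
           <-asym b<c (s≤s (proj₂ (All.lookup sA c∈))) }) ,
    (λ { (_ , _ , _ , _ , a<b , _ , _ , here refl , _ , b∈ , _) →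
           <-asym a<b (s≤s (proj₂ (All.lookup sA b∈))) })

  insert-separate : ∀ {n A} Bs → 1 ∉ A → Small n A → All (Small n) Bs →
                    All (Separate A) Bs → All (Separate A) (insertWith1 (suc n) Bs)
  insert-separate []       1∉ s _        _        = separate-max s ∷ []
  insert-separate (B ∷ Bs) 1∉ s (t ∷ ts) (p ∷ ps) with 1 ∈? B
  ... | no  _   = p ∷ insert-separate Bs 1∉ s ts ps
  ... | yes 1∈B = let x , y = separate-new 1∈B 1∉ t s (proj₂ p , proj₁ p) in (y , x) ∷ ps

  insert-nonCrossing : ∀ {n} Bs → All (Small n) Bs → AllPairs _≺_ Bs → AllPairs Separate Bs →
                       AllPairs Separate (insertWith1 (suc n) Bs)
  insert-nonCrossing []       _        _        _        = [] ∷ []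
  insert-nonCrossing (B ∷ Bs) (s ∷ ss) (o ∷ os) (p ∷ ps) with 1 ∈? B
  ... | no 1∉   = insert-separate Bs 1∉ s ss p ∷ insert-nonCrossing Bs ss os ps
  ... | yes 1∈B = All.zipWith (λ { (1∉C , sC , sep) → separate-new 1∈B 1∉C s sC sep })
                    (All.map no1 o , All.zip (ss , p)) ∷ ps
    where
    no1 : ∀ {C} → B ≺ C → 1 ∉ C
    no1 (x , x∈ , x<) 1∈C =
      <-irrefl refl (<-≤-trans (All.lookup x< 1∈C) (proj₁ (All.lookup s x∈)))

  addMax : NonCrossingPartition → NonCrossingPartition
  addMax P = record
    { size = suc n
    ; blockList = insertWith1 (suc n) (blockList P)
    ; partition = ↭-trans (insert-↭ (suc n) (blockList P))
        (↭-trans (prep (suc n) (partition P)) (range-suc n))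
    ; nonEmpty = insert-nonEmpty (suc n) (nonEmpty P)
    ; decreasing = insert-decreasing n small (decreasing P)
    ; sorted = insert-sorted (blockList P) (nonEmpty P) small (sorted P)
    ; nonCrossing = insert-nonCrossing (blockList P) small (sorted P) (nonCrossing P) }
    where
    n = size P
    small : All (Small n) (blockList P)
    small = AllP.concat⁻ (All-perm n (partition P))

  _⊕_ : NonCrossingPartition → NonCrossingPartition → NonCrossingPartition
  P₁ ⊕ P₂ = record
    { size = m + n
    ; blockList = Bs ++ map (map (m +_)) Cs
    ; partition = ↭-trans (↭-reflexive (sym (concat-++ Bs (map (map (m +_)) Cs))))
        (↭-trans (++⁺ (partition P₁) (↭-trans (↭-reflexive (concat-map {f = m +_} Cs))
                                              (↭-map⁺ (m +_) (partition P₂))))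
                 (↭-reflexive (sym (range-+ m n))))
    ; nonEmpty = AllP.++⁺ (nonEmpty P₁) (AllP.map⁺ (All.map
        (λ { {[]} ne _ → ne refl ; {_ ∷ _} _ () }) (nonEmpty P₂)))
    ; decreasing = AllP.++⁺ (decreasing P₁) (AllP.map⁺ (All.map
        (λ q → AllPairsP.map⁺ (AllPairs.map (+-monoʳ-< m) q)) (decreasing P₂)))
    ; sorted = AllPairsP.++⁺ (sorted P₁)
        (AllPairsP.map⁺ (AllPairs.map shift-≺ (sorted P₂)))
        (All.zipWith (λ { (ne , sB) → AllP.map⁺ (All.map (across-≺ ne sB) smallC) })
          (nonEmpty P₁ , smallB))
    ; nonCrossing = AllPairsP.++⁺ (nonCrossing P₁)
        (AllPairsP.map⁺ (AllPairs.map
          (λ { (x , y) → (λ i → x (unshift i)) , (λ i → y (unshift i)) }) (nonCrossing P₂)))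
        (All.map (λ sB → AllP.map⁺ (All.map (across sB) smallC)) smallB) }
    where
    m = size P₁
    n = size P₂
    Bs = blockList P₁
    Cs = blockList P₂
    smallB : All (Small m) Bs
    smallB = AllP.concat⁻ (All-perm m (partition P₁))
    smallC : All (Small n) Cs
    smallC = AllP.concat⁻ (All-perm n (partition P₂))

    shift-≺ : ∀ {B C} → B ≺ C → map (m +_) B ≺ map (m +_) C
    shift-≺ (x , x∈ , x<) = m + x , ∈-map⁺ (m +_) x∈ , AllP.map⁺ (All.map (+-monoʳ-< m) x<)

    across-≺ : ∀ {B C} → B ≢ [] → Small m B → Small n C → B ≺ map (m +_) C
    across-≺ ne sB sC = let x , x∈ = nonEmpty-∈ ne in
      x , x∈ , AllP.map⁺ (All.map
        (λ q → ≤-<-trans (proj₂ (All.lookup sB x∈)) (m<m+n m (proj₁ q))) sC)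

    unshift : ∀ {B C} → Interleaved (map (m +_) B) (map (m +_) C) → Interleaved B C
    unshift (_ , _ , _ , _ , a<b , b<c , c<e , a∈ , c∈ , b∈ , e∈)
      with a , a∈′ , refl ← ∈-map⁻ (m +_) a∈
         | b , b∈′ , refl ← ∈-map⁻ (m +_) b∈
         | c , c∈′ , refl ← ∈-map⁻ (m +_) c∈
         | e , e∈′ , refl ← ∈-map⁻ (m +_) e∈
      = a , b , c , e , +-cancelˡ-< m a b a<b , +-cancelˡ-< m b c b<c , +-cancelˡ-< m c e c<e ,
        a∈′ , c∈′ , b∈′ , e∈′

    above : ∀ {B C x y} → Small m B → x ∈ B → y ∈ map (m +_) C → ¬ y < x
    above sB x∈ y∈ y<x with z , _ , refl ← ∈-map⁻ (m +_) y∈ =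
      <-irrefl refl (<-≤-trans y<x (≤-trans (proj₂ (All.lookup sB x∈)) (m≤m+n m z)))

    across : ∀ {B C} → Small m B → Small n C → Separate B (map (m +_) C)
    across sB sC =
      (λ { (_ , _ , _ , _ , _ , b<c , _ , _ , c∈ , b∈ , _) → above sB c∈ b∈ b<c }) ,
      (λ { (_ , _ , _ , _ , a<b , _ , _ , a∈ , _ , b∈ , _) → above sB b∈ a∈ a<b })

  operations : CatalanOperations
  operations = record
    { Carrier = NonCrossingPartition ; ∣_∣ = size ; e = empty ; ƛ = addMax ; _⊕_ = _⊕_ }

  InitialSegmentIsUnion : NonCrossingPartition → ℕ → Set
  InitialSegmentIsUnion P k = All (λ B → All (_≤ k) B ⊎ All (k <_) B) (blockList P)

  initialSegmentIsUnion? : ∀ P k → Dec (InitialSegmentIsUnion P k)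
  initialSegmentIsUnion? P k =
    all? (λ B → all? (_≤? k) B ⊎-dec all? (k <?_) B) (blockList P)

  comp rcomp blocks nonmin : NonCrossingPartition → ℕ
  comp P   = count (initialSegmentIsUnion? P) (range (size P))
  rcomp P  = countEntries rlMax? (concat (blockList P))
  blocks P = length (blockList P)
  nonmin P = size P + 1 ∸ blocks P

Transports : (B : CatalanOperations) (s r l i : CatalanOperations.Carrier B → ℕ) → Set
Transports B s r l i =
  ∀ (t : PlaneTree) →
    sub t ≡ s (φ B t) ×
    rpath t ≡ r (φ B t) ×
    (1 ≤ size t → leaves t ≡ l (φ B t) × internal t ≡ i (φ B t))
  where open PlaneTrees

{-# OPTIONS --safe #-}
-- On a decomposable tree ƛ s ⊕ v the map φ produces ƛ (φ s) ⊕ φ v, so a native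
-- statistic agrees with the canonical one as soon as it obeys the same
-- recurrences at e, under ƛ and under ⊕.  For internal no recurrence is needed:
-- internal + leaves = size + 1 on plane trees, and the corresponding native pairs
-- have the same sum.
module Submission where

open import Algebra.Bundles using (CommutativeMonoid)
import Algebra.Properties.CommutativeSemigroup as CommutativeSemigroupProperties
open import Data.Bool.Base using (true; false; if_then_else_)
open import Data.Empty using (⊥; ⊥-elim)
open import Data.List.Base
  using (List; []; _∷_; [_]; _++_; length; map; filter; upTo; take; applyUpTo; last; reverse;
    takeWhile; concat)
open import Data.List.Properties
  using (length-map; length-++; length-filter; length-reverse; filter-++; applyUpTo-∷ʳ;
    map-applyUpTo; map-++; map-∘; map-cong-local; take-map; take-all; reverse-++; reverse-map;
    unfold-reverse; ++-assoc; concat-++; concat-map; ≡-dec; ∷-injectiveˡ; ∷-injectiveʳ;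
    map-injective; map-upTo)
open import Data.List.Membership.Propositional using (_∈_; _∉_; find)
open import Data.List.Membership.Propositional.Properties
  using (∈-map⁺; ∈-map⁻; ∈-++⁺ˡ; ∈-++⁺ʳ; ∈-++⁻; ∈-applyUpTo⁺; ∈-upTo⁻; ∈-concat⁻′)
import Data.List.Membership.DecPropositional as DecMembership
open import Data.List.Relation.Binary.Permutation.Propositional
  using (_↭_; ↭-sym; module PermutationReasoning)
open import Data.List.Relation.Binary.Permutation.Propositional.Properties
  using (∈-resp-↭; ↭-length; ↭-reverse; ++-commutativeMonoid)
open import Data.List.Relation.Binary.Pointwise.Base using (Pointwise; []; _∷_)
open import Data.List.Relation.Binary.Pointwise using (Pointwise-length)
open import Data.List.Relation.Unary.All using (All; []; _∷_)
import Data.List.Relation.Unary.All as All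
import Data.List.Relation.Unary.All.Properties as AllP
open import Data.List.Relation.Unary.AllPairs using (AllPairs; []; _∷_)
open import Data.List.Relation.Unary.Any using (here; there)
open import Data.Maybe.Base using (maybe′; just)
open import Data.Nat.Base using (ℕ; zero; suc; _+_; _*_; _∸_; _≤_; _<_; z≤n; s≤s; s≤s⁻¹)
open import Data.Nat.Properties
open import Data.Product.Base using (∃; ∃₂; _×_; _,_; proj₁; proj₂)
open import Data.Sum.Base using (_⊎_; inj₁; inj₂)
import Data.Sum.Base as Sum
open import Function.Base using (_∘_; id)
open import Function.Bundles using (_⇔_; mk⇔; Equivalence)
open import Relation.Binary.PropositionalEquality
  using (_≡_; _≢_; refl; sym; trans; cong; cong₂; subst; module ≡-Reasoning)
open import Relation.Nullary.Decidable
  using (Dec; yes; no; does; ¬?; _×-dec_; dec-true; dec-false; does-⇔)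
open import Relation.Nullary.Negation using (¬_)
open import Relation.Unary using (Decidable)
open import Defs

open CommutativeSemigroupProperties +-commutativeSemigroup using (interchange)
open DecMembership _≟_ using (_∈?_)
open Equivalence using (to; from)

-- The clauses are required on the whole carrier rather than on images of `φ`, so each family can be
-- treated through intrinsic properties of its objects. The size clauses belong to the record
-- because nonemptiness is expressed by `1 ≤ ∣ x ∣`, and the size of `φ t` can be computed from `t`.
-- The recursion for `l` starts at `ƛ e` and not at `e`: statistics such as `peak` or `blocks`
-- vanish at `e`, where `leaves` is 1, which is why the last two identities begin at size 1.
-- Likewise `r-⊕` asks for a nonempty second summand, since `x ⊕ e` keeps the value of `x`. Under
-- `⊕` the second summand is placed beyond the first, usually by a shift of labels, so these clauses
-- come down to showing that nothing unexpected happens across the boundary. The more delicate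
-- clauses concern `ƛ`, above all `s-ƛ`, which says that no proper initial part of `ƛ x` can be
-- split off.

record Recurrences (B : CatalanOperations)
                   (s r l i : CatalanOperations.Carrier B → ℕ) : Set where
  open CatalanOperations B
  field
    size-e : ∣ e ∣ ≡ 0
    size-ƛ : ∀ x → ∣ ƛ x ∣ ≡ suc ∣ x ∣
    size-⊕ : ∀ x y → ∣ x ⊕ y ∣ ≡ ∣ x ∣ + ∣ y ∣
    s-e : s e ≡ 0
    s-ƛ : ∀ x → s (ƛ x) ≡ 1
    s-⊕ : ∀ x y → s (x ⊕ y) ≡ s x + s y
    r-e : r e ≡ 0
    r-ƛ : ∀ x → r (ƛ x) ≡ 1 + r x
    r-⊕ : ∀ x y → 1 ≤ ∣ y ∣ → r (x ⊕ y) ≡ r y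
    l-ƛe : l (ƛ e) ≡ 1
    l-ƛ : ∀ x → 1 ≤ ∣ x ∣ → l (ƛ x) ≡ l x
    l-⊕ : ∀ x y → 1 ≤ ∣ x ∣ → 1 ≤ ∣ y ∣ → l (x ⊕ y) ≡ l x + l y
    l+i : ∀ x → 1 ≤ ∣ x ∣ → l x + i x ≡ ∣ x ∣ + 1

-- The `size t + 1` nodes of a plane tree are its leaves together with its internal nodes.
leaves+internal : ∀ t → PlaneTrees.leaves t + PlaneTrees.internal t ≡ PlaneTrees.size t + 1
leaves+internal (node []) = refl
leaves+internal (node (t ∷ [])) = begin
  leaves t + suc (internal t)  ≡⟨ +-suc (leaves t) (internal t) ⟩
  suc (leaves t + internal t)  ≡⟨ cong suc (leaves+internal t) ⟩
  suc (size t + 1)             ≡⟨ cong (λ n → suc (n + 1)) (+-identityʳ (size t)) ⟨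
  suc (size t + 0) + 1         ∎
  where open ≡-Reasoning; open PlaneTrees
leaves+internal (node (t ∷ ts@(_ ∷ _))) = begin
  -- The `∸ 1` in `internal` cancels against its `1 +` by computation: identifying the two roots
  -- loses one internal node.
  (leaves t + leaves v) + (internal t + internal v)
    ≡⟨ interchange (leaves t) (leaves v) (internal t) (internal v) ⟩
  (leaves t + internal t) + (leaves v + internal v)
    ≡⟨ cong₂ _+_ (leaves+internal t) (leaves+internal (node ts)) ⟩
  (size t + 1) + (size v + 1)
    ≡⟨ +-assoc (size t + 1) (size v) 1 ⟨
  (size t + 1 + size v) + 1
    ≡⟨ cong (λ n → n + size v + 1) (+-comm (size t) 1) ⟩
  suc (size t) + size v + 1 ∎
  where
  open ≡-Reasoning
  open PlaneTrees
  v = node ts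

recurrences⇒transports : ∀ {B s r l i} → Recurrences B s r l i → Transports B s r l i
recurrences⇒transports {B} {s} {r} {l} {i} R t =
  sub-φ t , rpath-φ t , λ 1≤t → leaves-φ t 1≤t , internal-φ t 1≤t
  where
  open CatalanOperations B
  open PlaneTrees using (size; leaves; internal; sub; rpath)
  open Recurrences R
  open ≡-Reasoning

  size-φ : ∀ t → ∣ φ B t ∣ ≡ size t
  size-φ (node []) = size-e
  size-φ (node (t ∷ [])) = begin
    ∣ ƛ (φ B t) ∣    ≡⟨ size-ƛ (φ B t) ⟩
    suc ∣ φ B t ∣    ≡⟨ cong suc (size-φ t) ⟩
    suc (size t)     ≡⟨ +-identityʳ _ ⟨
    suc (size t) + 0 ∎
  size-φ (node (t ∷ t′ ∷ ts)) = begin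
    ∣ ƛ (φ B t) ⊕ v ∣      ≡⟨ size-⊕ (ƛ (φ B t)) v ⟩
    ∣ ƛ (φ B t) ∣ + ∣ v ∣  ≡⟨ cong₂ _+_ (trans (size-ƛ (φ B t)) (cong suc (size-φ t)))
                                        (size-φ (node (t′ ∷ ts))) ⟩
    suc (size t) + size (node (t′ ∷ ts)) ∎
    where v = φ B (node (t′ ∷ ts))

  φ-nonempty : ∀ t → 1 ≤ size t → 1 ≤ ∣ φ B t ∣
  φ-nonempty t = subst (1 ≤_) (sym (size-φ t))

  ƛ-nonempty : ∀ x → 1 ≤ ∣ ƛ x ∣
  ƛ-nonempty x = subst (1 ≤_) (sym (size-ƛ x)) (s≤s z≤n)

  sub-φ : ∀ t → sub t ≡ s (φ B t)
  sub-φ (node []) = sym s-e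
  sub-φ (node (t ∷ [])) = sym (s-ƛ (φ B t))
  sub-φ (node (t ∷ t′ ∷ ts)) = sym (trans (s-⊕ (ƛ (φ B t)) _)
    (cong₂ _+_ (s-ƛ (φ B t)) (sym (sub-φ (node (t′ ∷ ts))))))

  rpath-φ : ∀ t → rpath t ≡ r (φ B t)
  rpath-φ (node []) = sym r-e
  rpath-φ (node (t ∷ [])) = trans (cong suc (rpath-φ t)) (sym (r-ƛ (φ B t)))
  rpath-φ (node (t ∷ t′ ∷ ts)) = trans (rpath-φ (node (t′ ∷ ts)))
    (sym (r-⊕ (ƛ (φ B t)) _ (φ-nonempty (node (t′ ∷ ts)) (s≤s z≤n))))

  -- Separated from `leaves-φ` because the agreement may fail at `e`; the value at `ƛ e` comes from
  -- `l-ƛe` instead of from an induction hypothesis.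
  leaves-ƛφ : ∀ t → leaves t ≡ l (ƛ (φ B t))
  leaves-φ : ∀ t → 1 ≤ size t → leaves t ≡ l (φ B t)
  leaves-ƛφ (node []) = sym l-ƛe
  leaves-ƛφ t@(node (_ ∷ _)) =
    trans (leaves-φ t (s≤s z≤n)) (sym (l-ƛ (φ B t) (φ-nonempty t (s≤s z≤n))))
  leaves-φ (node (t ∷ [])) _ = leaves-ƛφ t
  leaves-φ (node (t ∷ t′ ∷ ts)) _ = trans
    (cong₂ _+_ (leaves-ƛφ t) (leaves-φ (node (t′ ∷ ts)) (s≤s z≤n)))
    (sym (l-⊕ (ƛ (φ B t)) _ (ƛ-nonempty (φ B t)) (φ-nonempty (node (t′ ∷ ts)) (s≤s z≤n))))

  internal-φ : ∀ t → 1 ≤ size t → internal t ≡ i (φ B t)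
  internal-φ t 1≤t = +-cancelˡ-≡ (leaves t) _ _ (begin
    leaves t + internal t   ≡⟨ leaves+internal t ⟩
    size t + 1              ≡⟨ cong (_+ 1) (size-φ t) ⟨
    ∣ φ B t ∣ + 1           ≡⟨ l+i (φ B t) (φ-nonempty t 1≤t) ⟨
    l (φ B t) + i (φ B t)   ≡⟨ cong (_+ i (φ B t)) (leaves-φ t 1≤t) ⟨
    leaves t + i (φ B t)    ∎)

-- Counting over ranges and over the entries of a word; initial segments

count-++ : ∀ {A : Set} {P : A → Set} (P? : Decidable P) xs ys →
           count P? (xs ++ ys) ≡ count P? xs + count P? ys
count-++ P? xs ys = trans (cong length (filter-++ P? xs ys)) (length-++ (filter P? xs))

count-map-⇔ : ∀ {A B : Set} {P : A → Set} {Q : B → Set} (P? : Decidable P) (Q? : Decidable Q)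
              (f : A → B) xs → (∀ {x} → x ∈ xs → Q (f x) ⇔ P x) →
              count Q? (map f xs) ≡ count P? xs
count-map-⇔ P? Q? f []       Q⇔P = refl
count-map-⇔ P? Q? f (x ∷ xs) Q⇔P
  -- `filter` branches on `does`, so the two booleans are matched along with their equality rather
  -- than the decisions themselves.
  with does (Q? (f x)) | does (P? x) | does-⇔ (Q⇔P (here refl)) (Q? (f x)) (P? x)
... | true  | .true  | refl = cong suc (count-map-⇔ P? Q? f xs (Q⇔P ∘ there))
... | false | .false | refl = count-map-⇔ P? Q? f xs (Q⇔P ∘ there)

count-⇔ : ∀ {A : Set} {P Q : A → Set} (P? : Decidable P) (Q? : Decidable Q) xs →
          (∀ {x} → x ∈ xs → Q x ⇔ P x) → count Q? xs ≡ count P? xs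
count-⇔ P? Q? []       Q⇔P = refl
count-⇔ P? Q? (x ∷ xs) Q⇔P
  with does (Q? x) | does (P? x) | does-⇔ (Q⇔P (here refl)) (Q? x) (P? x)
... | true  | .true  | refl = cong suc (count-⇔ P? Q? xs (Q⇔P ∘ there))
... | false | .false | refl = count-⇔ P? Q? xs (Q⇔P ∘ there)

count-none : ∀ {A : Set} {P : A → Set} (P? : Decidable P) xs →
             (∀ {x} → x ∈ xs → ¬ P x) → count P? xs ≡ 0
count-none P? []       ¬P = refl
count-none P? (x ∷ xs) ¬P rewrite dec-false (P? x) (¬P (here refl)) = count-none P? xs (¬P ∘ there)

count-accept : ∀ {A : Set} {P : A → Set} (P? : Decidable P) {x} xs →
               P x → count P? (x ∷ xs) ≡ suc (count P? xs)
count-accept P? {x} xs px rewrite dec-true (P? x) px = refl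

count-reject : ∀ {A : Set} {P : A → Set} (P? : Decidable P) {x} xs →
               ¬ P x → count P? (x ∷ xs) ≡ count P? xs
count-reject P? {x} xs ¬px rewrite dec-false (P? x) ¬px = refl

∈-range⁺ : ∀ {x n} → 1 ≤ x → x ≤ n → x ∈ range n
∈-range⁺ {suc x} _ x≤n = ∈-applyUpTo⁺ suc x≤n

∈-range⁻ : ∀ {x n} → x ∈ range n → 1 ≤ x × x ≤ n
∈-range⁻ {n = n} = All.lookup (All-range n)

∈-perm⁻ : ∀ {x w n} → w ↭ range n → x ∈ w → 1 ≤ x × x ≤ n
∈-perm⁻ {n = n} p = All.lookup (All-perm n p)

∈-perm⁺ : ∀ {x w n} → w ↭ range n → 1 ≤ x → x ≤ n → x ∈ w
∈-perm⁺ p 1≤x x≤n = ∈-resp-↭ (↭-sym p) (∈-range⁺ 1≤x x≤n)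

range-∷ : ∀ n → range (suc n) ≡ 1 ∷ map suc (range n)
range-∷ n = range-+ 1 n

range-∷ʳ : ∀ n → range (suc n) ≡ range n ++ [ suc n ]
range-∷ʳ n = sym (applyUpTo-∷ʳ suc n)

-- Common shape of many `⊕` clauses: an index up to `m` sees only the first summand, an index
-- `m + k` only the second.
count-range-+ : ∀ {P Q R : ℕ → Set} (P? : Decidable P) (Q? : Decidable Q) (R? : Decidable R) m n →
                (∀ {k} → 1 ≤ k → k ≤ m → R k ⇔ P k) →
                (∀ {k} → 1 ≤ k → k ≤ n → R (m + k) ⇔ Q k) →
                count R? (range (m + n)) ≡ count P? (range m) + count Q? (range n)
count-range-+ P? Q? R? m n R⇔P R⇔Q = begin
  count R? (range (m + n))
    ≡⟨ cong (count R?) (range-+ m n) ⟩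
  count R? (range m ++ map (m +_) (range n))
    ≡⟨ count-++ R? (range m) _ ⟩
  count R? (range m) + count R? (map (m +_) (range n))
    ≡⟨ cong₂ _+_ (count-⇔ P? R? (range m) (λ k∈ → let 1≤k , k≤m = ∈-range⁻ k∈ in R⇔P 1≤k k≤m))
                 (count-map-⇔ Q? R? (m +_) (range n) (λ k∈ → let 1≤k , k≤n = ∈-range⁻ k∈ in R⇔Q 1≤k k≤n)) ⟩
  count P? (range m) + count Q? (range n) ∎
  where open ≡-Reasoning

-- Used for indecomposability: `comp` counts the places where an initial part closes up, and the
-- whole object always does.
count-only-last : ∀ {P : ℕ → Set} (P? : Decidable P) n →
                  (∀ {k} → 1 ≤ k → k ≤ n → ¬ P k) → P (suc n) → count P? (range (suc n)) ≡ 1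
count-only-last P? n ¬P p = begin
  count P? (range (suc n))                     ≡⟨ cong (count P?) (range-∷ʳ n) ⟩
  count P? (range n ++ [ suc n ])              ≡⟨ count-++ P? (range n) _ ⟩
  count P? (range n) + count P? [ suc n ]      ≡⟨ cong₂ _+_
    (count-none P? (range n) (λ k∈ → let 1≤k , k≤n = ∈-range⁻ k∈ in ¬P 1≤k k≤n))
    (count-accept P? [] p) ⟩
  1                                            ∎
  where open ≡-Reasoning

indicator-⇔ : ∀ {A B : Set} → A ⇔ B → (a? : Dec A) (b? : Dec B) →
              (if does a? then 1 else 0) ≡ (if does b? then 1 else 0)
indicator-⇔ A⇔B a? b? = cong (if_then 1 else 0) (does-⇔ A⇔B a? b?)

countEntries-++ : ∀ {P : ℕ → List ℕ → Set} (P? : ∀ x xs → Dec (P x xs)) v {w} →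
                  (∀ {x} us → x ∈ v → P x (us ++ w) ⇔ P x us) →
                  countEntries P? (v ++ w) ≡ countEntries P? v + countEntries P? w
countEntries-++ P? []      {w} P⇔ = refl
countEntries-++ P? (x ∷ v) {w} P⇔ = trans
  (cong₂ _+_ (indicator-⇔ (P⇔ v (here refl)) (P? x (v ++ w)) (P? x v))
             (countEntries-++ P? v (λ us x∈ → P⇔ us (there x∈))))
  (sym (+-assoc (if does (P? x v) then 1 else 0) _ _))

countEntries-skip : ∀ {P : ℕ → List ℕ → Set} (P? : ∀ x xs → Dec (P x xs)) v {w} →
                    (∀ {x} us → x ∈ v → ¬ P x (us ++ w)) →
                    countEntries P? (v ++ w) ≡ countEntries P? w
countEntries-skip P? []      {w} ¬P = refl
countEntries-skip P? (x ∷ v) {w} ¬P rewrite dec-false (P? x (v ++ w)) (¬P v (here refl)) =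
  countEntries-skip P? v (λ us x∈ → ¬P us (there x∈))

countEntries-map : ∀ {P : ℕ → List ℕ → Set} (P? : ∀ x xs → Dec (P x xs)) (f : ℕ → ℕ) w →
                   (∀ x us → P (f x) (map f us) ⇔ P x us) →
                   countEntries P? (map f w) ≡ countEntries P? w
countEntries-map P? f []      P⇔ = refl
countEntries-map P? f (x ∷ w) P⇔ = cong₂ _+_
  (indicator-⇔ (P⇔ x w) (P? (f x) (map f w)) (P? x w)) (countEntries-map P? f w P⇔)

countEntries-complement : ∀ {P : ℕ → List ℕ → Set} (P? : ∀ x xs → Dec (P x xs)) w →
  countEntries P? w + countEntries (λ x xs → ¬? (P? x xs)) w ≡ length w
countEntries-complement P? []      = refl
countEntries-complement P? (x ∷ w) with does (P? x w)
... | true  = cong suc (countEntries-complement P? w)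
... | false = trans (+-suc _ _) (cong suc (countEntries-complement P? w))

-- The first entry of the shifted word exceeds every entry of `v`, so `v` contributes no
-- right-to-left maximum; this is where `w` must be nonempty.
rlMax-shifted-++ : ∀ m {v w} → All (_≤ m) v → All (1 ≤_) w → 1 ≤ length w →
  countEntries rlMax? (v ++ map (m +_) w) ≡ countEntries rlMax? w
rlMax-shifted-++ m {v} {w@(_ ∷ _)} v≤m (1≤y ∷ _) _ = trans
  (countEntries-skip rlMax? v (λ us x∈ x-max →
    <⇒≱ (All.head (AllP.++⁻ʳ us x-max)) (≤-trans (All.lookup v≤m x∈) (m≤m+n m _))))
  (countEntries-map rlMax? (m +_) w (λ x us → mk⇔
    (λ p → All.map (+-cancelˡ-< m _ _) (AllP.map⁻ p))
    (λ p → AllP.map⁺ (All.map (+-monoʳ-< m) p))))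

rlMin-shifted-++ : ∀ m {v w} → All (_≤ m) v → All (1 ≤_) w →
  countEntries rlMin? (v ++ map (m +_) w) ≡ countEntries rlMin? v + countEntries rlMin? w
rlMin-shifted-++ m {v} {w} v≤m 1≤w = trans
  (countEntries-++ rlMin? v (λ us x∈ → mk⇔ (AllP.++⁻ˡ us) (λ p → AllP.++⁺ p
    (AllP.map⁺ (All.map (λ 1≤y → ≤-<-trans (All.lookup v≤m x∈) (m<m+n m 1≤y)) 1≤w)))))
  (cong (countEntries rlMin? v +_) (countEntries-map rlMin? (m +_) w (λ x us → mk⇔
    (λ p → All.map (+-cancelˡ-< m _ _) (AllP.map⁻ p))
    (λ p → AllP.map⁺ (All.map (+-monoʳ-< m) p)))))

-- Since `v` already uses up `1, …, s`, only the shifted part decides whether `zs` is an initial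
-- segment. The link to `zs` is stated through membership because for tableaux the two lists differ
-- in order.
sameElements-split : ∀ s {j v zs as} → v ↭ range s → All (1 ≤_) as →
  (∀ {x} → x ∈ zs ⇔ (x ∈ v ++ map (s +_) as)) →
  SameElements zs (range (s + j)) ⇔ SameElements as (range j)
sameElements-split s {j} {v} {zs} {as} perm 1≤as zs⇔ = mk⇔ restrict extend
  where
  restrict : SameElements zs (range (s + j)) → SameElements as (range j)
  restrict (zs⊆ , ⊆zs) = All.tabulate as⊆ , All.tabulate ⊆as
    where
    as⊆ : ∀ {a} → a ∈ as → a ∈ range j
    as⊆ a∈ = ∈-range⁺ (All.lookup 1≤as a∈) (+-cancelˡ-≤ s _ _
      (proj₂ (∈-range⁻ (All.lookup zs⊆ (from zs⇔ (∈-++⁺ʳ v (∈-map⁺ (s +_) a∈)))))))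
    ⊆as : ∀ {k} → k ∈ range j → k ∈ as
    ⊆as {k} k∈ with 1≤k , k≤j ← ∈-range⁻ k∈
      with ∈-++⁻ v (to zs⇔ (All.lookup ⊆zs (∈-range⁺ (≤-trans 1≤k (m≤n+m k s)) (+-monoʳ-≤ s k≤j))))
    ... | inj₁ s+k∈v = ⊥-elim (<⇒≱ (m<m+n s 1≤k) (proj₂ (∈-perm⁻ perm s+k∈v)))
    ... | inj₂ s+k∈ with a , a∈ , eq ← ∈-map⁻ (s +_) s+k∈ =
      subst (_∈ as) (sym (+-cancelˡ-≡ s k a eq)) a∈

  extend : SameElements as (range j) → SameElements zs (range (s + j))
  extend (as⊆ , ⊆as) = All.tabulate zs⊆ , All.tabulate ⊆zs
    where
    zs⊆ : ∀ {x} → x ∈ zs → x ∈ range (s + j)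
    zs⊆ x∈ with ∈-++⁻ v (to zs⇔ x∈)
    ... | inj₁ x∈v = let 1≤x , x≤s = ∈-perm⁻ perm x∈v in ∈-range⁺ 1≤x (≤-trans x≤s (m≤m+n s j))
    ... | inj₂ x∈as with a , a∈ , refl ← ∈-map⁻ (s +_) x∈as =
      let 1≤a , a≤j = ∈-range⁻ (All.lookup as⊆ a∈) in
      ∈-range⁺ (≤-trans 1≤a (m≤n+m a s)) (+-monoʳ-≤ s a≤j)
    ⊆zs : ∀ {x} → x ∈ range (s + j) → x ∈ zs
    ⊆zs {x} x∈ with 1≤x , x≤s+j ← ∈-range⁻ x∈ with ≤-<-connex x s
    ... | inj₁ x≤s = from zs⇔ (∈-++⁺ˡ (∈-perm⁺ perm 1≤x x≤s))
    ... | inj₂ s<x = from zs⇔ (∈-++⁺ʳ v (subst (_∈ map (s +_) as) (m+[n∸m]≡n (<⇒≤ s<x))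
      (∈-map⁺ (s +_) (All.lookup ⊆as (∈-range⁺ (m<n⇒0<n∸m s<x) (m≤n+o⇒m∸n≤o x s x≤s+j))))))

sameElements-perm : ∀ {w n} → w ↭ range n → SameElements w (range n)
sameElements-perm p = All.tabulate (∈-resp-↭ p) , All.tabulate (∈-resp-↭ (↭-sym p))

take-++-≤ : ∀ {A : Set} {k} {v w : List A} → k ≤ length v → take k (v ++ w) ≡ take k v
take-++-≤ {k = zero}              _         = refl
take-++-≤ {k = suc k} {v = _ ∷ _} (s≤s k≤v) = cong (_ ∷_) (take-++-≤ k≤v)

take-length-+ : ∀ {A : Set} (v : List A) {k w} → take (length v + k) (v ++ w) ≡ v ++ take k w
take-length-+ []      = refl
take-length-+ (x ∷ v) = cong (x ∷_) (take-length-+ v)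

∈-take : ∀ {A : Set} {x : A} k xs → x ∈ take k xs → x ∈ xs
∈-take (suc k) (y ∷ xs) (here eq)  = here eq
∈-take (suc k) (y ∷ xs) (there x∈) = there (∈-take k xs x∈)

All-take : ∀ {A : Set} {P : A → Set} k {xs} → All P xs → All P (take k xs)
All-take k {xs} ps = All.tabulate (λ x∈ → All.lookup ps (∈-take k xs x∈))

-- Dyck paths: returns, final descent, peaks and double rises

module DyckPathStatistics where
  open DyckPaths
  open DyckPath

  trailing : List Step → ℕ
  trailing w = length (takeWhile (d ≟ˢ_) (reverse w))

  takeWhile-u : ∀ v w → takeWhile (d ≟ˢ_) (v ++ u ∷ w) ≡ takeWhile (d ≟ˢ_) v
  takeWhile-u []      w = refl
  takeWhile-u (u ∷ v) w = refl
  takeWhile-u (d ∷ v) w = cong (d ∷_) (takeWhile-u v w)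

  -- Reading `w` from height `h` ends on the axis, so `v` is counted from height 0. The case `down`
  -- splits because only a step from height 1 is a return.
  returns-++ : ∀ {h w} v → DyckFrom h w → returns h (w ++ v) ≡ returns h w + returns 0 v
  returns-++ v stop = refl
  returns-++ v (up p) = returns-++ v p
  returns-++ v (down {zero} p) = cong suc (returns-++ v p)
  returns-++ v (down {suc h} p) = returns-++ v p

  -- Raised by one, `w` never touches the axis; the single return is the appended `d`.
  returns-wrap : ∀ {h w} → DyckFrom h w → returns (suc h) (w ++ [ d ]) ≡ 1
  returns-wrap stop = refl
  returns-wrap (up p) = returns-wrap p
  returns-wrap (down p) = returns-wrap p

  rcomp-ƛ : ∀ w → trailing (u ∷ w ++ [ d ]) ≡ 1 + trailing w
  rcomp-ƛ w = cong length (begin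
    takeWhile (d ≟ˢ_) (reverse (u ∷ w ++ [ d ]))
      ≡⟨ cong (takeWhile (d ≟ˢ_)) (unfold-reverse u (w ++ [ d ])) ⟩
    takeWhile (d ≟ˢ_) (reverse (w ++ [ d ]) ++ [ u ])
      ≡⟨ cong (λ v → takeWhile (d ≟ˢ_) (v ++ [ u ])) (reverse-++ w [ d ]) ⟩
    d ∷ takeWhile (d ≟ˢ_) (reverse w ++ [ u ])
      ≡⟨ cong (d ∷_) (takeWhile-u (reverse w) []) ⟩
    d ∷ takeWhile (d ≟ˢ_) (reverse w) ∎)
    where open ≡-Reasoning

  -- The second factor is displayed as `u ∷ v` because a nonempty Dyck path begins with `u`, which
  -- stops the final run of `d`s before it can enter `w`.
  rcomp-⊕ : ∀ w v → trailing (w ++ u ∷ v) ≡ trailing (u ∷ v)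
  rcomp-⊕ w v = cong length (begin
    takeWhile (d ≟ˢ_) (reverse (w ++ u ∷ v))
      ≡⟨ cong (takeWhile (d ≟ˢ_)) (reverse-++ w (u ∷ v)) ⟩
    takeWhile (d ≟ˢ_) (reverse (u ∷ v) ++ reverse w)
      ≡⟨ cong (λ x → takeWhile (d ≟ˢ_) (x ++ reverse w)) (unfold-reverse u v) ⟩
    takeWhile (d ≟ˢ_) ((reverse v ++ [ u ]) ++ reverse w)
      ≡⟨ cong (takeWhile (d ≟ˢ_)) (++-assoc (reverse v) [ u ] (reverse w)) ⟩
    takeWhile (d ≟ˢ_) (reverse v ++ u ∷ reverse w)
      ≡⟨ takeWhile-u (reverse v) (reverse w) ⟩
    takeWhile (d ≟ˢ_) (reverse v)
      ≡⟨ takeWhile-u (reverse v) [] ⟨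
    takeWhile (d ≟ˢ_) (reverse v ++ [ u ])
      ≡⟨ cong (takeWhile (d ≟ˢ_)) (unfold-reverse u v) ⟨
    takeWhile (d ≟ˢ_) (reverse (u ∷ v)) ∎)
    where open ≡-Reasoning

  -- A path ends in d, so no peak straddles the boundary.
  peaks-++ : ∀ {h w} v → DyckFrom h w → factors u d (w ++ v) ≡ factors u d w + factors u d v
  peaks-++ v stop = refl
  peaks-++ v (up (up p)) = peaks-++ v (up p)
  peaks-++ v (up (down p)) = cong suc (peaks-++ v (down p))
  peaks-++ v (down (up p)) = peaks-++ v (up p)
  peaks-++ v (down (down p)) = peaks-++ v (down p)
  peaks-++ []      (down stop) = refl
  peaks-++ (x ∷ v) (down stop) = refl

  -- A path ending on the axis cannot end in `u`, so each `u` is followed by a step and starts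
  -- exactly one of the factors `ud` and `uu`.
  peaks+uu : ∀ {h w} → DyckFrom h w → factors u d w + factors u u w ≡ count (u ≟ˢ_) w
  peaks+uu stop = refl
  peaks+uu (up (up {w = w} p)) =
    trans (+-suc (factors u d (u ∷ w)) _) (cong suc (peaks+uu (up p)))
  peaks+uu (up (down p)) = cong suc (peaks+uu (down p))
  peaks+uu (down stop) = refl
  peaks+uu (down (up p)) = peaks+uu (up p)
  peaks+uu (down (down p)) = peaks+uu (down p)

  peak-ƛ : ∀ {w} → DyckFrom 0 w → 1 ≤ count (u ≟ˢ_) w →
           factors u d (u ∷ w ++ [ d ]) ≡ factors u d w
  -- Matching on `up` shows that `w` begins with `u`, so the new first step forms no peak; for empty
  -- `w` it would form one.
  peak-ƛ p@(up _) _ = trans (peaks-++ [ d ] p) (+-identityʳ _)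

  recurrences : Recurrences operations comp rcomp peak nonpeak
  recurrences = record
    { size-e = refl
    ; size-ƛ = λ p → cong suc (trans (count-++ (u ≟ˢ_) (word p) [ d ]) (+-identityʳ _))
    ; size-⊕ = λ p q → count-++ (u ≟ˢ_) (word p) (word q)
    ; s-e = refl
    ; s-ƛ = λ p → returns-wrap (isDyck p)
    ; s-⊕ = λ p q → returns-++ (word q) (isDyck p)
    ; r-e = refl
    ; r-ƛ = λ p → rcomp-ƛ (word p)
    ; r-⊕ = λ p q → last-run (word p) (isDyck q)
    ; l-ƛe = refl
    ; l-ƛ = λ p → peak-ƛ (isDyck p)
    ; l-⊕ = λ p q _ _ → peaks-++ (word q) (isDyck p)
    ; l+i = λ p _ → trans (+-suc (peak p) _)
        (trans (cong suc (peaks+uu (isDyck p))) (+-comm 1 (semilength p)))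
    }
    where
    last-run : ∀ w {v} → DyckFrom 0 v → 1 ≤ count (u ≟ˢ_) v → trailing (w ++ v) ≡ trailing v
    last-run w {u ∷ v} (up _) _ = rcomp-⊕ w v

-- Triangulations: degrees of the end vertices and apexes over sides

module TriangulationStatistics where
  open Triangulations
  open Triangulation

  edge? : ∀ T i j → Dec ((i , j) ∈ edges T)
  edge? T i j = (i , j) ∈ᴱ? edges T

  adjacent⇔edge : ∀ T {i j} → i < j → Adjacent T i j ⇔ ((i , j) ∈ edges T)
  adjacent⇔edge T i<j = mk⇔
    (λ { (inj₁ ij∈) → ij∈ ; (inj₂ ji∈) → ⊥-elim (<-asym i<j (proj₁ (proj₂ (inPolygon T ji∈)))) })
    inj₁

  ¬adjacent-self : ∀ T {i} → ¬ Adjacent T i i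
  ¬adjacent-self T (inj₁ ii∈) = <-irrefl refl (proj₁ (proj₂ (inPolygon T ii∈)))
  ¬adjacent-self T (inj₂ ii∈) = <-irrefl refl (proj₁ (proj₂ (inPolygon T ii∈)))

  firstSide : ∀ T → (1 , 2) ∈ edges T
  firstSide T = maximal T ≤-refl ≤-refl (s≤s (s≤s z≤n)) λ { a∈ →
    λ { (inj₁ (1<a , a<2 , _)) → <⇒≱ a<2 1<a
      ; (inj₂ (a<1 , _)) → <⇒≱ a<1 (proj₁ (inPolygon T a∈)) } }

  -- The `∸ 1` discounts the neighbour 2 of vertex 1, which leaves the `size T` candidates
  -- `3, …, size T + 2`. In this form counts can be compared index by index.
  comp-range : ∀ T → comp T ≡ count (λ k → edge? T 1 (2 + k)) (range (size T))
  comp-range T = begin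
    count (adjacent? T 1) (range (2 + n)) ∸ 1
      ≡⟨ cong (λ xs → count (adjacent? T 1) xs ∸ 1) (range-+ 2 n) ⟩
    count (adjacent? T 1) (1 ∷ 2 ∷ map (2 +_) (range n)) ∸ 1
      ≡⟨ cong (_∸ 1) (trans (count-reject (adjacent? T 1) _ (¬adjacent-self T))
                            (count-accept (adjacent? T 1) _ (inj₁ (firstSide T)))) ⟩
    count (adjacent? T 1) (map (2 +_) (range n))
      ≡⟨ count-map-⇔ _ _ (2 +_) (range n) (λ _ → adjacent⇔edge T (s≤s (s≤s z≤n))) ⟩
    count (λ k → edge? T 1 (2 + k)) (range n) ∎
    where
    open ≡-Reasoning
    n = size T

  -- Here the `∸ 1` discounts the neighbour 1 along the long side.
  rcomp-range : ∀ T → rcomp T ≡ count (λ k → edge? T (suc k) (2 + size T)) (range (size T))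
  rcomp-range T = begin
    count adj? (range (2 + n)) ∸ 1
      ≡⟨ cong (λ xs → count adj? xs ∸ 1) (trans (range-∷ʳ (suc n)) (cong (_++ [ 2 + n ]) (range-∷ n))) ⟩
    count adj? (1 ∷ map suc (range n) ++ [ 2 + n ]) ∸ 1
      ≡⟨ cong (_∸ 1) (count-accept adj? _ (inj₂ (longSide T))) ⟩
    count adj? (map suc (range n) ++ [ 2 + n ])
      ≡⟨ count-++ adj? (map suc (range n)) _ ⟩
    count adj? (map suc (range n)) + count adj? [ 2 + n ]
      ≡⟨ cong₂ _+_
           (count-map-⇔ _ _ suc (range n) (λ k∈ → mk⇔
             (to (adjacent⇔edge T (s≤s (s≤s (proj₂ (∈-range⁻ k∈))))) ∘ Sum.swap) inj₂))
           (count-reject adj? [] (¬adjacent-self T)) ⟩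
    count (λ k → edge? T (suc k) (2 + n)) (range n) + 0
      ≡⟨ +-identityʳ _ ⟩
    count (λ k → edge? T (suc k) (2 + n)) (range n) ∎
    where
    open ≡-Reasoning
    n = size T
    adj? = adjacent? T (2 + n)

  -- The vertex i counted by tr is k + 1, and j is the apex over the side (i, i + 1).
  Middle : Triangulation → ℕ → Set
  Middle T k = ∃ λ j → (j , suc k) ∈ edges T × (j , 2 + k) ∈ edges T

  MiddleAdjacent : Triangulation → ℕ → Set
  MiddleAdjacent T i = ∃ λ j → j < i × Adjacent T j i × Adjacent T j (suc i)

  middle? : ∀ T i → Dec (MiddleAdjacent T i)
  middle? T i = anyUpTo? (λ j → adjacent? T j i ×-dec adjacent? T j (suc i)) i

  middle⇔ : ∀ T k → MiddleAdjacent T (suc k) ⇔ Middle T k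
  middle⇔ T k = mk⇔
    (λ (j , j< , adj , adj′) → j , to (adjacent⇔edge T j<) adj , to (adjacent⇔edge T (m<n⇒m<1+n j<)) adj′)
    (λ (j , j∈ , j∈′) → j , proj₁ (proj₂ (inPolygon T j∈)) , inj₁ j∈ , inj₁ j∈′)

  middle-cong : ∀ T U {k l} → Middle T k ⇔ Middle U l →
                MiddleAdjacent T (suc k) ⇔ MiddleAdjacent U (suc l)
  middle-cong T U {k} {l} T⇔U = mk⇔
    (from (middle⇔ U l) ∘ to T⇔U ∘ to (middle⇔ T k))
    (from (middle⇔ T k) ∘ from T⇔U ∘ to (middle⇔ U l))

  tr-range : ∀ T → tr T ≡ count (λ k → middle? T (suc k)) (range (size T))
  tr-range T = count-map-⇔ _ _ suc (range (size T)) (λ _ → mk⇔ id id)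

  -- An inversion view with the end points as indices, so that matching discards impossible edges;
  -- `1 ≤ i` keeps shifted edges away from the new vertex.
  data ConeEdge (T : Triangulation) : ℕ → ℕ → Set where
    first   : ConeEdge T 1 2
    long    : ConeEdge T 1 (3 + size T)
    shifted : ∀ {i j} → (i , j) ∈ edges T → 1 ≤ i → ConeEdge T (suc i) (suc j)

  coneEdge : ∀ T {i j} → (i , j) ∈ edges (addVertex T) → ConeEdge T i j
  coneEdge T (here refl) = first
  coneEdge T (there (here refl)) = long
  coneEdge T (there (there ij∈)) with (i , j) , ij∈′ , refl ← ∈-map⁻ shiftEdge ij∈ =
    shifted ij∈′ (proj₁ (inPolygon T ij∈′))

  shift-∈ : ∀ T {i j} → (i , j) ∈ edges T → (suc i , suc j) ∈ edges (addVertex T)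
  shift-∈ T ij∈ = there (there (∈-map⁺ shiftEdge ij∈))

  shift-∈⁻ : ∀ T {i j} → 1 ≤ i → (suc i , suc j) ∈ edges (addVertex T) → (i , j) ∈ edges T
  shift-∈⁻ T 1≤i ij∈ with coneEdge T ij∈
  shift-∈⁻ T () ij∈ | first
  shift-∈⁻ T () ij∈ | long
  ... | shifted ij∈′ _ = ij∈′

  -- The new vertex has only the neighbours 2, which is discounted, and `3 + size T`, which is the
  -- last candidate.
  comp-ƛ : ∀ T → comp (addVertex T) ≡ 1
  comp-ƛ T = trans (comp-range (addVertex T))
    (count-only-last (λ k → edge? (addVertex T) 1 (2 + k)) (size T)
      (λ 1≤k k≤n → notConeEdge 1≤k k≤n ∘ coneEdge T) (there (here refl)))
    where
    notConeEdge : ∀ {k} → 1 ≤ k → k ≤ size T → ¬ ConeEdge T 1 (2 + k)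
    notConeEdge () k≤n first
    notConeEdge 1≤k k≤n long = <-irrefl refl k≤n
    notConeEdge 1≤k k≤n (shifted _ ())

  rcomp-ƛ : ∀ T → rcomp (addVertex T) ≡ 1 + rcomp T
  rcomp-ƛ T = begin
    rcomp (addVertex T)                              ≡⟨ rcomp-range (addVertex T) ⟩
    count edgeᶜ? (range (suc n))                     ≡⟨ cong (count edgeᶜ?) (range-∷ n) ⟩
    -- The new long side is the discounted one, so the additional unit is the old long side, which
    -- now starts at vertex 2.
    count edgeᶜ? (1 ∷ map suc (range n))             ≡⟨ count-accept edgeᶜ? _ (shift-∈ T (longSide T)) ⟩
    suc (count edgeᶜ? (map suc (range n)))           ≡⟨ cong suc (count-map-⇔ _ edgeᶜ? suc (range n)
      (λ _ → mk⇔ (shift-∈⁻ T (s≤s z≤n)) (shift-∈ T))) ⟩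
    suc (count (λ k → edge? T (suc k) (2 + n)) (range n)) ≡⟨ cong suc (rcomp-range T) ⟨
    suc (rcomp T)                                    ∎
    where
    open ≡-Reasoning
    n = size T
    edgeᶜ? = λ k → edge? (addVertex T) (suc k) (3 + n)

  middle-ƛ : ∀ T {k} → 1 ≤ k → k ≤ size T → Middle (addVertex T) (suc k) ⇔ Middle T k
  middle-ƛ T {k} 1≤k k≤n = mk⇔
    (λ (j , j∈ , j∈′) → down 1≤k (coneEdge T j∈) j∈′)
    (λ (j , j∈ , j∈′) → suc j , shift-∈ T j∈ , shift-∈ T j∈′)
    where
    down : ∀ {j} → 1 ≤ k → ConeEdge T j (2 + k) → (j , 3 + k) ∈ edges (addVertex T) → Middle T k
    down () first _
    down _ long _ = ⊥-elim (<-irrefl refl k≤n)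
    down _ (shifted j∈ 1≤j) j∈′ = _ , j∈ , shift-∈⁻ T 1≤j j∈′

  -- An apex for vertex 2 would have to be vertex 1, whose only neighbours are 2 and `3 + size T`;
  -- the latter is 3 only for `size T` equal to 0.
  ¬middle-1 : ∀ T → 1 ≤ size T → ¬ Middle (addVertex T) 1
  ¬middle-1 T 1≤n (j , j∈ , j∈′) = go (coneEdge T j∈) (coneEdge T j∈′) refl
    where
    go : ∀ {j l} → ConeEdge T j 2 → ConeEdge T j l → l ≢ 3
    go (shifted j∈ 1≤j) _ _ = <⇒≱ (proj₁ (proj₂ (inPolygon T j∈))) 1≤j
    go first long eq with () ← subst (1 ≤_) (suc-injective (suc-injective (suc-injective eq))) 1≤n
    go first (shifted _ ()) _

  tr-ƛ : ∀ T → 1 ≤ size T → tr (addVertex T) ≡ tr T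
  tr-ƛ T 1≤n = begin
    tr (addVertex T)                                ≡⟨ tr-range (addVertex T) ⟩
    count middleᶜ? (range (suc n))                  ≡⟨ cong (count middleᶜ?) (range-∷ n) ⟩
    count middleᶜ? (1 ∷ map suc (range n))          ≡⟨ count-reject middleᶜ? _
      (¬middle-1 T 1≤n ∘ to (middle⇔ (addVertex T) 1)) ⟩
    count middleᶜ? (map suc (range n))              ≡⟨ count-map-⇔ _ middleᶜ? suc (range n)
      (λ k∈ → let 1≤k , k≤n = ∈-range⁻ k∈ in middle-cong (addVertex T) T (middle-ƛ T 1≤k k≤n)) ⟩
    count (λ k → middle? T (suc k)) (range n)       ≡⟨ tr-range T ⟨
    tr T                                            ∎
    where
    open ≡-Reasoning
    n = size T
    middleᶜ? = λ k → middle? (addVertex T) (suc k)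

  -- The upper end of an edge of `U` is at least 2, where `relabel` is a plain shift, hence the form
  -- `2 + j`; only the lower end can be the shared vertex 1.
  data JoinEdge (T U : Triangulation) : ℕ → ℕ → Set where
    left  : ∀ {i j} → (i , j) ∈ edges T → JoinEdge T U i j
    right : ∀ {i j} → (i , 2 + j) ∈ edges U → 1 ≤ i →
            JoinEdge T U (relabel (size T) i) (size T + (2 + j))

  joinEdge : ∀ T U {i j} → (i , j) ∈ edges (join T U) → JoinEdge T U i j
  joinEdge T U ij∈ with ∈-++⁻ (edges T) ij∈
  ... | inj₁ ij∈T = left ij∈T
  ... | inj₂ ij∈U with (i , j) , ij∈′ , refl ← ∈-map⁻ (relabelEdge (size T)) ij∈U =
    fromU ij∈′ (inPolygon U ij∈′)
    where
    fromU : ∀ {i j n} → (i , j) ∈ edges U → 1 ≤ i × i < j × j ≤ n →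
            JoinEdge T U (relabel (size T) i) (relabel (size T) j)
    fromU {suc i} {suc (suc j)} ij∈ _ = right ij∈ (s≤s z≤n)
    fromU {suc i} {suc zero}    ij∈ (_ , s≤s () , _)

  relabel-injective : ∀ m {i j} → 1 ≤ i → 1 ≤ j → relabel m i ≡ relabel m j → i ≡ j
  relabel-injective m {i} {j} 1≤i 1≤j eq = ≤-antisym
    (≮⇒≥ (λ j<i → <⇒≢ (relabel-mono m 1≤j j<i) (sym eq)))
    (≮⇒≥ (λ i<j → <⇒≢ (relabel-mono m 1≤i i<j) eq))

  join-left : ∀ T U {i j} → j ≤ 2 + size T → (i , j) ∈ edges (join T U) → (i , j) ∈ edges T
  join-left T U j≤ ij∈ with joinEdge T U ij∈
  ... | left ij∈T = ij∈T
  ... | right {i} {j} ij∈U 1≤i = glued ij∈U (+-cancelˡ-≤ (size T) (2 + j) 2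
                                     (subst (size T + (2 + j) ≤_) (+-comm 2 (size T)) j≤)) 1≤i
    where
    -- The edge (1, 2) of U is glued to the long side of T.
    glued : ∀ {i j} → (i , 2 + j) ∈ edges U → 2 + j ≤ 2 → 1 ≤ i →
            (relabel (size T) i , size T + (2 + j)) ∈ edges T
    glued {suc zero} {zero} _ _ _ = subst (λ l → (1 , l) ∈ edges T) (+-comm 2 (size T)) (longSide T)
    glued {suc (suc i)} {zero} i2∈ _ _ with s≤s (s≤s ()) ← proj₁ (proj₂ (inPolygon U i2∈))
    glued {_} {suc j} _ (s≤s (s≤s ())) _

  -- An edge of `T` can reach this far only by ending at `size T + 2`; then `j` is 0 and `i` is 1,
  -- and the edge in question is the side `(1 , 2)` of `U`.
  join-right : ∀ T U {i j} → 1 ≤ i →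
               (relabel (size T) i , size T + (2 + j)) ∈ edges (join T U) → (i , 2 + j) ∈ edges U
  join-right T U {i} {j} 1≤i ij∈ = go (joinEdge T U ij∈) refl refl
    where
    m = size T
    go : ∀ {a b} → JoinEdge T U a b → a ≡ relabel m i → b ≡ m + (2 + j) → (i , 2 + j) ∈ edges U
    go (right {i′} {j′} ij∈U 1≤i′) eqᵢ eqⱼ
      with refl ← relabel-injective m 1≤i′ 1≤i eqᵢ
         | refl ← +-cancelˡ-≡ m (2 + j′) (2 + j) eqⱼ = ij∈U
    go (left ij∈T) refl refl = glued j≤0 i≤1
      where
      j≤0 : j ≤ 0
      j≤0 = s≤s⁻¹ (s≤s⁻¹ (+-cancelˡ-≤ m (2 + j) 2
        (subst (m + (2 + j) ≤_) (+-comm 2 m) (proj₂ (proj₂ (inPolygon T ij∈T))))))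
      i≤1 : i < 2 + j
      i≤1 = relabel-cancel m 1≤i (s≤s z≤n) (proj₁ (proj₂ (inPolygon T ij∈T)))
      glued : j ≤ 0 → i < 2 + j → (i , 2 + j) ∈ edges U
      glued z≤n i<2 with refl ← ≤-antisym (s≤s⁻¹ i<2) 1≤i = firstSide U

  join-right⇔ : ∀ T U {i j} → 1 ≤ i →
    ((relabel (size T) i , size T + (2 + j)) ∈ edges (join T U)) ⇔ ((i , 2 + j) ∈ edges U)
  join-right⇔ T U 1≤i = mk⇔ (join-right T U 1≤i)
    (λ ij∈ → ∈-++⁺ʳ (edges T) (∈-map⁺ (relabelEdge (size T)) ij∈))

  m+[2+k] : ∀ m k → m + (2 + k) ≡ 2 + (m + k)
  m+[2+k] m k = trans (+-suc m (suc k)) (cong suc (+-suc m k))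

  -- The glued edge is `(1 , 2)` in `U`, where it is not among the candidates, so it is not counted
  -- twice.
  comp-⊕ : ∀ T U → comp (join T U) ≡ comp T + comp U
  comp-⊕ T U = begin
    comp (join T U)      ≡⟨ comp-range (join T U) ⟩
    count (λ k → edge? (join T U) 1 (2 + k)) (range (size T + size U))
      ≡⟨ count-range-+ (λ k → edge? T 1 (2 + k)) (λ k → edge? U 1 (2 + k)) _ (size T) (size U)
           (λ _ k≤m → mk⇔ (join-left T U (s≤s (s≤s k≤m))) ∈-++⁺ˡ)
           (λ {k} _ _ → subst (λ l → ((1 , l) ∈ edges (join T U)) ⇔ ((1 , 2 + k) ∈ edges U))
             (m+[2+k] (size T) k) (join-right⇔ T U ≤-refl)) ⟩
    count (λ k → edge? T 1 (2 + k)) (range (size T)) + count (λ k → edge? U 1 (2 + k)) (range (size U))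
      ≡⟨ cong₂ _+_ (comp-range T) (comp-range U) ⟨
    comp T + comp U      ∎
    where open ≡-Reasoning

  -- For nonempty `U` the last vertex lies outside `T`, so the vertices `2, …, size T + 1` are not
  -- adjacent to it; the predicate for their block is therefore `⊥`.
  rcomp-⊕ : ∀ T U → 1 ≤ size U → rcomp (join T U) ≡ rcomp U
  rcomp-⊕ T U 1≤n = begin
    rcomp (join T U)     ≡⟨ rcomp-range (join T U) ⟩
    count (λ k → edge? (join T U) (suc k) (2 + (m + n))) (range (m + n))
      ≡⟨ count-range-+ {P = λ _ → ⊥} (λ _ → no λ ()) (λ k → edge? U (suc k) (2 + n)) _ m n
           (λ 1≤k k≤m → mk⇔ (λ k∈ → notLeft 1≤k k≤m (joinEdge T U k∈) refl refl) λ ())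
           (λ { {suc k} _ _ → subst (λ l → ((l , 2 + (m + n)) ∈ edges (join T U)) ⇔
                                           ((2 + k , 2 + n) ∈ edges U)) (+-suc m (suc k))
             (subst (λ l → ((m + (2 + k) , l) ∈ edges (join T U)) ⇔ ((2 + k , 2 + n) ∈ edges U))
               (m+[2+k] m n) (join-right⇔ T U (s≤s z≤n))) }) ⟩
    count (λ _ → no λ ()) (range m) + count (λ k → edge? U (suc k) (2 + n)) (range n)
      ≡⟨ cong₂ _+_ (count-none {P = λ _ → ⊥} (λ _ → no λ ()) (range m) (λ _ ())) (sym (rcomp-range U)) ⟩
    rcomp U              ∎
    where
    open ≡-Reasoning
    m = size T
    n = size U
    notLeft : ∀ {k i j} → 1 ≤ k → k ≤ m → JoinEdge T U i j → i ≡ suc k → j ≢ 2 + (m + n)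
    notLeft 1≤k k≤m (left ij∈) _ refl =
      <⇒≱ (m<m+n m 1≤n) (s≤s⁻¹ (s≤s⁻¹ (proj₂ (proj₂ (inPolygon T ij∈)))))
    notLeft 1≤k k≤m (right {suc zero} _ _) refl _ with () ← 1≤k
    notLeft 1≤k k≤m (right {suc (suc i)} _ _) eq _ = <⇒≱ (s≤s (s≤s k≤m))
      (subst (2 + m ≤_) eq (subst (2 + m ≤_) (sym (m+[2+k] m i)) (s≤s (s≤s (m≤m+n m i)))))

  middle-left : ∀ T U {k} → k ≤ size T → Middle (join T U) k ⇔ Middle T k
  middle-left T U k≤m = mk⇔
    (λ (j , j∈ , j∈′) → j , join-left T U (s≤s (m≤n⇒m≤1+n k≤m)) j∈ , join-left T U (s≤s (s≤s k≤m)) j∈′)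
    (λ (j , j∈ , j∈′) → j , ∈-++⁺ˡ j∈ , ∈-++⁺ˡ j∈′)

  middle-right : ∀ T U {k} → 1 ≤ k → Middle (join T U) (size T + k) ⇔ Middle U k
  middle-right T U {suc k} _ = mk⇔
    -- The edge to the larger vertex is examined first: that vertex lies beyond `T`, so the apex
    -- comes from `U`. The other edge may be the glued one, which `join-right` also handles.
    (λ (j , j∈ , j∈′) → down (joinEdge T U j∈′) refl j∈)
    (λ (j , j∈ , j∈′) → relabel m j ,
      subst (λ l → (relabel m j , l) ∈ edges (join T U)) (+-suc m (suc k))
            (from (join-right⇔ T U (proj₁ (inPolygon U j∈))) j∈) ,
      subst (λ l → (relabel m j , l) ∈ edges (join T U)) (m+[2+k] m (suc k))
            (from (join-right⇔ T U (proj₁ (inPolygon U j∈))) j∈′))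
    where
    m = size T
    down : ∀ {j l} → JoinEdge T U j l → l ≡ 2 + (m + suc k) →
           (j , suc (m + suc k)) ∈ edges (join T U) → Middle U (suc k)
    down (left j∈) refl _ =
      ⊥-elim (<⇒≱ (m<m+n m (s≤s z≤n)) (s≤s⁻¹ (s≤s⁻¹ (proj₂ (proj₂ (inPolygon T j∈))))))
    down (right {i} {j} j∈U 1≤i) eq j∈
      with refl ← +-cancelˡ-≡ m (2 + j) (3 + k) (trans eq (sym (m+[2+k] m (suc k)))) =
      i , join-right T U 1≤i (subst (λ l → (relabel m i , l) ∈ edges (join T U)) (sym (+-suc m (suc k))) j∈) ,
      j∈U

  tr-⊕ : ∀ T U → tr (join T U) ≡ tr T + tr U
  tr-⊕ T U = begin
    tr (join T U)        ≡⟨ tr-range (join T U) ⟩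
    count (λ k → middle? (join T U) (suc k)) (range (size T + size U))
      ≡⟨ count-range-+ (λ k → middle? T (suc k)) (λ k → middle? U (suc k)) _ (size T) (size U)
           (λ _ k≤m → middle-cong (join T U) T (middle-left T U k≤m))
           (λ 1≤k _ → middle-cong (join T U) U (middle-right T U 1≤k)) ⟩
    count (λ k → middle? T (suc k)) (range (size T)) + count (λ k → middle? U (suc k)) (range (size U))
      ≡⟨ cong₂ _+_ (tr-range T) (tr-range U) ⟨
    tr T + tr U          ∎
    where open ≡-Reasoning

  tr≤size : ∀ T → tr T ≤ size T
  tr≤size T = ≤-trans (length-filter (middle? T) (map suc (range (size T))))
    (≤-reflexive (trans (length-map suc (range (size T))) (length-range (size T))))

  recurrences : Recurrences operations comp rcomp tr nontr
  recurrences = record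
    { size-e = refl
    ; size-ƛ = λ T → refl
    ; size-⊕ = λ T U → refl
    ; s-e = refl
    ; s-ƛ = comp-ƛ
    ; s-⊕ = comp-⊕
    ; r-e = refl
    ; r-ƛ = rcomp-ƛ
    ; r-⊕ = rcomp-⊕
    ; l-ƛe = refl
    ; l-ƛ = tr-ƛ
    ; l-⊕ = λ T U _ _ → tr-⊕ T U
    ; l+i = λ T _ → m+[n∸m]≡n (≤-trans (tr≤size T) (m≤m+n (size T) 1))
    }

-- Permutations: components and right-to-left minima of direct sums

module PermutationStatistics where
  open Permutations

  components-indecomposable : ∀ {n w} → w ↭ range (suc n) →
    (∀ {k} → 1 ≤ k → k ≤ n → ¬ SameElements (take k w) (range k)) → components w ≡ 1
  components-indecomposable {n} {w} perm indec = trans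
    (cong (λ m → count prefix? (range m)) length≡)
    (count-only-last prefix? n indec
      (subst (λ v → SameElements v (range (suc n)))
             (sym (take-all (suc n) w (≤-reflexive length≡)))
             (sameElements-perm perm)))
    where
    prefix? = λ k → sameElements? (take k w) (range k)
    length≡ : length w ≡ suc n
    length≡ = trans (↭-length perm) (length-range (suc n))

  length-directSum : ∀ v w → length (directSum v w) ≡ length v + length w
  length-directSum v w = trans (length-++ v) (cong (length v +_) (length-map _ w))

  entries-≤ : ∀ {w} → IsPermutation w → All (_≤ length w) w
  entries-≤ p = All.map proj₂ (All-perm _ p)

  entries-≥1 : ∀ {w} → IsPermutation w → All (1 ≤_) w
  entries-≥1 p = All.map proj₁ (All-perm _ p)

  components-directSum : ∀ {v w} → IsPermutation v → IsPermutation w →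
                         components (directSum v w) ≡ components v + components w
  components-directSum {v} {w} pv pw = trans
    (cong (λ n → count (λ k → sameElements? (take k (directSum v w)) (range k)) (range n))
          (length-directSum v w))
    (count-range-+ _ _ _ (length v) (length w)
      (λ {k} _ k≤ → subst (λ x → SameElements x (range k) ⇔ SameElements (take k v) (range k))
                          (sym (take-++-≤ k≤)) (mk⇔ id id))
      (λ {k} _ _ → sameElements-split (length v) pv (All-take k (entries-≥1 pw)) (prefix k)))
    where
    prefix : ∀ k {x} → x ∈ take (length v + k) (directSum v w) ⇔
                       (x ∈ v ++ map (length v +_) (take k w))
    prefix k {x} = subst (λ zs → x ∈ take (length v + k) (directSum v w) ⇔ (x ∈ zs))
      (trans (take-length-+ v) (cong (v ++_) (take-map k w))) (mk⇔ id id)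

  rmin-directSum : ∀ {v w} → IsPermutation v → IsPermutation w →
                   rminʷ (directSum v w) ≡ rminʷ v + rminʷ w
  rmin-directSum {v} pv pw = rlMin-shifted-++ (length v) (entries-≤ pv) (entries-≥1 pw)

  rmin+nonrmin : ∀ w → rminʷ w + nonrminʷ w ≡ length w + 1
  rmin+nonrmin w = trans (+-suc (rminʷ w) _)
    (trans (cong suc (countEntries-complement rlMin? w)) (+-comm 1 (length w)))

-- 231-avoiding permutations

module Permutation231Statistics where
  open AvoidingPermutation
  open Permutations
  open Permutations231
  open PermutationStatistics

  -- Every nonempty prefix contains the leading entry `n + 1`, which is too large for a proper
  -- initial segment.
  comp-ƛ : ∀ π → comp (prependMax π) ≡ 1
  comp-ƛ π = components-indecomposable (isPermutation (prependMax π))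
    (λ { {suc k} _ k≤n (prefix⊆ , _) → <⇒≱ k≤n (s≤s⁻¹ (proj₂ (∈-range⁻ (All.head prefix⊆)))) })

  rmax-ƛ : ∀ {w} → IsPermutation w → rmaxʷ (suc (length w) ∷ w) ≡ 1 + rmaxʷ w
  rmax-ƛ {w} p rewrite dec-true (rlMax? (suc (length w)) w) (All.map s≤s (entries-≤ p)) = refl

  rmin-ƛ : ∀ {w} → IsPermutation w → 1 ≤ length w → rminʷ (suc (length w) ∷ w) ≡ rminʷ w
  rmin-ƛ {w@(_ ∷ _)} p _ rewrite dec-false (rlMin? (suc (length w)) w)
    (λ min → <-asym (All.head min) (s≤s (All.head (entries-≤ p)))) = refl

  recurrences : Recurrences operations comp rmax rmin nonrmin
  recurrences = record
    { size-e = refl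
    ; size-ƛ = λ π → refl
    ; size-⊕ = λ π ρ → length-directSum (word π) (word ρ)
    ; s-e = refl
    ; s-ƛ = comp-ƛ
    ; s-⊕ = λ π ρ → components-directSum (isPermutation π) (isPermutation ρ)
    ; r-e = refl
    ; r-ƛ = λ π → rmax-ƛ (isPermutation π)
    ; r-⊕ = λ π ρ → rlMax-shifted-++ (length (word π))
        (entries-≤ (isPermutation π)) (entries-≥1 (isPermutation ρ))
    ; l-ƛe = refl
    ; l-ƛ = λ π → rmin-ƛ (isPermutation π)
    ; l-⊕ = λ π ρ _ _ → rmin-directSum (isPermutation π) (isPermutation ρ)
    ; l+i = λ π _ → rmin+nonrmin (word π)
    }

-- 321-avoiding permutations: the effect of the cyclic shift of boxed values

module Permutation321Statistics where
  open AvoidingPermutation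
  open Permutations
  open Permutations321
  open PermutationStatistics

  pulled : ℕ → List ℕ → List ℕ → List ℕ
  pulled m ps xs = map proj₁ (pull m (mark ps xs))

  pulledAt1 : ℕ → List ℕ → List ℕ → List ℕ
  pulledAt1 m ps xs = map proj₁ (pullAt1 m (mark ps xs))

  ∈-pulledAt1 : ∀ m ps {x xs} → x ∈ xs → x ∈ pulledAt1 m ps xs
  ∈-pulledAt1 m ps {x} {xs} x∈ = ∈-resp-↭ (↭-sym (pullAt1-↭ m (mark ps xs)))
    (there (subst (x ∈_) (sym (mark-values ps xs)) x∈))

  length-ƛʷ : ∀ w → length (ƛʷ w) ≡ suc (length w)
  length-ƛʷ w = trans (cong length (ƛʷ-pull w)) (trans (↭-length (pullAt1-↭ _ (mark [] w)))
    (cong (suc ∘ length) (mark-values [] w)))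

  -- Keeps the boolean as an equation, so that `rewrite` can resolve the marks while the proof or
  -- refutation remains available.
  does-cases : {P : Set} (p? : Dec P) → (P × does p? ≡ true) ⊎ (¬ P × does p? ≡ false)
  does-cases (yes p) = inj₁ (p , refl)
  does-cases (no ¬p) = inj₂ (¬p , refl)

  1∈perm : ∀ {w} → IsPermutation w → 1 ≤ length w → 1 ∈ w
  1∈perm p = ∈-perm⁺ p ≤-refl

  last-∷ : ∀ {x z} (xs : List ℕ) → last xs ≡ just z → last (x ∷ xs) ≡ just z
  last-∷ (_ ∷ _) eq = eq

  last-pull-∷ : ∀ {m} {x : ℕ} {z} b w → last (map proj₁ (pull m w)) ≡ just z →
                last (map proj₁ (pull m ((x , b) ∷ w))) ≡ just z
  last-pull-∷ {m} true  w eq = last-∷ (map proj₁ (pull m w)) eq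
  last-pull-∷ {m} false w eq = last-∷ (map proj₁ (pull m w)) eq

  -- The last entry is vacuously a right-to-left minimum, hence never boxed and never replaced.
  last-pulled : ∀ {z} m ps xs → last xs ≡ just z → last (pulled m ps xs) ≡ just z
  last-pulled m ps (x ∷ []) eq
    rewrite dec-false (boxed? ps x []) (λ (_ , _ , ¬min) → ¬min []) = eq
  last-pulled m ps (x ∷ xs@(_ ∷ _)) eq =
    last-pull-∷ (does (boxed? ps x xs)) (mark (x ∷ ps) xs) (last-pulled m (x ∷ ps) xs eq)

  last-pulledAt1 : ∀ {z} m ps xs → 1 ∉ ps → 1 ∈ xs → last xs ≡ just z →
                   last (pulledAt1 m ps xs) ≡ just z
  last-pulledAt1 m ps (x ∷ xs) 1∉ 1∈ eq rewrite 1∉⇒unboxed {ps} {x} {xs} 1∉ with x ≟ 1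
  last-pulledAt1 m ps (x ∷ [])         1∉ 1∈           eq | yes refl = eq
  last-pulledAt1 m ps (x ∷ xs@(_ ∷ _)) 1∉ 1∈           eq | yes refl =
    last-∷ (pulled m (1 ∷ ps) xs) (last-pulled m (1 ∷ ps) xs eq)
  last-pulledAt1 m ps (x ∷ xs)         1∉ (here 1≡x)   eq | no x≢1 = ⊥-elim (x≢1 (sym 1≡x))
  last-pulledAt1 m ps (x ∷ xs@(_ ∷ _)) 1∉ (there 1∈xs) eq | no x≢1 =
    last-∷ (pulledAt1 m (x ∷ ps) xs) (last-pulledAt1 m (x ∷ ps) xs (∉-∷ x≢1 1∉) 1∈xs eq)

  rcompʷ : List ℕ → ℕ
  rcompʷ w = maybe′ (λ πₙ → length w ∸ πₙ + 1) 0 (last w)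

  last-of-∷ : ∀ (x : ℕ) xs → ∃ λ z → last (x ∷ xs) ≡ just z
  last-of-∷ x []        = x , refl
  last-of-∷ x (y ∷ xs)  = last-of-∷ y xs

  last-∈ : ∀ {z} (xs : List ℕ) → last xs ≡ just z → z ∈ xs
  last-∈ (x ∷ [])         refl = here refl
  last-∈ (x ∷ xs@(_ ∷ _)) eq   = there (last-∈ xs eq)

  rcomp-ƛ : ∀ {w} → IsPermutation w → rcompʷ (ƛʷ w) ≡ 1 + rcompʷ w
  rcomp-ƛ {[]} p = refl
  rcomp-ƛ {w@(x ∷ xs)} p with z , eq ← last-of-∷ x xs
    rewrite trans (cong last (ƛʷ-pull w))
              (last-pulledAt1 (suc (length w)) [] w (λ ()) (1∈perm p (s≤s z≤n)) eq)
          | eq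
          | length-ƛʷ w
    -- The last entry is kept and the length grows by one; the last entry being at most the length
    -- makes the truncated subtraction exact.
    = cong (_+ 1) (+-∸-assoc 1 (All.lookup (entries-≤ p) (last-∈ w eq)))

  last-map : ∀ (f : ℕ → ℕ) {z} xs → last xs ≡ just z → last (map f xs) ≡ just (f z)
  last-map f (x ∷ [])         refl = refl
  last-map f (x ∷ xs@(_ ∷ _)) eq   = last-map f xs eq

  last-++ : ∀ {z} (v w : List ℕ) → last w ≡ just z → last (v ++ w) ≡ just z
  last-++ []      w eq = eq
  last-++ (x ∷ v) w eq = last-∷ (v ++ w) (last-++ v w eq)

  rcomp-⊕ : ∀ v w → 1 ≤ length w → rcompʷ (directSum v w) ≡ rcompʷ w
  rcomp-⊕ v w@(y ∷ ys) _ with z , eq ← last-of-∷ y ys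
    rewrite last-++ v (map (length v +_) w) (last-map (length v +_) w eq)
          | eq
          | length-directSum v w
    = cong (_+ 1) ([m+n]∸[m+o]≡n∸o (length v) (length w) z)

  next-> : ∀ {x m} w → x < m → All (x <_) (map proj₁ w) → x < next m w
  next-> []                x<m _        = x<m
  next-> ((y , true)  ∷ w) x<m (p ∷ _)  = p
  next-> ((y , false) ∷ w) x<m (_ ∷ ps) = next-> w x<m ps

  pull-> : ∀ {x m} w → x < m → All (x <_) (map proj₁ w) → All (x <_) (map proj₁ (pull m w))
  pull-> []                x<m _        = []
  pull-> ((y , true)  ∷ w) x<m (_ ∷ ps) = next-> w x<m ps ∷ pull-> w x<m ps
  pull-> ((y , false) ∷ w) x<m (p ∷ ps) = p ∷ pull-> w x<m ps

  -- An entry that does not survive was boxed, hence is a left-to-right maximum.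
  survives-or-max : ∀ m ps {y} xs → y ∈ xs → y ∈ pulled m ps xs ⊎ All (_< y) ps
  survives-or-max m ps (x ∷ xs) y∈ with does-cases (boxed? ps x xs)
  ... | inj₁ ((_ , max , _) , isBoxed) rewrite isBoxed = boxedHead y∈
    where
    boxedHead : ∀ {y} → y ∈ x ∷ xs → y ∈ _ ∷ pulled m (x ∷ ps) xs ⊎ All (_< y) ps
    boxedHead (here refl) = inj₂ max
    boxedHead (there y∈)  = Sum.map there All.tail (survives-or-max m (x ∷ ps) xs y∈)
  ... | inj₂ (_ , notBoxed) rewrite notBoxed = unboxedHead y∈
    where
    unboxedHead : ∀ {y} → y ∈ x ∷ xs → y ∈ x ∷ pulled m (x ∷ ps) xs ⊎ All (_< y) ps
    unboxedHead (here refl) = inj₁ (here refl)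
    unboxedHead (there y∈)  = Sum.map there All.tail (survives-or-max m (x ∷ ps) xs y∈)

  -- A later `y` either survives, and then exceeds `z`, or was boxed, and then exceeds all earlier
  -- entries, `x` among them.
  rlMin-pulled⁻ : ∀ m ps {x z} xs → x ≤ z → RLMin z (pulled m (x ∷ ps) xs) → RLMin x xs
  rlMin-pulled⁻ m ps xs x≤z min = All.tabulate λ y∈ →
    Sum.[ (λ y∈′ → ≤-<-trans x≤z (All.lookup min y∈′)) , All.head ]′ (survives-or-max m (_ ∷ ps) xs y∈)

  rlMin-pulled : ∀ m ps {x} xs → x < m → RLMin x (pulled m (x ∷ ps) xs) ⇔ RLMin x xs
  rlMin-pulled m ps {x} xs x<m = mk⇔ (rlMin-pulled⁻ m ps xs ≤-refl)
    (λ min → pull-> (mark (x ∷ ps) xs) x<m (subst (All (x <_)) (sym (mark-values (x ∷ ps) xs)) min))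

  -- At a boxed position neither value is a right-to-left minimum, the old one by the definition of
  -- a box; an unboxed entry keeps its status.
  rmin-pulled : ∀ m ps xs → All (_< m) xs → rminʷ (pulled m ps xs) ≡ rminʷ xs
  rmin-pulled m ps []       _            = refl
  rmin-pulled m ps (x ∷ xs) (x<m ∷ xs<m) with does-cases (boxed? ps x xs)
  ... | inj₁ ((_ , _ , ¬min) , isBoxed)
    rewrite isBoxed
          | dec-false (rlMin? x xs) ¬min
          | dec-false (rlMin? (next m (mark (x ∷ ps) xs)) (pulled m (x ∷ ps) xs))
              (¬min ∘ rlMin-pulled⁻ m ps xs
                -- The incoming value exceeds `x`: it is `m` or the value of a later box, and boxes
                -- exceed everything before them.
                (<⇒≤ (next-below (mark (x ∷ ps) xs) x<m (mark-below (x ∷ ps) xs (here refl)))))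
    = rmin-pulled m (x ∷ ps) xs xs<m
  ... | inj₂ (_ , notBoxed) rewrite notBoxed = cong₂ _+_
    (indicator-⇔ (rlMin-pulled m ps xs x<m) (rlMin? x (pulled m (x ∷ ps) xs)) (rlMin? x xs))
    (rmin-pulled m (x ∷ ps) xs xs<m)

  -- Everything to the left of the entry 1, the inserted position included, has 1 on its right and
  -- is no right-to-left minimum; the rest is `rmin-pulled`.
  rmin-pulledAt1 : ∀ m ps xs → 1 ∉ ps → 1 ∈ xs → 1 ≤ m → All (1 ≤_) xs → All (_< m) xs →
                   rminʷ (pulledAt1 m ps xs) ≡ rminʷ xs
  rmin-pulledAt1 m ps (x ∷ xs) 1∉ 1∈ 1≤m (1≤x ∷ 1≤xs) (x<m ∷ xs<m)
    rewrite 1∉⇒unboxed {ps} {x} {xs} 1∉ with x ≟ 1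
  ... | yes refl
    rewrite dec-false (rlMin? (next m (mark (1 ∷ ps) xs)) (1 ∷ pulled m (1 ∷ ps) xs))
              (λ min → <⇒≱ (All.head min) (next-> (mark (1 ∷ ps) xs) 1≤m
                (subst (All (1 ≤_)) (sym (mark-values (1 ∷ ps) xs)) 1≤xs)))
    = cong₂ _+_
        (indicator-⇔ (rlMin-pulled m ps xs x<m) (rlMin? 1 (pulled m (1 ∷ ps) xs)) (rlMin? 1 xs))
        (rmin-pulled m (1 ∷ ps) xs xs<m)
  ... | no x≢1 = go 1∈
    where
    1≮x : ∀ {ys} → 1 ∈ ys → ¬ RLMin x ys
    1≮x 1∈ys min = <⇒≱ (All.lookup min 1∈ys) 1≤x
    go : 1 ∈ x ∷ xs → rminʷ (x ∷ pulledAt1 m (x ∷ ps) xs) ≡ rminʷ (x ∷ xs)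
    go (here 1≡x) = ⊥-elim (x≢1 (sym 1≡x))
    go (there 1∈xs)
      rewrite dec-false (rlMin? x xs) (1≮x 1∈xs)
            | dec-false (rlMin? x (pulledAt1 m (x ∷ ps) xs)) (1≮x (∈-pulledAt1 m (x ∷ ps) 1∈xs))
      = rmin-pulledAt1 m (x ∷ ps) xs (∉-∷ x≢1 1∉) 1∈xs 1≤m 1≤xs xs<m

  rmin-ƛ : ∀ {w} → IsPermutation w → 1 ≤ length w → rminʷ (ƛʷ w) ≡ rminʷ w
  rmin-ƛ {w} p 1≤w = trans (cong rminʷ (ƛʷ-pull w))
    (rmin-pulledAt1 (suc (length w)) [] w (λ ()) (1∈perm p 1≤w) (s≤s z≤n)
      (entries-≥1 p) (All.map s≤s (entries-≤ p)))

  -- vs contains m, or an entry exceeding some element of xs missing from vs;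
  -- for a proper prefix vs of ƛʷ w this excludes vs = {1, …, k}.
  Gap : ℕ → List ℕ → List ℕ → Set
  Gap m xs vs = ∃ λ z → z ∈ vs × (z ≡ m ⊎ ∃ λ y → y ∈ xs × y < z × y ∉ vs)

  gap-weaken : ∀ {m x xs vs} → Gap m xs vs → Gap m (x ∷ xs) vs
  gap-weaken (z , z∈ , inj₁ z≡m)                  = z , z∈ , inj₁ z≡m
  gap-weaken (z , z∈ , inj₂ (y , y∈ , y<z , y∉)) = z , z∈ , inj₂ (y , there y∈ , y<z , y∉)

  -- If the incoming value is not `m`, it is the value of the next box, and a box, not being a
  -- right-to-left minimum, has a smaller entry after it.
  gap-next : ∀ m ps xs → AllPairs _≢_ xs → Gap m xs [ next m (mark ps xs) ]
  gap-next m ps [] _ = m , here refl , inj₁ refl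
  gap-next m ps (x ∷ xs) (x≢ ∷ uq) with does-cases (boxed? ps x xs)
  ... | inj₁ ((_ , _ , ¬min) , isBoxed) rewrite isBoxed
      with y , y∈ , x≮y ← find (AllP.¬All⇒Any¬ (x <?_) xs ¬min) =
    x , here refl , inj₂ (y , there y∈ , ≤∧≢⇒< (≮⇒≥ x≮y) (y≢x y∈) , λ { (here y≡x) → y≢x y∈ y≡x })
    where
    y≢x : ∀ {y} → y ∈ xs → y ≢ x
    y≢x y∈ y≡x = All.lookup x≢ y∈ (sym y≡x)
  ... | inj₂ (_ , notBoxed) rewrite notBoxed = gap-weaken (gap-next m (x ∷ ps) xs uq)

  -- Only `x` may be new in `us`, and `x` differs from all of `xs`, so the missing entry `y` remains
  -- missing.
  gap-∷ : ∀ {m x xs vs us} → All (x ≢_) xs → (∀ {v} → v ∈ vs → v ∈ us) →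
          (∀ {u} → u ∈ us → u ≡ x ⊎ u ∈ vs) → Gap m xs vs → Gap m (x ∷ xs) us
  gap-∷ x≢ vs⊆us us⊆ (z , z∈ , inj₁ z≡m) = z , vs⊆us z∈ , inj₁ z≡m
  gap-∷ x≢ vs⊆us us⊆ (z , z∈ , inj₂ (y , y∈ , y<z , y∉)) = z , vs⊆us z∈ ,
    inj₂ (y , there y∈ , y<z , λ y∈us → Sum.[ (λ y≡x → All.lookup x≢ y∈ (sym y≡x)) , y∉ ]′ (us⊆ y∈us))

  insert-second : ∀ {x v : ℕ} {vs} → (∀ {u} → u ∈ v ∷ vs → u ∈ v ∷ x ∷ vs) ×
                  (∀ {u} → u ∈ v ∷ x ∷ vs → u ≡ x ⊎ u ∈ v ∷ vs)
  insert-second = (λ { (here eq) → here eq ; (there u∈) → there (there u∈) }) ,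
    (λ { (here eq) → inj₂ (here eq) ; (there (here eq)) → inj₁ eq
       ; (there (there u∈)) → inj₂ (there u∈) })

  -- The prefix starts at the inserted position. Passing an entry `x` adds just `x` to it: in front
  -- if `x` is boxed, being then the incoming value, and otherwise in second place.
  gap-pulled : ∀ m j ps xs → j ≤ length xs → AllPairs _≢_ xs →
               Gap m xs (take (suc j) (next m (mark ps xs) ∷ pulled m ps xs))
  gap-pulled m zero    ps xs       _         uq = gap-next m ps xs uq
  gap-pulled m (suc j) ps (x ∷ xs) (s≤s j≤) (x≢ ∷ uq) with does (boxed? ps x xs)
  ... | true  = gap-∷ x≢ there (λ { (here eq) → inj₁ eq ; (there u∈) → inj₂ u∈ })
                  (gap-pulled m j (x ∷ ps) xs j≤ uq)
  ... | false = gap-∷ x≢ (proj₁ insert-second) (proj₂ insert-second)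
                  (gap-pulled m j (x ∷ ps) xs j≤ uq)

  -- A prefix containing 1 extends past the insertion point, where `gap-pulled` applies.
  gap-pulledAt1 : ∀ m k ps xs → 1 ∉ ps → k ≤ length xs → AllPairs _≢_ xs →
                  1 ∈ take k (pulledAt1 m ps xs) → Gap m xs (take k (pulledAt1 m ps xs))
  gap-pulledAt1 m zero    ps xs       1∉ k≤ uq ()
  gap-pulledAt1 m (suc k) ps (x ∷ xs) 1∉ (s≤s k≤) (x≢ ∷ uq) 1∈
    rewrite 1∉⇒unboxed {ps} {x} {xs} 1∉ with x ≟ 1
  gap-pulledAt1 m (suc zero) ps (x ∷ xs) 1∉ (s≤s k≤) (x≢ ∷ uq) 1∈ | yes refl =
    gap-weaken (gap-next m (1 ∷ ps) xs uq)
  gap-pulledAt1 m (suc (suc j)) ps (x ∷ xs) 1∉ (s≤s k≤) (x≢ ∷ uq) 1∈ | yes refl =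
    gap-∷ x≢ (proj₁ insert-second) (proj₂ insert-second)
      (gap-pulled m j (1 ∷ ps) xs (<⇒≤ k≤) uq)
  gap-pulledAt1 m (suc k) ps (x ∷ xs) 1∉ (s≤s k≤) (x≢ ∷ uq) (here 1≡x)  | no x≢1 =
    ⊥-elim (x≢1 (sym 1≡x))
  gap-pulledAt1 m (suc k) ps (x ∷ xs) 1∉ (s≤s k≤) (x≢ ∷ uq) (there 1∈) | no x≢1 =
    gap-∷ x≢ there (λ { (here eq) → inj₁ eq ; (there u∈) → inj₂ u∈ })
      (gap-pulledAt1 m k (x ∷ ps) xs (∉-∷ x≢1 1∉) k≤ uq 1∈)

  ƛʷ-indecomposable : ∀ {w k} → IsPermutation w → 1 ≤ k → k ≤ length w →
                      ¬ SameElements (take k (ƛʷ w)) (range k)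
  ƛʷ-indecomposable {w} {k} p 1≤k k≤n same
    with prefix⊆ , ⊆prefix ← subst (λ v → SameElements (take k v) (range k)) (ƛʷ-pull w) same
    with gap-pulledAt1 (suc (length w)) k [] w (λ ()) k≤n (unique-↭ (↭-sym p) (range-unique _))
           (All.lookup ⊆prefix (∈-range⁺ ≤-refl 1≤k))
  ... | z , z∈ , inj₁ refl = <⇒≱ (s≤s k≤n) (proj₂ (∈-range⁻ (All.lookup prefix⊆ z∈)))
  ... | z , z∈ , inj₂ (y , y∈ , y<z , y∉) = y∉ (All.lookup ⊆prefix
    (∈-range⁺ (All.lookup (entries-≥1 p) y∈)
              (≤-trans (<⇒≤ y<z) (proj₂ (∈-range⁻ (All.lookup prefix⊆ z∈))))))

  comp-ƛ : ∀ π → comp (λ₃₂₁ π) ≡ 1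
  comp-ƛ π = components-indecomposable
    (subst (λ n → ƛʷ (word π) ↭ range n) (length-ƛʷ (word π)) (ƛʷ-perm (isPermutation π)))
    (ƛʷ-indecomposable (isPermutation π))

  recurrences : Recurrences operations comp rcomp rmin nonrmin
  recurrences = record
    { size-e = refl
    ; size-ƛ = λ π → length-ƛʷ (word π)
    ; size-⊕ = λ π ρ → length-directSum (word π) (word ρ)
    ; s-e = refl
    ; s-ƛ = comp-ƛ
    ; s-⊕ = λ π ρ → components-directSum (isPermutation π) (isPermutation ρ)
    ; r-e = refl
    ; r-ƛ = λ π → rcomp-ƛ (isPermutation π)
    ; r-⊕ = λ π ρ → rcomp-⊕ (word π) (word ρ)
    ; l-ƛe = refl
    ; l-ƛ = λ π → rmin-ƛ (isPermutation π)
    ; l-⊕ = λ π ρ _ _ → rmin-directSum (isPermutation π) (isPermutation ρ)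
    ; l+i = λ π _ → rmin+nonrmin (word π)
    }

-- Binary trees: right spines and right edges

module BinaryTreeStatistics where
  open BinaryTrees

  size-⊕ : ∀ S T → size (S ⊕ T) ≡ size S + size T
  size-⊕ ∅         T = refl
  size-⊕ ⟨ L , R ⟩ T = cong suc (trans (cong (size L +_) (size-⊕ R T)) (sym (+-assoc (size L) _ _)))

  comp-⊕ : ∀ S T → comp (S ⊕ T) ≡ comp S + comp T
  comp-⊕ ∅         T = refl
  comp-⊕ ⟨ L , R ⟩ T = cong suc (comp-⊕ R T)

  lastLeft-< : ∀ L R → size (lastLeft ⟨ L , R ⟩) < size ⟨ L , R ⟩
  lastLeft-< L ∅           = s≤s (m≤m+n (size L) 0)
  lastLeft-< L ⟨ L′ , R′ ⟩ =
    <-trans (lastLeft-< L′ R′) (s≤s (m≤n+m (size ⟨ L′ , R′ ⟩) (size L)))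

  -- Each application of `lastLeft` removes a node, so any bound from `size T` on gives the same
  -- count; `rcomp` of a sum runs with a larger bound than `rcomp` of its second summand.
  iterations-fuel : ∀ {j k} T → size T ≤ j → size T ≤ k → iterations j T ≡ iterations k T
  iterations-fuel {j} {k} ∅ _ _ = refl
  iterations-fuel {suc j} {suc k} ⟨ L , R ⟩ T≤j T≤k = cong suc
    (iterations-fuel (lastLeft ⟨ L , R ⟩) (s≤s⁻¹ (≤-trans (lastLeft-< L R) T≤j))
                                          (s≤s⁻¹ (≤-trans (lastLeft-< L R) T≤k)))

  -- `⊕` hangs the second tree at the end of the right spine of `S`, so both trees have the same
  -- last spine node.
  lastLeft-⊕ : ∀ S L R → lastLeft (S ⊕ ⟨ L , R ⟩) ≡ lastLeft ⟨ L , R ⟩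
  lastLeft-⊕ ∅               L R = refl
  lastLeft-⊕ ⟨ T , ∅ ⟩       L R = refl
  lastLeft-⊕ ⟨ _ , S@(⟨ _ , _ ⟩) ⟩ L R = lastLeft-⊕ S L R

  rcomp-⊕ : ∀ S T → 1 ≤ size T → rcomp (S ⊕ T) ≡ rcomp T
  rcomp-⊕ ∅           T           _ = refl
  rcomp-⊕ ⟨ L′ , R′ ⟩ T@(⟨ L , R ⟩) _ = cong suc (trans
    (cong (iterations (size L′ + size (R′ ⊕ T))) (lastLeft-⊕ ⟨ L′ , R′ ⟩ L R))
    (iterations-fuel (lastLeft T)
      (≤-trans (s≤s⁻¹ (≤-trans (lastLeft-< L R) smaller)) (m≤n+m _ (size L′)))
      (s≤s⁻¹ (lastLeft-< L R))))
    where
    smaller : size T ≤ suc (size (R′ ⊕ T))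
    smaller = subst (λ n → size T ≤ suc n) (sym (size-⊕ R′ T))
      (≤-trans (m≤n+m (size T) (size R′)) (n≤1+n _))

  -- The new right edge from the end of the spine of `S` to the root of `T` makes up for the second
  -- `1 +` offset.
  redge-⊕ : ∀ S T → 1 ≤ size S → 1 ≤ size T → redge (S ⊕ T) ≡ redge S + redge T
  redge-⊕ ⟨ L , ∅ ⟩ T@(⟨ _ , _ ⟩) _ _ = cong suc (+-assoc (rightEdges L) 1 (rightEdges T))
  redge-⊕ ⟨ L , R@(⟨ _ , _ ⟩) ⟩ T _ 1≤T = cong suc (begin
    rightEdges L + 1 + rightEdges (R ⊕ T)      ≡⟨ cong (rightEdges L + 1 +_)
      (suc-injective (redge-⊕ R T (s≤s z≤n) 1≤T)) ⟩
    rightEdges L + 1 + (rightEdges R + redge T) ≡⟨ +-assoc (rightEdges L + 1) _ _ ⟨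
    rightEdges L + 1 + rightEdges R + redge T  ∎)
    where open ≡-Reasoning

  rightEdges≤size : ∀ T → rightEdges T ≤ size T
  rightEdges≤size ∅         = z≤n
  rightEdges≤size ⟨ L , ∅ ⟩ = ≤-trans (rightEdges≤size L) (m≤n⇒m≤1+n (m≤m+n (size L) 0))
  rightEdges≤size ⟨ L , R@(⟨ _ , _ ⟩) ⟩ = subst (_≤ size ⟨ L , R ⟩)
    (cong (_+ rightEdges R) (+-comm 1 (rightEdges L)))
    (s≤s (+-mono-≤ (rightEdges≤size L) (rightEdges≤size R)))

  recurrences : Recurrences operations comp rcomp redge ledge
  recurrences = record
    { size-e = refl
    ; size-ƛ = λ T → cong suc (+-identityʳ (size T))
    ; size-⊕ = size-⊕
    ; s-e = refl
    ; s-ƛ = λ T → refl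
    ; s-⊕ = comp-⊕
    ; r-e = refl
    ; r-ƛ = λ T → cong (λ n → suc (iterations n T)) (+-identityʳ (size T))
    ; r-⊕ = rcomp-⊕
    ; l-ƛe = refl
    ; l-ƛ = λ T _ → refl
    ; l-⊕ = redge-⊕
    ; l+i = λ T _ → m+[n∸m]≡n (subst (redge T ≤_) (+-comm 1 (size T)) (s≤s (rightEdges≤size T)))
    }

-- Largest indices, complementary counts and list prefixes, for the tableaux

largest-⇔ : ∀ {P Q : ℕ → Set} (P? : Decidable P) (Q? : Decidable Q) n →
            (∀ {k} → k ≤ n → Q k ⇔ P k) → largest Q? n ≡ largest P? n
largest-⇔ P? Q? zero    Q⇔P = refl
largest-⇔ P? Q? (suc n) Q⇔P
  with does (Q? (suc n)) | does (P? (suc n)) | does-⇔ (Q⇔P ≤-refl) (Q? (suc n)) (P? (suc n))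
... | true  | .true  | refl = refl
... | false | .false | refl = largest-⇔ P? Q? n (λ k≤n → Q⇔P (m≤n⇒m≤1+n k≤n))

-- `largest` falls back to 0 without a test, whereas after the shift the index 1 is tested; `P 0`
-- makes that test succeed.
largest-suc : ∀ {P Q : ℕ → Set} (P? : Decidable P) (Q? : Decidable Q) n → P 0 →
              (∀ {k} → k ≤ n → Q (suc k) ⇔ P k) → largest Q? (suc n) ≡ suc (largest P? n)
largest-suc P? Q? zero    p Q⇔P rewrite dec-true (Q? 1) (from (Q⇔P z≤n) p) = refl
largest-suc P? Q? (suc n) p Q⇔P
  with does (Q? (2 + n)) | does (P? (suc n)) | does-⇔ (Q⇔P ≤-refl) (Q? (2 + n)) (P? (suc n))
... | true  | .true  | refl = refl
... | false | .false | refl = largest-suc P? Q? n p (λ k≤n → Q⇔P (m≤n⇒m≤1+n k≤n))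

largest-none-above : ∀ {P : ℕ → Set} (P? : Decidable P) m n →
                     (∀ {k} → n < k → k ≤ m + n → ¬ P k) → largest P? (m + n) ≡ largest P? n
largest-none-above P? zero    n ¬P = refl
largest-none-above P? (suc m) n ¬P rewrite dec-false (P? (suc (m + n))) (¬P (s≤s (m≤n+m n m)) ≤-refl) =
  largest-none-above P? m n (λ n<k k≤ → ¬P n<k (m≤n⇒m≤1+n k≤))

count-split : ∀ {A : Set} {P Q : A → Set} (P? : Decidable P) (Q? : Decidable Q) xs →
              (∀ {x} → x ∈ xs → (P x × ¬ Q x) ⊎ (¬ P x × Q x)) →
              count P? xs + count Q? xs ≡ length xs
count-split P? Q? []       h = refl
count-split P? Q? (x ∷ xs) h with h (here refl)
... | inj₁ (p , ¬q) rewrite dec-true (P? x) p | dec-false (Q? x) ¬q =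
  cong suc (count-split P? Q? xs (h ∘ there))
... | inj₂ (¬p , q) rewrite dec-false (P? x) ¬p | dec-true (Q? x) q =
  trans (+-suc _ _) (cong suc (count-split P? Q? xs (h ∘ there)))

unique-++⇒disjoint : ∀ {x : ℕ} xs {ys} → AllPairs _≢_ (xs ++ ys) → x ∈ xs → x ∉ ys
unique-++⇒disjoint (x ∷ xs) (x≢ ∷ _) (here refl) x∈ys = All.lookup (AllP.++⁻ʳ xs x≢) x∈ys refl
unique-++⇒disjoint (_ ∷ xs) (_ ∷ u)  (there x∈)  x∈ys = unique-++⇒disjoint xs u x∈ x∈ys

-- Reads off the entry at index `length xs`; `f` is arbitrary because each step of the induction
-- replaces it by `f ∘ suc`.
prefix-value : ∀ {k} xs {y ys} (f : ℕ → ℕ) → take k (xs ++ y ∷ ys) ≡ applyUpTo f k →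
               length xs < k → y ≡ f (length xs)
prefix-value {suc k} []       f eq _        = ∷-injectiveˡ eq
prefix-value {suc k} (x ∷ xs) f eq (s≤s lt) = prefix-value xs (f ∘ suc) (∷-injectiveʳ eq) lt

++-interchange : ∀ (ws xs ys zs : List ℕ) → (ws ++ xs) ++ (ys ++ zs) ↭ (ws ++ ys) ++ (xs ++ zs)
++-interchange = CommutativeSemigroupProperties.interchange
  (CommutativeMonoid.commutativeSemigroup ++-commutativeMonoid)

-- Standard Young tableaux with two rows

module TableauStatistics where
  open Tableaux
  open Tableau

  length-bottom : ∀ T → length (bottom T) ≡ size T
  length-bottom T = sym (Pointwise-length (columns T))

  top-bounds : ∀ T {x} → x ∈ top T → 1 ≤ x × x ≤ 2 * size T
  top-bounds T x∈ = ∈-perm⁻ (entries T) (∈-++⁺ˡ x∈)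

  bottom-bounds : ∀ T {y} → y ∈ bottom T → 1 ≤ y × y ≤ 2 * size T
  bottom-bounds T y∈ = ∈-perm⁻ (entries T) (∈-++⁺ʳ (top T) y∈)

  top∩bottom : ∀ T {x} → x ∈ top T → x ∉ bottom T
  top∩bottom T = unique-++⇒disjoint (top T) (unique-↭ (↭-sym (entries T)) (range-unique _))

  below-top : ∀ {x t b} → Pointwise _<_ t b → x ∈ t → ∃ λ y → y ∈ b × x < y
  below-top (x<y ∷ _) (here refl) = _ , here refl , x<y
  below-top (_ ∷ ps)  (there x∈)  = let y , y∈ , x<y = below-top ps x∈ in y , there y∈ , x<y

  above-bottom : ∀ {y t b} → Pointwise _<_ t b → y ∈ b → ∃ λ x → x ∈ t × x < y
  above-bottom (x<y ∷ _) (here refl) = _ , here refl , x<y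
  above-bottom (_ ∷ ps)  (there y∈)  = let x , x∈ , x<y = above-bottom ps y∈ in x , there x∈ , x<y

  top-<max : ∀ T {x} → x ∈ top T → suc x ≤ 2 * size T
  top-<max T x∈ = let _ , y∈ , x<y = below-top (columns T) x∈ in
    ≤-trans x<y (proj₂ (bottom-bounds T y∈))

  bottom->1 : ∀ T {y} → y ∈ bottom T → 2 ≤ y
  bottom->1 T y∈ = let _ , x∈ , x<y = above-bottom (columns T) y∈ in
    ≤-trans (s≤s (proj₁ (top-bounds T x∈))) x<y

  -- In `wrap` the new 1 pushes the top row one place to the right, so the first `j + 1` columns
  -- hold only `j` old top entries but `j + 1` old bottom ones; `x` and `y` form the old column that
  -- is torn apart.
  column : ∀ {j t b} → Pointwise _<_ t b → AllPairs _<_ t → j < length t →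
           ∃₂ λ x y → x ∈ t × x ∉ take j t × y ∈ take (suc j) b × x < y
  column {zero}  (x<y ∷ _) _ _ = _ , _ , here refl , (λ ()) , here refl , x<y
  column {suc j} (_ ∷ ps) (x₀< ∷ inc) (s≤s j<) =
    let x , y , x∈ , x∉ , y∈ , x<y = column ps inc j< in
    x , y , there x∈ ,
    (λ { (here refl) → <-irrefl refl (All.lookup x₀< x∈) ; (there x∈′) → x∉ x∈′ }) ,
    there y∈ , x<y

  prefix : Tableau → ℕ → List ℕ
  prefix T k = take k (top T) ++ take k (bottom T)

  prefix-all : ∀ T → prefix T (size T) ≡ top T ++ bottom T
  prefix-all T = cong₂ _++_ (take-all (size T) (top T) ≤-refl)
    (take-all (size T) (bottom T) (≤-reflexive (length-bottom T)))

  -- If the first k columns of λ(T) held exactly 1, …, 2k, they would contain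
  -- the (k+1)-st entry of the top row, which is smaller than their last
  -- bottom entry.
  wrap-incomplete : ∀ T {k} → 1 ≤ k → k ≤ size T → ¬ SameElements (prefix (wrap T) k) (range (2 * k))
  wrap-incomplete T {suc j} _ k≤n (prefix⊆ , ⊆prefix)
    with x , y , x∈ , x∉ , y∈ , x<y ← column (columns T) (topIncreasing T) k≤n
    = contra (All.lookup ⊆prefix (∈-range⁺ (s≤s z≤n) (≤-trans (s≤s (<⇒≤ x<y)) suc-y≤)))
    where
    take-bottom : take (suc j) (map suc (bottom T) ++ [ 2 + 2 * size T ]) ≡
                  map suc (take (suc j) (bottom T))
    take-bottom = trans (take-++-≤ (subst (suc j ≤_)
      (sym (trans (length-map suc (bottom T)) (length-bottom T))) k≤n)) (take-map (suc j) (bottom T))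

    suc-y≤ : suc y ≤ 2 * suc j
    suc-y≤ = proj₂ (∈-range⁻ (All.lookup prefix⊆ (∈-++⁺ʳ (take (suc j) (top (wrap T)))
      (subst (suc y ∈_) (sym take-bottom) (∈-map⁺ suc y∈)))))

    contra : suc x ∉ prefix (wrap T) (suc j)
    contra (here 1+x≡1) with 1≤x ← proj₁ (top-bounds T x∈) = <⇒≢ 1≤x (sym (suc-injective 1+x≡1))
    contra (there 1+x∈) with ∈-++⁻ (take j (map suc (top T))) 1+x∈
    ... | inj₁ ∈t with x′ , x′∈ , refl ← ∈-map⁻ suc (subst (suc x ∈_) (take-map j (top T)) ∈t) = x∉ x′∈
    ... | inj₂ ∈b with x′ , x′∈ , refl ← ∈-map⁻ suc (subst (suc x ∈_) take-bottom ∈b) =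
      top∩bottom T x∈ (∈-take (suc j) (bottom T) x′∈)

  comp-ƛ : ∀ T → comp (wrap T) ≡ 1
  comp-ƛ T = count-only-last (λ k → sameElements? (prefix (wrap T) k) (range (2 * k)))
    (length (map suc (top T)))
    (λ 1≤k k≤ → wrap-incomplete T 1≤k (subst (_ ≤_) (length-map suc (top T)) k≤))
    (subst (λ w → SameElements w (range (2 * size (wrap T)))) (sym (prefix-all (wrap T)))
           (sameElements-perm (entries (wrap T))))

  size-⊕ : ∀ T U → size (T ⊕ U) ≡ size T + size U
  size-⊕ T U = trans (length-++ (top T)) (cong (size T +_) (length-map _ (top U)))

  prefix-⊕ˡ : ∀ T U {k} → k ≤ size T → prefix (T ⊕ U) k ≡ prefix T k
  prefix-⊕ˡ T U k≤ = cong₂ _++_ (take-++-≤ k≤)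
    (take-++-≤ (subst (_ ≤_) (sym (length-bottom T)) k≤))

  -- Listing row by row interleaves the entries of `T` and `U`, so the two sides agree only up to
  -- order.
  prefix-⊕ʳ : ∀ T U k → prefix (T ⊕ U) (size T + k) ↭
                        (top T ++ bottom T) ++ map (2 * size T +_) (prefix U k)
  prefix-⊕ʳ T U k = begin
    take (size T + k) (top T ++ f (top U)) ++ take (size T + k) (bottom T ++ f (bottom U))
      ≡⟨ cong₂ _++_ (take-length-+ (top T))
           (trans (cong (λ n → take (n + k) (bottom T ++ f (bottom U))) (sym (length-bottom T)))
                  (take-length-+ (bottom T))) ⟩
    (top T ++ take k (f (top U))) ++ bottom T ++ take k (f (bottom U))
      ↭⟨ ++-interchange (top T) _ (bottom T) _ ⟩
    (top T ++ bottom T) ++ take k (f (top U)) ++ take k (f (bottom U))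
      ≡⟨ cong ((top T ++ bottom T) ++_) (trans
           (cong₂ _++_ (take-map k (top U)) (take-map k (bottom U)))
           (sym (map-++ _ (take k (top U)) (take k (bottom U))))) ⟩
    (top T ++ bottom T) ++ f (prefix U k) ∎
    where
    open PermutationReasoning
    f = map (2 * size T +_)

  comp-⊕ : ∀ T U → comp (T ⊕ U) ≡ comp T + comp U
  comp-⊕ T U = trans
    (cong (λ n → count (λ k → sameElements? (prefix (T ⊕ U) k) (range (2 * k))) (range n)) (size-⊕ T U))
    (count-range-+ _ _ _ (size T) (size U)
      (λ {k} _ k≤ → subst (λ w → SameElements w (range (2 * k)) ⇔ SameElements (prefix T k) (range (2 * k)))
                          (sym (prefix-⊕ˡ T U k≤)) (mk⇔ id id))
      (λ {k} _ _ → subst (λ n → SameElements (prefix (T ⊕ U) (size T + k)) (range n) ⇔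
                                SameElements (prefix U k) (range (2 * k)))
        (sym (*-distribˡ-+ 2 (size T) k))
        (sameElements-split (2 * size T) (entries T)
          (AllP.++⁺ (All-take k (All.tabulate (proj₁ ∘ top-bounds U)))
                    (All-take k (All.tabulate (proj₁ ∘ bottom-bounds U))))
          (mk⇔ (∈-resp-↭ (prefix-⊕ʳ T U k)) (∈-resp-↭ (↭-sym (prefix-⊕ʳ T U k)))))))

  descending : ℕ → ℕ → List ℕ
  descending n k = map (2 * n ∸_) (upTo k)

  EndsWith : Tableau → ℕ → Set
  EndsWith T k = take k (reverse (bottom T)) ≡ descending (size T) k

  endsWith? : ∀ T k → Dec (EndsWith T k)
  endsWith? T k = ≡-dec _≟_ (take k (reverse (bottom T))) (descending (size T) k)

  -- The subtracted indices stay below `k ≤ n`, so truncated subtraction commutes with adding `c`.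
  descending-shift : ∀ c {n k} m → 2 * m ≡ c + 2 * n → k ≤ n →
                     descending m k ≡ map (c +_) (descending n k)
  descending-shift c {n} {k} m eq k≤n = trans
    (map-cong-local (All.tabulate (λ {i} i∈ → trans (cong (_∸ i) eq)
      (+-∸-assoc c (≤-trans (<⇒≤ (∈-upTo⁻ i∈)) (≤-trans k≤n (m≤m+n n _)))))))
    (map-∘ (upTo k))

  descending-suc : ∀ {n k} → k ≤ n → descending (suc n) (suc k) ≡ (2 + 2 * n) ∷ map suc (descending n k)
  descending-suc {n} {k} k≤n = cong₂ _∷_ (2*suc n) (begin
    map (2 * suc n ∸_) (applyUpTo suc k)     ≡⟨ cong (λ N → map (N ∸_) (applyUpTo suc k)) (2*suc n) ⟩
    map (2 + 2 * n ∸_) (applyUpTo suc k)     ≡⟨ map-applyUpTo suc (2 + 2 * n ∸_) k ⟩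
    applyUpTo (1 + 2 * n ∸_) k               ≡⟨ map-upTo (1 + 2 * n ∸_) k ⟨
    map (1 + 2 * n ∸_) (upTo k)              ≡⟨ map-cong-local (All.tabulate (λ {i} i∈ →
      +-∸-assoc 1 (≤-trans (<⇒≤ (∈-upTo⁻ i∈)) (≤-trans k≤n (m≤m+n n _))))) ⟩
    map (suc ∘ (2 * n ∸_)) (upTo k)          ≡⟨ map-∘ (upTo k) ⟩
    map suc (map (2 * n ∸_) (upTo k))        ∎)
    where open ≡-Reasoning

  -- The reversed bottom row gains the new maximum in front and is shifted by one behind it, exactly
  -- like the descending sequence, so runs of length `k` become runs of length `k + 1`.
  rcomp-ƛ : ∀ T → rcomp (wrap T) ≡ 1 + rcomp T
  rcomp-ƛ T = trans (cong (λ n → largest (endsWith? (wrap T)) (suc n)) (length-map suc (top T)))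
    (largest-suc (endsWith? T) (endsWith? (wrap T)) (size T) refl (λ {k} k≤n → mk⇔
      (λ eq → map-injective suc-injective (∷-injectiveʳ
        (trans (sym (ending k)) (trans eq (ending′ k≤n)))))
      (λ eq → trans (ending k) (trans (cong (λ w → 2 + 2 * size T ∷ map suc w) eq) (sym (ending′ k≤n))))))
    where
    ending : ∀ k → take (suc k) (reverse (bottom (wrap T))) ≡
                   2 + 2 * size T ∷ map suc (take k (reverse (bottom T)))
    ending k = trans (cong (take (suc k)) (reverse-++ (map suc (bottom T)) [ 2 + 2 * size T ]))
      (cong (2 + 2 * size T ∷_) (trans (cong (take k) (sym (reverse-map suc (bottom T))))
                                      (take-map k (reverse (bottom T)))))
    ending′ : ∀ {k} → k ≤ size T → descending (size (wrap T)) (suc k) ≡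
                      2 + 2 * size T ∷ map suc (descending (size T) k)
    ending′ {k} k≤n = trans (cong (λ n → descending (suc n) (suc k)) (length-map suc (top T)))
                            (descending-suc k≤n)

  reverse-bottom-⊕ : ∀ T U → reverse (bottom (T ⊕ U)) ≡
                     map (2 * size T +_) (reverse (bottom U)) ++ reverse (bottom T)
  reverse-bottom-⊕ T U = trans (reverse-++ (bottom T) _)
    (cong (_++ reverse (bottom T)) (sym (reverse-map _ (bottom U))))

  length-reversed : ∀ T U → length (map (2 * size T +_) (reverse (bottom U))) ≡ size U
  length-reversed T U = trans (length-map _ (reverse (bottom U)))
    (trans (length-reverse (bottom U)) (length-bottom U))

  2*size-⊕ : ∀ T U → 2 * size (T ⊕ U) ≡ 2 * size T + 2 * size U
  2*size-⊕ T U = trans (cong (2 *_) (size-⊕ T U)) (*-distribˡ-+ 2 (size T) (size U))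

  endsWith-⊕ : ∀ T U {k} → k ≤ size U → EndsWith (T ⊕ U) k ⇔ EndsWith U k
  endsWith-⊕ T U {k} k≤n = mk⇔
    (λ eq → map-injective (+-cancelˡ-≡ (2 * size T) _ _) (trans (sym ending) (trans eq ending′)))
    (λ eq → trans ending (trans (cong (map (2 * size T +_)) eq) (sym ending′)))
    where
    ending : take k (reverse (bottom (T ⊕ U))) ≡ map (2 * size T +_) (take k (reverse (bottom U)))
    ending = trans (cong (take k) (reverse-bottom-⊕ T U))
      (trans (take-++-≤ (subst (k ≤_) (sym (length-reversed T U)) k≤n))
             (take-map k (reverse (bottom U))))
    ending′ : descending (size (T ⊕ U)) k ≡ map (2 * size T +_) (descending (size U) k)
    ending′ = descending-shift (2 * size T) (size (T ⊕ U)) (2*size-⊕ T U) k≤n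

  -- Past the columns of U the bottom entries drop to at most 2|T|.
  ¬endsWith-⊕ : ∀ T U {k} → 1 ≤ size U → size U < k → k ≤ size T + size U → ¬ EndsWith (T ⊕ U) k
  ¬endsWith-⊕ T U {k} 1≤n n<k k≤ eq = go (reverse (bottom T)) refl
    where
    xs = map (2 * size T +_) (reverse (bottom U))
    m = size T
    n = size U
    go : ∀ ys → reverse (bottom T) ≡ ys → ⊥
    go [] eq′ = <⇒≱ n<k (subst (λ l → k ≤ l + n)
      (trans (sym (length-bottom T)) (trans (sym (length-reverse (bottom T))) (cong length eq′))) k≤)
    go (y ∷ ys) eq′ = <⇒≱ (subst (2 * m <_) (sym y≡) (m<m+n (2 * m) 1≤n)) y≤
      where
      y≤ : y ≤ 2 * m
      y≤ = proj₂ (bottom-bounds T (∈-resp-↭ (↭-reverse (bottom T)) (subst (y ∈_) (sym eq′) (here refl))))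
      y≡ : y ≡ 2 * m + n
      y≡ = begin
        y                              ≡⟨ prefix-value xs (2 * size (T ⊕ U) ∸_)
          (trans (cong (take k) (sym (trans (reverse-bottom-⊕ T U) (cong (xs ++_) eq′))))
                 (trans eq (map-upTo _ k)))
          (subst (_< k) (sym (length-reversed T U)) n<k) ⟩
        2 * size (T ⊕ U) ∸ length xs   ≡⟨ cong₂ _∸_ (2*size-⊕ T U) (length-reversed T U) ⟩
        2 * m + 2 * n ∸ n              ≡⟨ +-∸-assoc (2 * m) (m≤m+n n (n + 0)) ⟩
        2 * m + (2 * n ∸ n)            ≡⟨ cong (2 * m +_) (trans (m+n∸m≡n n (n + 0)) (+-identityʳ n)) ⟩
        2 * m + n                      ∎
        where open ≡-Reasoning

  rcomp-⊕ : ∀ T U → 1 ≤ size U → rcomp (T ⊕ U) ≡ rcomp U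
  rcomp-⊕ T U 1≤n = begin
    largest (endsWith? (T ⊕ U)) (size (T ⊕ U))    ≡⟨ cong (largest (endsWith? (T ⊕ U))) (size-⊕ T U) ⟩
    largest (endsWith? (T ⊕ U)) (size T + size U) ≡⟨ largest-none-above _ (size T) (size U)
                                                       (¬endsWith-⊕ T U 1≤n) ⟩
    largest (endsWith? (T ⊕ U)) (size U)          ≡⟨ largest-⇔ _ _ (size U) (endsWith-⊕ T U) ⟩
    largest (endsWith? U) (size U)                ∎
    where open ≡-Reasoning

  -- The new top entry 1 does not count: shifted bottom entries are at least 3, and the new one
  -- exceeds 2 because `T` is nonempty. The new bottom entry succeeds no shifted top entry, since no
  -- top entry of `T` is its maximum.
  noncons-ƛ : ∀ T → 1 ≤ size T → noncons (wrap T) ≡ noncons T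
  noncons-ƛ T 1≤n = trans
    (count-reject (λ i → suc i ∈? bottom (wrap T)) (map suc (top T)) 2∉)
    (count-map-⇔ _ _ suc (top T) (λ {x} x∈ → mk⇔ (down x∈)
      (λ 1+x∈ → ∈-++⁺ˡ (∈-map⁺ suc 1+x∈))))
    where
    2∉ : 2 ∉ map suc (bottom T) ++ [ 2 + 2 * size T ]
    2∉ 2∈ with ∈-++⁻ (map suc (bottom T)) 2∈
    ... | inj₁ 2∈b with _ , y∈ , refl ← ∈-map⁻ suc 2∈b = <-irrefl refl (bottom->1 T y∈)
    ... | inj₂ (here eq) = <⇒≢ (≤-trans 1≤n (m≤m+n (size T) _)) (suc-injective (suc-injective eq))
    down : ∀ {x} → x ∈ top T → 2 + x ∈ map suc (bottom T) ++ [ 2 + 2 * size T ] → suc x ∈ bottom T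
    down x∈ 2+x∈ with ∈-++⁻ (map suc (bottom T)) 2+x∈
    ... | inj₁ ∈b with _ , y∈ , refl ← ∈-map⁻ suc ∈b = y∈
    ... | inj₂ (here refl) = ⊥-elim (<-irrefl refl (top-<max T x∈))

  -- The maximum of `T` is in its bottom row, so the successor of a top entry never crosses the
  -- boundary.
  noncons-⊕ : ∀ T U → noncons (T ⊕ U) ≡ noncons T + noncons U
  noncons-⊕ T U = trans (count-++ (λ i → suc i ∈? bottom (T ⊕ U)) (top T) _)
    (cong₂ _+_ (count-⇔ _ _ (top T) (λ x∈ → mk⇔ (left x∈) ∈-++⁺ˡ))
               (count-map-⇔ _ _ (s +_) (top U) (λ {x} x∈ → mk⇔ (right x∈)
                 (λ 1+x∈ → ∈-++⁺ʳ (bottom T)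
                   (subst (_∈ map (s +_) (bottom U)) (+-suc s x) (∈-map⁺ (s +_) 1+x∈))))))
    where
    s = 2 * size T
    left : ∀ {x} → x ∈ top T → suc x ∈ bottom (T ⊕ U) → suc x ∈ bottom T
    left x∈ 1+x∈ with ∈-++⁻ (bottom T) 1+x∈
    ... | inj₁ ∈b = ∈b
    ... | inj₂ ∈b with y , y∈ , eq ← ∈-map⁻ (s +_) ∈b =
      ⊥-elim (<⇒≱ (m<m+n s (proj₁ (bottom-bounds U y∈))) (subst (_≤ s) eq (top-<max T x∈)))
    right : ∀ {x} → x ∈ top U → suc (s + x) ∈ bottom (T ⊕ U) → suc x ∈ bottom U
    right {x} x∈ 1+x∈ with ∈-++⁻ (bottom T) 1+x∈
    ... | inj₁ ∈b = ⊥-elim (<⇒≱ (s≤s (m≤m+n s x)) (proj₂ (bottom-bounds T ∈b)))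
    ... | inj₂ ∈b with y , y∈ , eq ← ∈-map⁻ (s +_) ∈b =
      subst (_∈ bottom U) (+-cancelˡ-≡ s y (suc x) (trans (sym eq) (sym (+-suc s x)))) y∈

  -- A top entry is not the maximum, so its successor is an entry and lies in exactly one row.
  noncons+cons : ∀ T → noncons T + cons T ≡ size T + 1
  noncons+cons T = trans (+-suc (noncons T) _) (trans
    (cong suc (count-split _ _ (top T) successor)) (+-comm 1 (size T)))
    where
    successor : ∀ {x} → x ∈ top T → (suc x ∈ bottom T × suc x ∉ top T) ⊎
                                     (suc x ∉ bottom T × suc x ∈ top T)
    successor x∈ with ∈-++⁻ (top T) (∈-perm⁺ (entries T) (s≤s z≤n) (top-<max T x∈))
    ... | inj₁ ∈t = inj₂ (top∩bottom T ∈t , ∈t)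
    ... | inj₂ ∈b = inj₁ (∈b , λ ∈t → top∩bottom T ∈t ∈b)

  recurrences : Recurrences operations comp rcomp noncons cons
  recurrences = record
    { size-e = refl
    ; size-ƛ = λ T → cong suc (length-map suc (top T))
    ; size-⊕ = size-⊕
    ; s-e = refl
    ; s-ƛ = comp-ƛ
    ; s-⊕ = comp-⊕
    ; r-e = refl
    ; r-ƛ = rcomp-ƛ
    ; r-⊕ = rcomp-⊕
    ; l-ƛe = refl
    ; l-ƛ = noncons-ƛ
    ; l-⊕ = λ T U _ _ → noncons-⊕ T U
    ; l+i = λ T _ → noncons+cons T
    }

-- Non-crossing partitions: the first block and the flattened form

module NonCrossingPartitionStatistics where
  open NonCrossingPartitions
  open NonCrossingPartition

  bounded : ∀ P → All (Small (size P)) (blockList P)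
  bounded P = AllP.concat⁻ (All-perm (size P) (partition P))

  -- Blocks are sorted by minimum: if 1 lay in a later block, the first one would contain a smaller
  -- element.
  1∈first : ∀ {n B Bs} → concat (B ∷ Bs) ↭ range n → All (_≢ []) (B ∷ Bs) →
            AllPairs _≺_ (B ∷ Bs) → 1 ∈ B
  1∈first {n} {B} {Bs} perm (B≢[] ∷ _) (B≺ ∷ _)
    with x , x∈ ← nonEmpty-∈ B≢[]
    with 1≤x , x≤n ← ∈-perm⁻ perm (∈-++⁺ˡ x∈)
    with ∈-++⁻ B (∈-perm⁺ perm ≤-refl (≤-trans 1≤x x≤n))
  ... | inj₁ 1∈B = 1∈B
  ... | inj₂ 1∈Bs with C , 1∈C , C∈ ← ∈-concat⁻′ Bs 1∈Bs
                  with y , y∈ , y< ← All.lookup B≺ C∈ =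
    ⊥-elim (<⇒≱ (All.lookup y< 1∈C) (proj₁ (∈-perm⁻ perm (∈-++⁺ˡ y∈))))

  insertWith1-first : ∀ m {B} Bs → 1 ∈ B → insertWith1 m (B ∷ Bs) ≡ (m ∷ B) ∷ Bs
  insertWith1-first m {B} Bs 1∈B rewrite dec-true (1 ∈? B) 1∈B = refl

  -- As 1 lies in the first block, insertion alters only the head of the list; the view holds the
  -- lists before and after it.
  data FirstBlock : NonCrossingPartition → Set where
    noBlock : ∀ {P} → blockList P ≡ [] → FirstBlock P
    starts  : ∀ {P} B Bs → blockList P ≡ B ∷ Bs → 1 ∈ B →
               blockList (addMax P) ≡ (suc (size P) ∷ B) ∷ Bs → FirstBlock P

  firstBlock : ∀ P → FirstBlock P
  firstBlock P = go refl
    where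
    go : ∀ {Bs} → blockList P ≡ Bs → FirstBlock P
    go {[]}     eq = noBlock eq
    go {B ∷ Bs} eq = starts B Bs eq 1∈B
      (trans (cong (insertWith1 (suc (size P))) eq) (insertWith1-first (suc (size P)) Bs 1∈B))
      where
      1∈B : 1 ∈ B
      1∈B = 1∈first (subst (λ bs → concat bs ↭ range (size P)) eq (partition P))
        (subst (All (_≢ [])) eq (nonEmpty P)) (subst (AllPairs _≺_) eq (sorted P))

  size-empty : ∀ P → blockList P ≡ [] → size P ≡ 0
  size-empty P eq = trans (sym (length-range (size P)))
    (trans (sym (↭-length (partition P))) (cong (length ∘ concat) eq))

  -- The block of 1 comes first and is listed in decreasing order, so the new maximum leads the
  -- flattened form.
  concat-addMax : ∀ P → concat (blockList (addMax P)) ≡ suc (size P) ∷ concat (blockList P)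
  concat-addMax P with firstBlock P
  ... | noBlock eq rewrite eq = refl
  ... | starts B Bs eq _ eq′ rewrite eq′ | eq = refl

  -- Source of indecomposability: a block with both extreme elements straddles every cut
  -- `k ≤ size P`.
  1,max∈first : ∀ P → ∃ λ B → B ∈ blockList (addMax P) × 1 ∈ B × suc (size P) ∈ B
  1,max∈first P with firstBlock P
  ... | noBlock eq rewrite eq | size-empty P eq = [ 1 ] , here refl , here refl , here refl
  ... | starts B Bs eq 1∈B eq′ rewrite eq′ =
    suc (size P) ∷ B , here refl , there 1∈B , here refl

  comp-ƛ : ∀ P → comp (addMax P) ≡ 1
  comp-ƛ P = count-only-last (initialSegmentIsUnion? (addMax P)) (size P) notUnion
    (All.map (λ small → inj₁ (All.map proj₂ small)) (bounded (addMax P)))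
    where
    notUnion : ∀ {k} → 1 ≤ k → k ≤ size P → ¬ InitialSegmentIsUnion (addMax P) k
    notUnion 1≤k k≤n union with B , B∈ , 1∈B , max∈B ← 1,max∈first P with All.lookup union B∈
    ... | inj₁ B≤k = <⇒≱ (s≤s k≤n) (All.lookup B≤k max∈B)
    ... | inj₂ k<B = <⇒≱ (All.lookup k<B 1∈B) 1≤k

  -- For a cut `k ≤ m` all blocks of `Q` lie above it, and for a cut `m + k` all blocks of `P` lie
  -- below it, so each cut tests one summand only.
  comp-⊕ : ∀ P Q → comp (P ⊕ Q) ≡ comp P + comp Q
  comp-⊕ P Q = count-range-+ (initialSegmentIsUnion? P) (initialSegmentIsUnion? Q)
    (initialSegmentIsUnion? (P ⊕ Q)) m (size Q)
    (λ _ k≤m → mk⇔ (AllP.++⁻ˡ (blockList P))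
      (λ union → AllP.++⁺ union (AllP.map⁺ (All.map
        (λ small → inj₂ (AllP.map⁺ (All.map
          (λ { (1≤y , _) → ≤-<-trans k≤m (m<m+n m 1≤y) }) small))) (bounded Q)))))
    (λ {k} _ _ → mk⇔
      (λ union → All.map (Sum.map (All.map (+-cancelˡ-≤ m _ _) ∘ AllP.map⁻)
                                  (All.map (+-cancelˡ-< m _ _) ∘ AllP.map⁻))
                         (AllP.map⁻ (AllP.++⁻ʳ (blockList P) union)))
      (λ union → AllP.++⁺
        (All.map (λ small → inj₁ (All.map (λ { (_ , x≤m) → ≤-trans x≤m (m≤m+n m k) }) small))
                 (bounded P))
        (AllP.map⁺ (All.map (Sum.map (AllP.map⁺ ∘ All.map (+-monoʳ-≤ m))
                                     (AllP.map⁺ ∘ All.map (+-monoʳ-< m))) union))))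
    where m = size P

  rcomp-ƛ : ∀ P → rcomp (addMax P) ≡ 1 + rcomp P
  rcomp-ƛ P rewrite concat-addMax P
                  | dec-true (rlMax? (suc (size P)) (concat (blockList P)))
                      (All.map (λ { (_ , x≤n) → s≤s x≤n }) (All-perm (size P) (partition P))) = refl

  rcomp-⊕ : ∀ P Q → 1 ≤ size Q → rcomp (P ⊕ Q) ≡ rcomp Q
  rcomp-⊕ P Q 1≤Q = trans
    (cong (countEntries rlMax?) (trans (sym (concat-++ (blockList P) _))
      (cong (concat (blockList P) ++_) (concat-map (blockList Q)))))
    (rlMax-shifted-++ (size P) (All.map proj₂ (All-perm (size P) (partition P)))
      (All.map proj₁ (All-perm (size Q) (partition Q)))
      (subst (1 ≤_) (sym (trans (↭-length (partition Q)) (length-range (size Q)))) 1≤Q))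

  blocks-ƛ : ∀ P → 1 ≤ size P → blocks (addMax P) ≡ blocks P
  blocks-ƛ P 1≤P with firstBlock P
  ... | noBlock eq = ⊥-elim (<⇒≢ 1≤P (sym (size-empty P eq)))
  ... | starts B Bs eq _ eq′ = trans (cong length eq′) (cong length (sym eq))

  blocks≤size : ∀ P → blocks P ≤ size P
  blocks≤size P = subst (blocks P ≤_) (trans (↭-length (partition P)) (length-range (size P)))
    (length≤concat (nonEmpty P))
    where
    length≤concat : ∀ {Bs : List (List ℕ)} → All (_≢ []) Bs → length Bs ≤ length (concat Bs)
    length≤concat [] = z≤n
    length≤concat {[] ∷ Bs}      (B≢[] ∷ _) = ⊥-elim (B≢[] refl)
    length≤concat {(x ∷ B) ∷ Bs} (_ ∷ ps)   = s≤s (≤-trans (length≤concat ps)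
      (subst (length (concat Bs) ≤_) (sym (length-++ B)) (m≤n+m _ (length B))))

  recurrences : Recurrences operations comp rcomp blocks nonmin
  recurrences = record
    { size-e = refl
    ; size-ƛ = λ P → refl
    ; size-⊕ = λ P Q → refl
    ; s-e = refl
    ; s-ƛ = comp-ƛ
    ; s-⊕ = comp-⊕
    ; r-e = refl
    ; r-ƛ = rcomp-ƛ
    ; r-⊕ = rcomp-⊕
    ; l-ƛe = refl
    ; l-ƛ = blocks-ƛ
    ; l-⊕ = λ P Q _ _ → trans (length-++ (blockList P)) (cong (blocks P +_) (length-map _ (blockList Q)))
    ; l+i = λ P _ → m+[n∸m]≡n (≤-trans (blocks≤size P) (m≤m+n (size P) 1))
    }

mainTheorem3 : Transports DyckPaths.operations
    DyckPaths.comp DyckPaths.rcomp DyckPaths.peak DyckPaths.nonpeak ×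
    Transports Triangulations.operations
    Triangulations.comp Triangulations.rcomp Triangulations.tr Triangulations.nontr ×
    Transports Permutations231.operations
    Permutations231.comp Permutations231.rmax Permutations231.rmin Permutations231.nonrmin ×
    Transports Permutations321.operations
    Permutations321.comp Permutations321.rcomp Permutations321.rmin Permutations321.nonrmin ×
    Transports BinaryTrees.operations
    BinaryTrees.comp BinaryTrees.rcomp BinaryTrees.redge BinaryTrees.ledge ×
    Transports Tableaux.operations
    Tableaux.comp Tableaux.rcomp Tableaux.noncons Tableaux.cons ×
    Transports NonCrossingPartitions.operations
    NonCrossingPartitions.comp NonCrossingPartitions.rcomp
    NonCrossingPartitions.blocks NonCrossingPartitions.nonmin
mainTheorem3 =
  recurrences⇒transports DyckPathStatistics.recurrences ,
  recurrences⇒transports TriangulationStatistics.recurrences ,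
  recurrences⇒transports Permutation231Statistics.recurrences ,
  recurrences⇒transports Permutation321Statistics.recurrences ,
  recurrences⇒transports BinaryTreeStatistics.recurrences ,
  recurrences⇒transports TableauStatistics.recurrences ,
  recurrences⇒transports NonCrossingPartitionStatistics.recurrences
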